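{- Let $k\ge1$ and $n\ge 2k+1$. There is a bijection between the $k$-triangulations of a convex $n$-gon (vertices labeled $1,\dots,n$ counterclockwise) with degree sequence $(d_1,\dots,d_{n-k-1})$ and the $k$-tuples $\mathbf P\in\mathcal D_n^k$ with parameters $(h_0,h_1,\dots,h_k)$ and $(u_1,\dots,u_{n-2k-2})$, where $$d_i=\begin{cases}h_{i-1}&\text{if }1\le i\le k+1,\\ n-i-k-u_{i-k-1}&\text{if }k+1<i\le n-k-1.\end{cases}$$
   Context: A $k$-triangulation of a convex $n$-gon is a maximal set of diagonals such that no $k+1$ of them mutually cross. Diagonals between vertices at distance at most $k$ (distance = number of polygon sides separating them) are trivial; the neighbors of a vertex are the vertices joined to it by a nontrivial diagonal. For a $k$-triangulation, $d_i$ is the number of neighbors of vertex $i$ among $i+1,\dots,n$, and $(d_1,\dots,d_{n-k-1})$ is its degree sequence. Let $m=n-2k-1$, $T=N^mE^m$, $B=(EN)^m$ (steps $N=(0,1)$, $E=(1,0)$). $\mathcal D_n^k$ is the set of $k$-tuples $(P_1,\dots,P_k)$ of $N/E$ lattice paths from the origin to $(m,m)$, each weakly above $B$ and weakly below $T$, with $P_i$ weakly above $P_{i+1}$. With $P_0=T$, $P_{k+1}=B$, $h_i$ is the number of east steps on which $P_i$ and $P_{i+1}$ coincide ($0\le i\le k$), and $u_s$ ($1\le s\le m-1$) is the number of unit east steps at $y$-coordinate $m-s$ lying strictly between $T$ and $B$ and not used by any $P_i$. -}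

module Defs where

open import Data.Bool using (Bool; true; false; _∧_; not; if_then_else_)
open import Data.Nat using (ℕ; zero; suc; _+_; _*_; _∸_; _≤_; _<_; _<ᵇ_; _≤ᵇ_; _⊓_)
open import Data.Nat.Properties using (m∸n≤m; ≤-trans)
open import Data.Fin using (Fin; toℕ; inject≤)
open import Data.List using (List; []; _∷_; _++_; replicate; concat; length; filterᵇ; allFin; upTo; zipWith)
open import Data.Bool.ListAction using (any)
open import Data.Vec using (Vec; lookup; tabulate; toList)
open import Data.Product using (Σ; _×_; _,_; proj₁)
open import Data.Sum using (_⊎_)
open import Relation.Nullary using (¬_; does)
open import Relation.Binary.PropositionalEquality using (_≡_; _≢_)
import Relation.Binary.PropositionalEquality as PE
open import Relation.Binary.Bundles using (Setoid)
import Relation.Binary.Construct.On as On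
open import Data.Product.Properties using (≡-dec)
import Data.Nat.Properties as ℕP
open import Data.List.Membership.DecPropositional (≡-dec ℕP._≟_ ℕP._≟_) using (_∈?_)

-- Polygon side.  Vertices 1,…,n of the paper are Fin n (vertex i ↦ i-1).
-- A set of diagonals is a Boolean matrix E; entry E[a][b] = true means the
-- diagonal {a,b} is present.  Canonical form: only entries with a < b may
-- be true (each diagonal stored once, as (smaller, larger)).

DiagSet : ℕ → Set
DiagSet n = Vec (Vec Bool n) n

In : ∀ {n} → DiagSet n → Fin n → Fin n → Set
In E a b = lookup (lookup E a) b ≡ true

Canonical : ∀ {n} → DiagSet n → Set
Canonical {n} E = ∀ (a b : Fin n) → In E a b → toℕ a < toℕ b

Cross : ∀ {n} → Fin n × Fin n → Fin n × Fin n → Set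
Cross (a , b) (c , d) =
  (toℕ a < toℕ c × toℕ c < toℕ b × toℕ b < toℕ d) ⊎
  (toℕ c < toℕ a × toℕ a < toℕ d × toℕ d < toℕ b)

HasCrossing : ∀ {n} (k : ℕ) → (Fin n → Fin n → Set) → Set
HasCrossing {n} k S =
  Σ (Fin (suc k) → Fin n × Fin n) λ f →
    (∀ i → S (proj₁ (f i)) (Data.Product.proj₂ (f i))) ×
    (∀ i j → i ≢ j → Cross (f i) (f j))

Add : ∀ {n} → (Fin n → Fin n → Set) → Fin n → Fin n → Fin n → Fin n → Set
Add S a b c d = S c d ⊎ (c ≡ a × d ≡ b)

IsKTriangulation : (n k : ℕ) → DiagSet n → Set
IsKTriangulation n k E =
  Canonical E ×
  ¬ HasCrossing k (In E) ×
  (∀ (a b : Fin n) → toℕ a < toℕ b → ¬ In E a b → HasCrossing k (Add (In E) a b))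

-- distance (number of polygon sides separating a and b), for a < b
dist : (n : ℕ) → Fin n → Fin n → ℕ
dist n a b = (toℕ b ∸ toℕ a) ⊓ (n ∸ (toℕ b ∸ toℕ a))

-- number of neighbours (via nontrivial diagonals) of v among later vertices
deg : (n k : ℕ) → DiagSet n → Fin n → ℕ
deg n k E v = length (filterᵇ
  (λ j → (toℕ v <ᵇ toℕ j) ∧ lookup (lookup E v) j ∧ (k <ᵇ dist n v j))
  (allFin n))

-- degree sequence (d_1,…,d_{n-k-1}); entry j (0-based) is d_{j+1}
degSeq : (n k : ℕ) → DiagSet n → Vec ℕ (n ∸ k ∸ 1)
degSeq n k E = tabulate λ j →
  deg n k E (inject≤ j (≤-trans (m∸n≤m (n ∸ k) 1) (m∸n≤m n k)))

data Step : Set where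
  N E : Step

countN : List Step → ℕ
countN [] = 0
countN (N ∷ s) = suc (countN s)
countN (E ∷ s) = countN s

take : ℕ → List Step → List Step
take zero _ = []
take (suc t) [] = []
take (suc t) (x ∷ s) = x ∷ take t s

yAfter : List Step → ℕ → ℕ
yAfter p t = countN (take t p)

msz : ℕ → ℕ → ℕ
msz n k = n ∸ (2 * k) ∸ 1

ValidPath : ℕ → List Step → Set
ValidPath m p = length p ≡ m + m × countN p ≡ m

-- P weakly above Q (paths of equal length): at every time t the
-- y-coordinate of P is at least that of Q
WeaklyAbove : List Step → List Step → Set
WeaklyAbove P Q = ∀ t → yAfter Q t ≤ yAfter P t

Tpath : ℕ → List Step
Tpath m = replicate m N ++ replicate m E

Bpath : ℕ → List Step
Bpath m = concat (replicate m (E ∷ N ∷ []))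

InD : (n k : ℕ) → Vec (List Step) k → Set
InD n k Ps =
  (∀ i → ValidPath (msz n k) (lookup Ps i)) ×
  (∀ i → WeaklyAbove (lookup Ps i) (Bpath (msz n k))) ×
  (∀ i → WeaklyAbove (Tpath (msz n k)) (lookup Ps i)) ×
  (∀ (i j : Fin k) → toℕ j ≡ suc (toℕ i) → WeaklyAbove (lookup Ps i) (lookup Ps j))

-- unit east steps of a path, each recorded by its left endpoint (x,y)
eastFrom : ℕ → ℕ → List Step → List (ℕ × ℕ)
eastFrom x y [] = []
eastFrom x y (E ∷ s) = (x , y) ∷ eastFrom (suc x) y s
eastFrom x y (N ∷ s) = eastFrom x (suc y) s

eastSteps : List Step → List (ℕ × ℕ)
eastSteps = eastFrom 0 0

uses : List Step → ℕ × ℕ → Bool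
uses P e = does (e ∈? eastSteps P)

common : List Step → List Step → ℕ
common P Q = length (filterᵇ (uses Q) (eastSteps P))

extended : (n k : ℕ) → Vec (List Step) k → List (List Step)
extended n k Ps = Tpath (msz n k) ∷ (toList Ps ++ Bpath (msz n k) ∷ [])

tailL : ∀ {A : Set} → List A → List A
tailL [] = []
tailL (_ ∷ xs) = xs

nth : List ℕ → ℕ → ℕ
nth [] _ = 0
nth (x ∷ xs) zero = x
nth (x ∷ xs) (suc i) = nth xs i

hpar : (n k : ℕ) → Vec (List Step) k → ℕ → ℕ
hpar n k Ps i = nth (zipWith common (extended n k Ps) (tailL (extended n k Ps))) i

-- u_s, 1 ≤ s ≤ m-1: unit east steps (x, m-s) with 0 ≤ x < m-s (i.e. strictly
-- between T and B) not used by any P_i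
upar : (n k : ℕ) → Vec (List Step) k → ℕ → ℕ
upar n k Ps s = length (filterᵇ
  (λ x → not (any (λ P → uses P (x , msz n k ∸ s)) (toList Ps)))
  (upTo (msz n k ∸ s)))

predicted : (n k : ℕ) → Vec (List Step) k → ℕ → ℕ
predicted n k Ps i =
  if i ≤ᵇ suc k then hpar n k Ps (i ∸ 1)
  else n ∸ i ∸ k ∸ upar n k Ps (i ∸ k ∸ 1)

Matches : (n k : ℕ) → Vec ℕ (n ∸ k ∸ 1) → Vec (List Step) k → Set
Matches n k d Ps = ∀ (j : Fin (n ∸ k ∸ 1)) → lookup d j ≡ predicted n k Ps (suc (toℕ j))

-- The two sets, as setoids whose equality is equality of the underlying
-- combinatorial data (proofs of the properties are ignored).

KTriSetoid : (n k : ℕ) → Vec ℕ (n ∸ k ∸ 1) → Setoid _ _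
KTriSetoid n k d = On.setoid {B = Σ (DiagSet n) λ E → IsKTriangulation n k E × degSeq n k E ≡ d}
  (PE.setoid (DiagSet n)) proj₁

PathSetoid : (n k : ℕ) → Vec ℕ (n ∸ k ∸ 1) → Setoid _ _
PathSetoid n k d = On.setoid {B = Σ (Vec (List Step) k) λ Ps → InD n k Ps × Matches n k d Ps}
  (PE.setoid (Vec (List Step) k)) proj₁

-- Let m = n − 2k − 1.  Read the rows of the triangle of nontrivial diagonals
-- one after the other, an absent diagonal {a, b} being the adjacent
-- transposition number b − a − k.  Thresholding the resulting sorting process
-- computes longest chains of present diagonals, so a set of diagonals has no
-- (k+1)-crossing iff its absent diagonals sort the identity of S_{m+1} into
-- w₀, and it is maximal iff they form a reduced word.  Hence, with a weight xᵢ
-- for each nontrivial diagonal from vertex i to a later one, the generating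
-- function of k-triangulations is the coefficient of w₀ in a product of rows
-- (xᵢ + u₁)(xᵢ + u₂)⋯(xᵢ + u_l) in the nilCoxeter algebra.  Families of paths
-- with the weights of the theorem are counted by a product of transfer
-- operators, one for each common-step parameter hᵢ.
--
-- Truncate the last factors on either side: force the last diagonal of a row
-- to be present, respectively keep the path below height m.  If Φ(α₁ … αⱼ | β₁ … βᵣ) is the
-- generating function in which the factors with weights β are truncated, then
-- on both sides
--   (β − α) Φ(fs α β | bs) = β Φ(fs α | β bs) − α Φ(fs β | α bs).
-- So for distinct weights Φ is determined by the case of a single untruncated
-- factor, which is the same problem for m − 1.  Evaluating at powers of a
-- large number recovers the number of objects with given parameters, and equal
-- finite numbers give the bijection.
module Submission where

-- For i > k+1 the predicted degree is the number of used interior edges at one height. An edge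
-- shared by several paths must be charged once; it is charged to the highest path through it, which
-- is recognised by comparing that path with its upper neighbour. This locality is what makes
-- transfer operators possible.
--
-- The size drops by one for a concrete reason on each side. If every row behind the first is
-- truncated, the smallest letter can reach the last place only in the first row, so all letters of
-- that row are forced. If all paths stay below the top level, their last column is forced, and the
-- edges just below T act as contacts with a smaller T. On both sides the weight of the longest
-- shortened row, or of the highest interior level, becomes an additional full factor, but at
-- opposite ends of the list; this is why rows of equal length have to commute.
--
-- All identities live in the natural numbers: negative terms are moved across, divided differences
-- get their own recursion, and a factor β - α is cancelled by comparing two instances of the same
-- equation.

open import Data.Nat.Base using (NonZero; nonZero)
open import Data.Bool using (Bool; true; false; _∧_; not; if_then_else_; T)
open import Data.Nat using (ℕ; zero; suc; _+_; _*_; _∸_; _^_; _≤_; _<_; z≤n; s≤s; _<ᵇ_; _≤ᵇ_; _⊓_; _≤?_; _<?_; _≟_)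
open import Data.Nat.Tactic.RingSolver using (solve-∀)
open import Data.Vec using (Vec; []; _∷_)
open import Data.List using (List; []; _∷_; _++_; foldr; cartesianProductWith)
open import Data.Product using (Σ; _×_; _,_; proj₁; proj₂)
open import Data.Sum using (_⊎_; inj₁; inj₂)
open import Data.Empty using (⊥; ⊥-elim)
open import Data.Unit using (tt)
open import Function using (_∘_; id)
open import Relation.Nullary using (¬_; Dec; yes; no; does)
open import Relation.Binary.PropositionalEquality using (_≡_; _≢_; refl; sym; trans; cong; cong₂; subst; subst₂; module ≡-Reasoning)
open import Relation.Binary.Definitions using (tri<; tri≈; tri>)
import Data.Bool as Bool
import Data.Bool.Properties as Bp
import Data.Fin.Properties as Fp
import Data.List as List
import Data.List.Properties as Lp
import Data.List.Relation.Binary.Permutation.Propositional.Properties as Pm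
import Data.List.Relation.Binary.Permutation.Setoid.Properties as PmS
import Data.List.Relation.Unary.All as All
import Data.List.Relation.Unary.All.Properties as Allₚ
import Data.List.Relation.Unary.Unique.Propositional.Properties as Uq
import Data.Nat.Properties as Np
import Data.Vec as Vec
import Data.Vec.Properties as Vp
import Relation.Binary.Construct.On as On

-- Finite sums, and lattice paths as vectors of heights.

module Sums where
  open import Data.List.Membership.Propositional using (_∈_)
  open import Data.List.Membership.Propositional.Properties using (∈-++⁺ˡ; ∈-++⁺ʳ; ∈-++⁻; ∈-map⁺; ∈-map⁻)
  open import Data.List.Relation.Unary.Any using (here; there)

  variable
    A B C : Set
    m : ℕ

  +-exchange : ∀ a b c → a + (b + c) ≡ b + (a + c)
  +-exchange = solve-∀

  *-exchange : ∀ a b c → a * (b * c) ≡ b * (a * c)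
  *-exchange = solve-∀

  ∑ : List A → (A → ℕ) → ℕ
  ∑ [] f = 0
  ∑ (x ∷ xs) f = f x + ∑ xs f

  ∑-cong∈ : (xs : List A) {f g : A → ℕ} → (∀ x → x ∈ xs → f x ≡ g x) → ∑ xs f ≡ ∑ xs g
  ∑-cong∈ [] e = refl
  ∑-cong∈ (x ∷ xs) e = cong₂ _+_ (e x (here refl)) (∑-cong∈ xs λ y p → e y (there p))

  ∑-cong : (xs : List A) {f g : A → ℕ} → (∀ x → f x ≡ g x) → ∑ xs f ≡ ∑ xs g
  ∑-cong xs e = ∑-cong∈ xs λ x _ → e x

  ∑-++ : (xs ys : List A) (f : A → ℕ) → ∑ (xs ++ ys) f ≡ ∑ xs f + ∑ ys f
  ∑-++ [] ys f = sym (Np.+-identityˡ _)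
  ∑-++ (x ∷ xs) ys f = trans (cong (f x +_) (∑-++ xs ys f)) (sym (Np.+-assoc (f x) _ _))

  ∑-map : (h : A → B) (xs : List A) (f : B → ℕ) → ∑ (List.map h xs) f ≡ ∑ xs (f ∘ h)
  ∑-map h [] f = refl
  ∑-map h (x ∷ xs) f = cong (f (h x) +_) (∑-map h xs f)

  ∑-zero : (xs : List A) → ∑ xs (λ _ → 0) ≡ 0
  ∑-zero [] = refl
  ∑-zero (x ∷ xs) = trans (Np.+-identityˡ _) (∑-zero xs)

  ∑-scale : (c : ℕ) (xs : List A) (f : A → ℕ) → ∑ xs (λ x → c * f x) ≡ c * ∑ xs f
  ∑-scale c [] f = sym (Np.*-zeroʳ c)
  ∑-scale c (x ∷ xs) f = trans (cong (c * f x +_) (∑-scale c xs f)) (sym (Np.*-distribˡ-+ c (f x) _))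

  ∑-add : (xs : List A) (f g : A → ℕ) → ∑ xs (λ x → f x + g x) ≡ ∑ xs f + ∑ xs g
  ∑-add [] f g = refl
  ∑-add (x ∷ xs) f g = trans (cong ((f x + g x) +_) (∑-add xs f g)) (lem (f x) (g x) (∑ xs f) (∑ xs g))
    where
    lem : ∀ a b c d → (a + b) + (c + d) ≡ (a + c) + (b + d)
    lem = solve-∀

  ∑-swap : (xs : List A) (ys : List B) (f : A → B → ℕ) →
    ∑ xs (λ x → ∑ ys (f x)) ≡ ∑ ys (λ y → ∑ xs (λ x → f x y))
  ∑-swap [] ys f = sym (∑-zero ys)
  ∑-swap (x ∷ xs) ys f = trans (cong (∑ ys (f x) +_) (∑-swap xs ys f)) (sym (∑-add ys (f x) _))

  ∑-product : (f : A → B → C) (xs : List A) (ys : List B) (g : C → ℕ) →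
    ∑ (cartesianProductWith f xs ys) g ≡ ∑ xs (λ x → ∑ ys (λ y → g (f x y)))
  ∑-product f [] ys g = refl
  ∑-product f (x ∷ xs) ys g =
    trans (∑-++ (List.map (f x) ys) _ g) (cong₂ _+_ (∑-map (f x) ys g) (∑-product f xs ys g))

  -- Heights of the east steps of a path, last column first: in a vector of
  -- length m the entry followed by x others belongs to column x.

  data Decreasing : ℕ → Vec ℕ m → Set where
    []  : ∀ {Y} → Decreasing Y []
    _∷_ : ∀ {Y z} {y : Vec ℕ m} → z < Y → Decreasing (suc z) y → Decreasing Y (z ∷ y)

  decreasing-weaken : ∀ {Y Z} {y : Vec ℕ m} → Y ≤ Z → Decreasing Y y → Decreasing Z y
  decreasing-weaken le [] = []
  decreasing-weaken le (p ∷ d) = Np.≤-trans p le ∷ d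

  -- Splits on whether the first entry attains the largest allowed value `z`. The tail may then
  -- still equal `z`, so its bound is `suc z`: the vectors decrease only weakly.
  decreasings : (m Y : ℕ) → List (Vec ℕ m)
  decreasings zero Y = [] ∷ []
  decreasings (suc m) zero = []
  decreasings (suc m) (suc z) = decreasings (suc m) z ++ List.map (z ∷_) (decreasings m (suc z))

  ∈-decreasings⁻ : ∀ m Y {y : Vec ℕ m} → y ∈ decreasings m Y → Decreasing Y y
  ∈-decreasings⁻ zero Y {[]} _ = []
  ∈-decreasings⁻ (suc m) (suc z) y∈ with ∈-++⁻ (decreasings (suc m) z) y∈
  ... | inj₁ p = decreasing-weaken (Np.n≤1+n z) (∈-decreasings⁻ (suc m) z p)
  ... | inj₂ p with ∈-map⁻ (z ∷_) p
  ... | y , q , refl = Np.≤-refl ∷ ∈-decreasings⁻ m (suc z) q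

  ∈-decreasings⁺ : ∀ {m Y} {y : Vec ℕ m} → Decreasing Y y → y ∈ decreasings m Y
  ∈-decreasings⁺ [] = here refl
  ∈-decreasings⁺ {suc m} {suc Y} {z ∷ y} (s≤s p ∷ d) with z Np.≟ Y
  ... | yes refl = ∈-++⁺ʳ (decreasings (suc m) z) (∈-map⁺ (z ∷_) (∈-decreasings⁺ d))
  ... | no z≢Y = ∈-++⁺ˡ (∈-decreasings⁺ (Np.≤∧≢⇒< p z≢Y ∷ d))

  -- For `x = t` these are the heights of `Tpath t`; the two arguments are separate because
  -- inductions over the columns keep the height fixed.
  top : ∀ x → ℕ → Vec ℕ x
  top x t = Vec.replicate x t

  top-decreasing : ∀ x t → Decreasing (suc t) (top x t)
  top-decreasing zero t = []
  top-decreasing (suc x) t = Np.≤-refl ∷ top-decreasing x t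

  -- The heights of `Bpath`, whose east step in column `x` runs at height `x`.
  ground : ∀ x → Vec ℕ x
  ground zero = []
  ground (suc x) = x ∷ ground x

  ground-decreasing : ∀ m → Decreasing m (ground m)
  ground-decreasing zero = []
  ground-decreasing (suc x) = Np.≤-refl ∷ decreasing-weaken (Np.n≤1+n x) (ground-decreasing x)

  -- Weights of consecutive paths, and exchanging their contact weights.

  module PathAlgebra (s : ℕ → ℕ) where

    opaque
      -- The edge of column `x` at height `x` lies on B, so it is not interior and gets weight 1.
      -- Every other edge is charged according to its height.
      σ : ℕ → ℕ → ℕ
      σ x z with z Np.≟ x
      ... | yes _ = 1
      ... | no _ = s z

      σ-ground : ∀ x → σ x x ≡ 1
      σ-ground x with x Np.≟ x
      ... | yes _ = refl
      ... | no ne = ⊥-elim (ne refl)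

      σ-above : ∀ {x z} → x < z → σ x z ≡ s z
      σ-above {x} {z} x<z with z Np.≟ x
      ... | yes refl = ⊥-elim (Np.<-irrefl refl x<z)
      ... | no _ = refl

    opaque
      -- The factor contributed in column x by a path at height z whose upper
      -- neighbour is at height t.
      γ : ℕ → ℕ → ℕ → ℕ → ℕ
      γ x α t z with z <? x | Np.<-cmp z t
      ... | yes _ | _ = 0
      ... | no _ | tri< _ _ _ = σ x z
      ... | no _ | tri≈ _ _ _ = α
      ... | no _ | tri> _ _ _ = 0

      γ-low : ∀ {x α t z} → z < x → γ x α t z ≡ 0
      γ-low {x} {α} {t} {z} p with z <? x | Np.<-cmp z t
      ... | yes _ | _ = refl
      ... | no q | _ = ⊥-elim (q p)

      γ-high : ∀ {x α t z} → t < z → γ x α t z ≡ 0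
      γ-high {x} {α} {t} {z} p with z <? x | Np.<-cmp z t
      ... | yes _ | _ = refl
      ... | no _ | tri< _ _ n = ⊥-elim (n p)
      ... | no _ | tri≈ _ _ n = ⊥-elim (n p)
      ... | no _ | tri> _ _ _ = refl

      γ-equal : ∀ {x α t} → x ≤ t → γ x α t t ≡ α
      γ-equal {x} {α} {t} p with t <? x | Np.<-cmp t t
      ... | yes q | _ = ⊥-elim (Np.<⇒≱ q p)
      ... | no _ | tri< _ n _ = ⊥-elim (n refl)
      ... | no _ | tri≈ _ _ _ = refl
      ... | no _ | tri> _ n _ = ⊥-elim (n refl)

      γ-between : ∀ {x α t z} → x ≤ z → z < t → γ x α t z ≡ σ x z
      γ-between {x} {α} {t} {z} p q with z <? x | Np.<-cmp z t
      ... | yes r | _ = ⊥-elim (Np.<⇒≱ r p)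
      ... | no _ | tri< _ _ _ = refl
      ... | no _ | tri≈ n _ _ = ⊥-elim (n q)
      ... | no _ | tri> n _ _ = ⊥-elim (n q)

    -- In a product of such weights along a family, an interior edge shared by several paths
    -- contributes its `σ` only for the highest of them; the others see a contact.
    Γ : ℕ → Vec ℕ m → Vec ℕ m → ℕ
    Γ α [] [] = 1
    Γ {suc x} α (t ∷ τ) (z ∷ y) = γ x α t z * Γ α τ y

    -- U sums the weights of the paths below height Y between the paths τ and
    -- b.  V is the divided difference of U in the contact weights α, β; it has
    -- a subtraction-free recursion because of the telescoping identity below.
    U : ℕ → ℕ → Vec ℕ m → Vec ℕ m → ℕ → ℕ
    U α β [] [] Y = 1
    U α β (t ∷ τ) (b ∷ bs) zero = 0
    U {suc x} α β (t ∷ τ) (b ∷ bs) (suc z) =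
      U α β (t ∷ τ) (b ∷ bs) z + (γ x α t z * γ x β z b) * U α β τ bs (suc z)

    opaque
      V : ℕ → ℕ → Vec ℕ m → Vec ℕ m → ℕ → ℕ
      V α β [] [] Y = 0
      V {suc x} α β (t ∷ τ) (b ∷ bs) Y with x ≤? b | b <? Y | Y ≤? t
      ... | yes _ | yes _ | yes _ = σ x b * (U α β τ bs Y + α * V α β τ bs Y)
      ... | _ | _ | _ = 0

      V-[] : ∀ α β {Y} → V α β [] [] Y ≡ 0
      V-[] α β = refl

    module _ {x : ℕ} (α β : ℕ) (t : ℕ) (τ : Vec ℕ x) (b : ℕ) (bs : Vec ℕ x) where
      opaque
        unfolding V

        V-in : ∀ {Y} → x ≤ b → b < Y → Y ≤ t →
          V α β (t ∷ τ) (b ∷ bs) Y ≡ σ x b * (U α β τ bs Y + α * V α β τ bs Y)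
        V-in {Y} p q r with x ≤? b | b <? Y | Y ≤? t
        ... | yes _ | yes _ | yes _ = refl
        ... | yes _ | yes _ | no n = ⊥-elim (n r)
        ... | yes _ | no n | _ = ⊥-elim (n q)
        ... | no n | _ | _ = ⊥-elim (n p)

        V-out : ∀ {Y} → (b < x ⊎ Y ≤ b ⊎ t < Y) → V α β (t ∷ τ) (b ∷ bs) Y ≡ 0
        V-out {Y} out with x ≤? b | b <? Y | Y ≤? t
        ... | yes p | yes q | yes r = ⊥-elim (imp out)
          where
          imp : (b < x ⊎ Y ≤ b ⊎ t < Y) → ⊥
          imp (inj₁ h) = Np.<⇒≱ h p
          imp (inj₂ (inj₁ h)) = Np.<⇒≱ q h
          imp (inj₂ (inj₂ h)) = Np.<⇒≱ h r
        ... | yes _ | yes _ | no n = refl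
        ... | yes _ | no n | _ = refl
        ... | no n | _ | _ = refl

    -- The bound `Y` cuts nothing off when `τ` itself lies below it. In view of `U-swap` this says
    -- that the unrestricted `U` is symmetric in its two contact weights.
    V-top : ∀ {α β} {τ bs : Vec ℕ m} {Y} → Decreasing Y τ → V α β τ bs Y ≡ 0
    V-top {α = α} {β} {τ = []} {[]} [] = V-[] α β
    V-top {α = α} {β} {τ = t ∷ τ} {b ∷ bs} (p ∷ _) = V-out α β t τ b bs (inj₂ (inj₂ p))

    w-zero : ∀ {x α β t b z} → (b < x ⊎ z < b ⊎ t < z) → γ x α t z * γ x β z b ≡ 0
    w-zero {x} {α} {β} {t} {b} {z} (inj₁ p) =
      trans (cong (γ x α t z *_) (γ-low p)) (Np.*-zeroʳ (γ x α t z))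
    w-zero {x} {α} {β} {t} {b} {z} (inj₂ (inj₁ p)) =
      trans (cong (γ x α t z *_) (γ-high p)) (Np.*-zeroʳ (γ x α t z))
    w-zero {x} {α} {β} {t} {b} {z} (inj₂ (inj₂ p)) =
      trans (cong (_* γ x β z b) (γ-high p)) (Np.*-zeroˡ (γ x β z b))

    w-bottom : ∀ {x α β t b} → x ≤ b → b < t → γ x α t b * γ x β b b ≡ σ x b * β
    w-bottom p q = cong₂ _*_ (γ-between p q) (γ-equal p)

    w-both : ∀ {x α β b} → x ≤ b → γ x α b b * γ x β b b ≡ α * β
    w-both p = cong₂ _*_ (γ-equal p) (γ-equal p)

    w-top : ∀ {x α β t b} → x ≤ b → b < t → γ x α t t * γ x β t b ≡ α * σ x b
    w-top p q = cong₂ _*_ (γ-equal (Np.≤-trans p (Np.<⇒≤ q))) (γ-between p q)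

    w-middle : ∀ {x α β t b z} → x ≤ b → b < z → z < t → γ x α t z * γ x β z b ≡ s z * σ x b
    w-middle p q r = cong₂ _*_
      (trans (γ-between (Np.≤-trans p (Np.<⇒≤ q)) r) (σ-above (Np.≤-<-trans p q)))
      (γ-between p q)

    -- `U + α * V` behaves like a cumulative sum in the bound, with increment `s Y * V`. As `bs`
    -- lies below `Y`, an edge at height `Y` that contributes is off B, so its weight `s Y` does not
    -- depend on the column and the identity for the remaining columns can be substituted.
    U-telescope : ∀ {m} α β (τ bs : Vec ℕ m) {Y h} → Decreasing h τ → Decreasing Y bs →
      U α β τ bs (suc Y) + α * V α β τ bs (suc Y) ≡
      (U α β τ bs Y + α * V α β τ bs Y) + s Y * V α β τ bs (suc Y)
    U-telescope α β [] [] {Y} _ _ rewrite V-[] α β {suc Y} | V-[] α β {Y} = lem α (s Y)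
      where
      lem : ∀ a c → 1 + a * 0 ≡ (1 + a * 0) + c * 0
      lem = solve-∀
    U-telescope {suc x} α β (t ∷ τ) (b ∷ bs) {Y} (_ ∷ dτ) (b<Y ∷ db) with x ≤? b
    ... | no x≰b
      rewrite w-zero {x} {α} {β} {t} {b} {Y} (inj₁ (Np.≰⇒> x≰b))
            | V-out α β t τ b bs {suc Y} (inj₁ (Np.≰⇒> x≰b))
            | V-out α β t τ b bs {Y} (inj₁ (Np.≰⇒> x≰b))
      = lem (U α β (t ∷ τ) (b ∷ bs) Y) (U α β τ bs (suc Y)) α (s Y)
      where
      lem : ∀ u u' a c → (u + 0 * u') + a * 0 ≡ (u + a * 0) + c * 0
      lem = solve-∀
    ... | yes x≤b with Np.<-cmp Y t
    ... | tri< Y<t _ _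
      rewrite w-middle {x} {α} {β} x≤b b<Y Y<t
            | V-in α β t τ b bs x≤b (Np.m<n⇒m<1+n b<Y) Y<t
            | V-in α β t τ b bs x≤b b<Y (Np.<⇒≤ Y<t)
      = lem _ (s Y) (σ x b) _ α _ _ _ (U-telescope α β τ bs dτ (decreasing-weaken b<Y db))
      where
      lem : ∀ u c g u1 a v1 u0 v0 → u1 + a * v1 ≡ (u0 + a * v0) + c * v1 →
        (u + c * g * u1) + a * (g * (u1 + a * v1)) ≡
        (u + a * (g * (u0 + a * v0))) + c * (g * (u1 + a * v1))
      lem u c g u1 a v1 u0 v0 e = trans (l1 u c g u1 a v1 (u1 + a * v1))
          (trans (cong (λ q → u + c * g * u1 + a * (g * q)) e) (l2 u c g u1 a v1 (u0 + a * v0)))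
        where
        l1 : ∀ u c g u1 a v1 q → (u + c * g * u1) + a * (g * q) ≡ u + c * g * u1 + a * (g * q)
        l1 = solve-∀
        l2 : ∀ u c g u1 a v1 r → u + c * g * u1 + a * (g * (r + c * v1)) ≡
          (u + a * (g * r)) + c * (g * (u1 + a * v1))
        l2 = solve-∀
    -- At `Y = t` the edge is a contact of weight `α` instead of `s t`. The identity survives
    -- because the remaining columns of `τ` are at height at most `t`, so their `V` at `suc t` is
    -- zero.
    ... | tri≈ _ refl _
      rewrite w-top {x} {α} {β} x≤b b<Y
            | V-out α β t τ b bs {suc t} (inj₂ (inj₂ Np.≤-refl))
            | V-in α β t τ b bs x≤b b<Y Np.≤-refl
      = lem _ (s t) (σ x b) _ α _ _ _ (U-telescope α β τ bs dτ (decreasing-weaken b<Y db)) (V-top dτ)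
      where
      lem : ∀ u c g u1 a v1 u0 v0 → u1 + a * v1 ≡ (u0 + a * v0) + c * v1 → v1 ≡ 0 →
        (u + a * g * u1) + a * 0 ≡ (u + a * (g * (u0 + a * v0))) + c * 0
      lem u c g u1 a v1 u0 v0 e refl = trans (l1 u c g u1 a)
          (trans (cong (λ q → u + a * g * q) e) (l2 u c g a (u0 + a * v0)))
        where
        l1 : ∀ u c g u1 a → (u + a * g * u1) + a * 0 ≡ u + a * g * (u1 + a * 0)
        l1 = solve-∀
        l2 : ∀ u c g a r → u + a * g * (r + c * 0) ≡ (u + a * (g * r)) + c * 0
        l2 = solve-∀
    ... | tri> _ _ t<Y
      rewrite w-zero {x} {α} {β} {t} {b} {Y} (inj₂ (inj₂ t<Y))
            | V-out α β t τ b bs {suc Y} (inj₂ (inj₂ (Np.m<n⇒m<1+n t<Y)))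
            | V-out α β t τ b bs {Y} (inj₂ (inj₂ t<Y))
      = lem (U α β (t ∷ τ) (b ∷ bs) Y) (U α β τ bs (suc Y)) α (s Y)
      where
      lem : ∀ u u' a c → (u + 0 * u') + a * 0 ≡ (u + a * 0) + c * 0
      lem = solve-∀

    -- The equation `U α β - U β α = (β - α) V` without subtraction. Admitting one more height `z`
    -- in the leading column preserves it: at `z = b` the contact weights trade places, strictly
    -- between `b` and `t` the change is supplied by `U-telescope`, and at `z = t` the `V` of the
    -- remaining columns vanishes.
    U-swap : ∀ {m} α β (τ bs : Vec ℕ m) {h h'} → Decreasing h τ → Decreasing h' bs → ∀ Y →
      U α β τ bs Y + α * V α β τ bs Y ≡ U β α τ bs Y + β * V α β τ bs Y
    U-swap α β [] [] _ _ Y rewrite V-[] α β {Y} = lem α β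
      where
      lem : ∀ a c → 1 + a * 0 ≡ 1 + c * 0
      lem = solve-∀
    U-swap α β (t ∷ τ) (b ∷ bs) _ _ zero
      rewrite V-out α β t τ b bs {zero} (inj₂ (inj₁ z≤n)) = lem α β
      where
      lem : ∀ a c → 0 + a * 0 ≡ 0 + c * 0
      lem = solve-∀
    U-swap {suc x} α β (t ∷ τ) (b ∷ bs) dt@(_ ∷ dτ) dB@(_ ∷ db) (suc z) = go (x ≤? b)
      where
      u = U α β (t ∷ τ) (b ∷ bs) z
      ũ = U β α (t ∷ τ) (b ∷ bs) z
      ih : u + α * V α β (t ∷ τ) (b ∷ bs) z ≡ ũ + β * V α β (t ∷ τ) (b ∷ bs) z
      ih = U-swap α β (t ∷ τ) (b ∷ bs) dt dB z
      ih' : U α β τ bs (suc z) + α * V α β τ bs (suc z) ≡ U β α τ bs (suc z) + β * V α β τ bs (suc z)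
      ih' = U-swap α β τ bs dτ db (suc z)
      Goal : Set
      Goal = U α β (t ∷ τ) (b ∷ bs) (suc z) + α * V α β (t ∷ τ) (b ∷ bs) (suc z)
           ≡ U β α (t ∷ τ) (b ∷ bs) (suc z) + β * V α β (t ∷ τ) (b ∷ bs) (suc z)
      ihV : ∀ {v} → V α β (t ∷ τ) (b ∷ bs) z ≡ v → u + α * v ≡ ũ + β * v
      ihV e = subst (λ v → u + α * v ≡ ũ + β * v) e ih
      ihV' : ∀ {v} → V α β τ bs (suc z) ≡ v → U α β τ bs (suc z) + α * v ≡ U β α τ bs (suc z) + β * v
      ihV' e = subst (λ v → U α β τ bs (suc z) + α * v ≡ U β α τ bs (suc z) + β * v) e ih'
      drop0 : ∀ a {p q c} → p + a * 0 ≡ q + c * 0 → p ≡ q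
      drop0 a {p} {q} {c} e = trans (l p a) (trans e (sym (l q c)))
        where
        l : ∀ p a → p ≡ p + a * 0
        l = solve-∀
      outside : (b < x ⊎ z < b ⊎ t < z) → (b < x ⊎ z ≤ b ⊎ t < z) → (b < x ⊎ suc z ≤ b ⊎ t < suc z) → Goal
      outside o o₀ o₁
        rewrite w-zero {x} {α} {β} {t} {b} {z} o | w-zero {x} {β} {α} {t} {b} {z} o
              | V-out α β t τ b bs {suc z} o₁
        = cong₂ _+_ (cong (_+ 0) (drop0 α {c = β} (ihV (V-out α β t τ b bs o₀)))) (trans (Np.*-zeroʳ α) (sym (Np.*-zeroʳ β)))
      go : Dec (x ≤ b) → Goal
      go (no x≰b) = outside (inj₁ (Np.≰⇒> x≰b)) (inj₁ (Np.≰⇒> x≰b)) (inj₁ (Np.≰⇒> x≰b))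
      go (yes x≤b) with Np.<-cmp z b
      ... | tri< z<b _ _ = outside (inj₂ (inj₁ z<b)) (inj₂ (inj₁ (Np.<⇒≤ z<b))) (inj₂ (inj₁ z<b))
      ... | tri≈ _ refl _ with Np.<-cmp b t
      ...   | tri< b<t _ _
        rewrite w-bottom {x} {α} {β} x≤b b<t | w-bottom {x} {β} {α} x≤b b<t
              | V-in α β t τ b bs x≤b Np.≤-refl b<t
        = lem u ũ (σ x b) α β _ _ _ (drop0 α {c = β} (ihV (V-out α β t τ b bs {b} (inj₂ (inj₁ Np.≤-refl))))) ih'
        where
        lem : ∀ u ũ g a c u1 ũ1 v1 → u ≡ ũ → u1 + a * v1 ≡ ũ1 + c * v1 →
          (u + g * c * u1) + a * (g * (u1 + a * v1)) ≡ (ũ + g * a * ũ1) + c * (g * (u1 + a * v1))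
        lem u _ g a c u1 ũ1 v1 refl e = trans (cong (λ q → (u + g * c * u1) + a * (g * q)) e) (l u g a c u1 ũ1 v1)
          where
          l : ∀ u g a c u1 ũ1 v1 → (u + g * c * u1) + a * (g * (ũ1 + c * v1)) ≡ (u + g * a * ũ1) + c * (g * (u1 + a * v1))
          l = solve-∀
      ...   | tri≈ _ refl _
        rewrite w-both {x} {α} {β} x≤b | w-both {x} {β} {α} x≤b
              | V-out α β b τ b bs {suc b} (inj₂ (inj₂ Np.≤-refl))
        = lem u ũ α β _ _ (drop0 α {c = β} (ihV (V-out α β b τ b bs {b} (inj₂ (inj₁ Np.≤-refl))))) (drop0 α {c = β} (ihV' (V-top dτ)))
        where
        lem : ∀ u ũ a c u1 ũ1 → u ≡ ũ → u1 ≡ ũ1 → (u + a * c * u1) + a * 0 ≡ (ũ + c * a * ũ1) + c * 0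
        lem u _ a c u1 _ refl refl = l u a c u1
          where
          l : ∀ u a c u1 → (u + a * c * u1) + a * 0 ≡ (u + c * a * u1) + c * 0
          l = solve-∀
      ...   | tri> _ _ t<b = outside (inj₂ (inj₂ t<b)) (inj₂ (inj₂ t<b)) (inj₂ (inj₂ (Np.m<n⇒m<1+n t<b)))
      go (yes x≤b) | tri> _ _ b<z with Np.<-cmp z t
      ...   | tri< z<t _ _
        rewrite w-middle {x} {α} {β} x≤b b<z z<t | w-middle {x} {β} {α} x≤b b<z z<t
              | V-in α β t τ b bs x≤b (Np.m<n⇒m<1+n b<z) z<t
        = lem u ũ (s z) (σ x b) α β _ _ _ _ _ (ihV (V-in α β t τ b bs x≤b b<z (Np.<⇒≤ z<t))) ih' (U-telescope α β τ bs dτ (decreasing-weaken b<z db))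
        where
        lem : ∀ u ũ c g a d u1 ũ1 v1 u0 v0 →
          u + a * (g * (u0 + a * v0)) ≡ ũ + d * (g * (u0 + a * v0)) →
          u1 + a * v1 ≡ ũ1 + d * v1 → u1 + a * v1 ≡ (u0 + a * v0) + c * v1 →
          (u + c * g * u1) + a * (g * (u1 + a * v1)) ≡ (ũ + c * g * ũ1) + d * (g * (u1 + a * v1))
        lem u ũ c g a d u1 ũ1 v1 u0 v0 e₀ e₁ e₂ = trans (cong (λ q → (u + c * g * u1) + a * (g * q)) e₂)
          (trans (l1 u c g a u1 v1 (u0 + a * v0)) (trans (cong₂ (λ p q → p + c * g * q) e₀ e₁)
            (trans (l2 ũ c g d ũ1 v1 (u0 + a * v0)) (cong (λ q → (ũ + c * g * ũ1) + d * (g * q)) (sym e₂)))))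
          where
          l1 : ∀ u c g a u1 v1 r → (u + c * g * u1) + a * (g * (r + c * v1)) ≡ (u + a * (g * r)) + c * g * (u1 + a * v1)
          l1 = solve-∀
          l2 : ∀ u c g d u1 v1 r → (u + d * (g * r)) + c * g * (u1 + d * v1) ≡ (u + c * g * u1) + d * (g * (r + c * v1))
          l2 = solve-∀
      ...   | tri≈ _ refl _
        rewrite w-top {x} {α} {β} x≤b b<z | w-top {x} {β} {α} x≤b b<z
              | V-out α β t τ b bs {suc t} (inj₂ (inj₂ Np.≤-refl))
        = lem u ũ (s t) (σ x b) α β _ _ _ _ _ (ihV (V-in α β t τ b bs x≤b b<z Np.≤-refl)) ih' (U-telescope α β τ bs dτ (decreasing-weaken b<z db)) (V-top dτ)
        where
        lem : ∀ u ũ c g a d u1 ũ1 v1 u0 v0 →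
          u + a * (g * (u0 + a * v0)) ≡ ũ + d * (g * (u0 + a * v0)) →
          u1 + a * v1 ≡ ũ1 + d * v1 → u1 + a * v1 ≡ (u0 + a * v0) + c * v1 → v1 ≡ 0 →
          (u + a * g * u1) + a * 0 ≡ (ũ + d * g * ũ1) + d * 0
        lem u ũ c g a d u1 ũ1 v1 u0 v0 e₀ e₁ e₂ refl =
          trans (l1 u c g a u1) (trans (cong (λ q → u + a * (g * q)) r≡) (trans e₀
            (trans (cong (λ q → ũ + d * (g * q)) (trans (sym r≡) (trans (sym (cong (u1 +_) (Np.*-zeroʳ a))) e₁))) (l2 ũ g d ũ1))))
          where
          r≡ : u1 + 0 ≡ u0 + a * v0
          r≡ = trans (cong (u1 +_) (sym (Np.*-zeroʳ a))) (trans e₂ (l0 (u0 + a * v0) c))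
            where
            l0 : ∀ r c → r + c * 0 ≡ r
            l0 = solve-∀
          l1 : ∀ u c g a u1 → (u + a * g * u1) + a * 0 ≡ u + a * (g * (u1 + 0))
          l1 = solve-∀
          l2 : ∀ u g d u1 → u + d * (g * (u1 + d * 0)) ≡ (u + d * g * u1) + d * 0
          l2 = solve-∀
      ...   | tri> _ _ t<z = outside (inj₂ (inj₂ t<z)) (inj₂ (inj₂ t<z)) (inj₂ (inj₂ (Np.m<n⇒m<1+n t<z)))

-- Transfer operators for families of paths.

module PathTransfer where
  open Sums

  product : List ℕ → ℕ
  product = foldr _*_ 1

  when : Dec A → ℕ → ℕ
  when (yes _) n = n
  when (no _) n = 0

  when-yes : (d : Dec A) {n : ℕ} → A → when d n ≡ n
  when-yes (yes _) _ = refl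
  when-yes (no n) a = ⊥-elim (n a)

  when-no : (d : Dec A) {n : ℕ} → ¬ A → when d n ≡ 0
  when-no (yes a) n = ⊥-elim (n a)
  when-no (no _) _ = refl

  module PathOperators (s : ℕ → ℕ) where
    open PathAlgebra s

    -- Adds one path below `τ` with contact weight `α` and continues with `g`. The bound `Y = suc m`
    -- admits every path up to T; `Y = m` is the truncated version, without east steps at height
    -- `m`.
    D : ℕ → ℕ → (Vec ℕ m → ℕ) → Vec ℕ m → ℕ
    D {m} Y α g τ = ∑ (decreasings m Y) λ y → Γ α τ y * g y

    D-cong : ∀ Y α {g h : Vec ℕ m → ℕ} → (∀ y → Decreasing Y y → g y ≡ h y) → ∀ τ → D Y α g τ ≡ D Y α h τ
    D-cong {m} Y α e τ = ∑-cong∈ (decreasings m Y) λ y y∈ → cong (Γ α τ y *_) (e y (∈-decreasings⁻ m Y y∈))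

    D-linear : ∀ Y α a b (f g : Vec ℕ m → ℕ) τ →
      D Y α (λ y → a * f y + b * g y) τ ≡ a * D Y α f τ + b * D Y α g τ
    D-linear {m} Y α a b f g τ = trans (∑-cong L (λ y → lem (Γ α τ y) a b (f y) (g y)))
      (trans (∑-add L _ _) (cong₂ _+_ (∑-scale a L _) (∑-scale b L _)))
      where
      L = decreasings m Y
      lem : ∀ x a b p q → x * (a * p + b * q) ≡ a * (x * p) + b * (x * q)
      lem = solve-∀

    U-sum : ∀ α β (τ b : Vec ℕ m) Y → U α β τ b Y ≡ ∑ (decreasings m Y) (λ y → Γ α τ y * Γ β y b)
    U-sum α β [] [] Y = refl
    U-sum α β (t ∷ τ) (b ∷ bs) zero = refl
    U-sum {suc x} α β (t ∷ τ) (b ∷ bs) (suc z) = sym (begin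
      ∑ (decreasings (suc x) z ++ List.map (z ∷_) (decreasings x (suc z))) F
        ≡⟨ ∑-++ (decreasings (suc x) z) _ F ⟩
      ∑ (decreasings (suc x) z) F + ∑ (List.map (z ∷_) (decreasings x (suc z))) F
        ≡⟨ cong₂ _+_ (sym (U-sum α β (t ∷ τ) (b ∷ bs) z)) (∑-map (z ∷_) (decreasings x (suc z)) F) ⟩
      U α β (t ∷ τ) (b ∷ bs) z + ∑ (decreasings x (suc z)) (F ∘ (z ∷_))
        ≡⟨ cong (U α β (t ∷ τ) (b ∷ bs) z +_) (trans
             (∑-cong (decreasings x (suc z)) (λ y → lem (γ x α t z) (Γ α τ y) (γ x β z b) (Γ β y bs)))
             (trans (∑-scale (γ x α t z * γ x β z b) (decreasings x (suc z)) (λ y → Γ α τ y * Γ β y bs)) (cong (γ x α t z * γ x β z b *_) (sym (U-sum α β τ bs (suc z)))))) ⟩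
      U α β (t ∷ τ) (b ∷ bs) (suc z) ∎)
      where
      open ≡-Reasoning
      F : Vec ℕ (suc x) → ℕ
      F y = Γ α (t ∷ τ) y * Γ β y (b ∷ bs)
      lem : ∀ p q r w → p * q * (r * w) ≡ p * r * (q * w)
      lem = solve-∀

    D-D : ∀ Y Z α β (h : Vec ℕ m → ℕ) τ →
      D Y α (D Z β h) τ ≡ ∑ (decreasings m Z) (λ b → U α β τ b Y * h b)
    D-D {m} Y Z α β h τ = begin
      ∑ (decreasings m Y) (λ y → Γ α τ y * ∑ (decreasings m Z) (λ b → Γ β y b * h b))
        ≡⟨ ∑-cong (decreasings m Y) (λ y → sym (∑-scale (Γ α τ y) (decreasings m Z) _)) ⟩
      ∑ (decreasings m Y) (λ y → ∑ (decreasings m Z) (λ b → Γ α τ y * (Γ β y b * h b)))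
        ≡⟨ ∑-swap (decreasings m Y) (decreasings m Z) _ ⟩
      ∑ (decreasings m Z) (λ b → ∑ (decreasings m Y) (λ y → Γ α τ y * (Γ β y b * h b)))
        ≡⟨ ∑-cong (decreasings m Z) (λ b → trans (∑-cong (decreasings m Y) (λ y → lem (Γ α τ y) (Γ β y b) (h b)))
             (trans (∑-scale (h b) (decreasings m Y) _)
               (trans (cong (h b *_) (sym (U-sum α β τ b Y))) (Np.*-comm (h b) _)))) ⟩
      ∑ (decreasings m Z) (λ b → U α β τ b Y * h b) ∎
      where
      open ≡-Reasoning
      lem : ∀ p q r → p * (q * r) ≡ r * (p * q)
      lem = solve-∀

    -- All four terms sum over the same lower paths `b`, so the identity is checked for each `b`. At
    -- the top level `V` vanishes, hence `U-telescope` expresses the untruncated sum by the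
    -- truncated one, and `U-swap` exchanges the weights there.
    D-exchange : ∀ α β (h : Vec ℕ m → ℕ) τ → Decreasing (suc m) τ →
      β * D (suc m) α (D m β h) τ + α * D m β (D m α h) τ ≡
      α * D (suc m) α (D m β h) τ + β * D m α (D m β h) τ
    D-exchange {m} α β h τ dτ = begin
      β * D (suc m) α (D m β h) τ + α * D m β (D m α h) τ
        ≡⟨ combine β α (suc m) α β m β α ⟩
      ∑ L (λ b → β * (U α β τ b (suc m) * h b) + α * (U β α τ b m * h b))
        ≡⟨ ∑-cong∈ L (λ b b∈ → pointwise b (∈-decreasings⁻ m m b∈)) ⟩
      ∑ L (λ b → α * (U α β τ b (suc m) * h b) + β * (U α β τ b m * h b))
        ≡⟨ sym (combine α β (suc m) α β m α β) ⟩
      α * D (suc m) α (D m β h) τ + β * D m α (D m β h) τ ∎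
      where
      open ≡-Reasoning
      L = decreasings m m
      combine : ∀ p q Y a b Z c d → p * D Y a (D m b h) τ + q * D Z c (D m d h) τ ≡
        ∑ L (λ v → p * (U a b τ v Y * h v) + q * (U c d τ v Z * h v))
      combine p q Y a b Z c d = sym (trans (∑-add L _ _) (cong₂ _+_
        (trans (∑-scale p L _) (cong (p *_) (sym (D-D Y m a b h τ))))
        (trans (∑-scale q L _) (cong (q *_) (sym (D-D Z m c d h τ))))))
      pointwise : ∀ b → Decreasing m b →
        β * (U α β τ b (suc m) * h b) + α * (U β α τ b m * h b) ≡
        α * (U α β τ b (suc m) * h b) + β * (U α β τ b m * h b)
      pointwise b db = lem α β (h b) (U α β τ b (suc m)) (U α β τ b m) (U β α τ b m) (V α β τ b m) _ (s m)
        (U-telescope α β τ b dτ db) (U-swap α β τ b dτ db m) (V-top dτ)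
        where
        lem : ∀ a c h u1 u ũ v v1 r → u1 + a * v1 ≡ (u + a * v) + r * v1 → u + a * v ≡ ũ + c * v → v1 ≡ 0 →
          c * (u1 * h) + a * (ũ * h) ≡ a * (u1 * h) + c * (u * h)
        lem a c h u1 u ũ v _ r e₁ e₂ refl = trans (cong (λ q → c * (q * h) + a * (ũ * h)) u1≡)
          (trans (l2 a c h u ũ v) (cong (λ q → a * (q * h) + c * (u * h)) (sym (trans u1≡ e₂))))
          where
          l1 : ∀ p a → p + a * 0 ≡ p
          l1 = solve-∀
          u1≡ : u1 ≡ u + a * v
          u1≡ = trans (sym (l1 u1 a)) (trans e₁ (l1 _ r))
          l2 : ∀ a c h u ũ v → c * ((u + a * v) * h) + a * (ũ * h) ≡ a * ((ũ + c * v) * h) + c * (u * h)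
          l2 = solve-∀

    foldr-D-exchange : ∀ α β (h : Vec ℕ m → ℕ) fs τ → Decreasing (suc m) τ →
      β * foldr (D (suc m)) (D (suc m) α (D m β h)) fs τ + α * foldr (D (suc m)) (D m β (D m α h)) fs τ ≡
      α * foldr (D (suc m)) (D (suc m) α (D m β h)) fs τ + β * foldr (D (suc m)) (D m α (D m β h)) fs τ
    foldr-D-exchange α β h [] τ dτ = D-exchange α β h τ dτ
    foldr-D-exchange {m} α β h (a ∷ fs) τ _ = trans (sym (D-linear (suc m) a β α _ _ τ))
      (trans (D-cong (suc m) a (λ y dy → foldr-D-exchange α β h fs y dy) τ) (D-linear (suc m) a α β _ _ τ))

    -- Indicator of `ground`: an operator applied to it records just the contacts of the last path
    -- with B.
    δ : Vec ℕ m → ℕ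
    δ [] = 1
    δ {suc x} (z ∷ y) = when (z ≟ x) (δ y)

    δ-head : ∀ {x} (y : Vec ℕ x) → δ (x ∷ y) ≡ δ y
    δ-head {x} y = when-yes (x ≟ x) refl

    δ-off : ∀ {x z} (y : Vec ℕ x) → z ≢ x → δ (z ∷ y) ≡ 0
    δ-off {x} {z} y n = when-no (z ≟ x) n

    ∑-cons : ∀ x z (F : Vec ℕ (suc x) → ℕ) → ∑ (decreasings (suc x) (suc z)) F ≡
      ∑ (decreasings (suc x) z) F + ∑ (decreasings x (suc z)) (λ y → F (z ∷ y))
    ∑-cons x z F = trans (∑-++ (decreasings (suc x) z) _ F) (cong (∑ (decreasings (suc x) z) F +_) (∑-map (z ∷_) (decreasings x (suc z)) F))

    ∑-vanish : ∀ x Y (F : Vec ℕ (suc x) → ℕ) → (∀ z y → z < Y → F (z ∷ y) ≡ 0) → ∑ (decreasings (suc x) Y) F ≡ 0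
    ∑-vanish x Y F e = trans (∑-cong∈ (decreasings (suc x) Y) (λ y y∈ → go (∈-decreasings⁻ (suc x) Y y∈))) (∑-zero (decreasings (suc x) Y))
      where
      go : ∀ {y} → Decreasing Y y → F y ≡ 0
      go (p ∷ _) = e _ _ p

    ∑-δ : ∀ x Y (g : Vec ℕ x → ℕ) → x ≤ Y → ∑ (decreasings x Y) (λ y → g y * δ y) ≡ g (ground x)
    ∑-δ zero Y g _ = lem (g [])
      where
      lem : ∀ a → a * 1 + 0 ≡ a
      lem = solve-∀
    ∑-δ (suc x) (suc z) g (s≤s x≤z) with x ≟ z
    ... | yes refl = trans (∑-cons x x _) (cong₂ _+_
        (∑-vanish x x _ (λ w y w<x → trans (cong (g (w ∷ y) *_) (δ-off y (Np.<⇒≢ w<x))) (Np.*-zeroʳ (g (w ∷ y)))))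
        (trans (∑-cong (decreasings x (suc x)) (λ y → cong (g (x ∷ y) *_) (δ-head y))) (∑-δ x (suc x) (λ y → g (x ∷ y)) (Np.n≤1+n x))))
    ... | no x≢z = trans (∑-cons x z _) (trans (cong₂ _+_
        (∑-δ (suc x) z g (Np.≤∧≢⇒< x≤z x≢z))
        (trans (∑-cong (decreasings x (suc z)) (λ y → trans (cong (g (z ∷ y) *_) (δ-off y (x≢z ∘ sym))) (Np.*-zeroʳ (g (z ∷ y)))))
          (∑-zero (decreasings x (suc z)))))
        (Np.+-identityʳ _))

    D-δ : ∀ Y α (τ : Vec ℕ m) → m ≤ Y → D Y α δ τ ≡ Γ α τ (ground m)
    D-δ {m} Y α τ le = ∑-δ m Y (Γ α τ) le

    -- Since `δ` forces the last summed path to be B, `k + 1` weights describe families of `k`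
    -- paths.
    pathSum : ∀ m → List ℕ → ℕ
    pathSum m αs = foldr (D (suc m)) δ αs (top m m)

    -- The paths of the factors after fs stay below the top level m.
    partialPathSum : ∀ m → List ℕ → ℕ → List ℕ → ℕ
    partialPathSum m fs α bs = foldr (D (suc m)) (D m α (foldr (D m) δ bs)) fs (top m m)

    foldr-D-cong : ∀ fs {g h : Vec ℕ m → ℕ} → (∀ y → g y ≡ h y) → ∀ y → foldr (D (suc m)) g fs y ≡ foldr (D (suc m)) h fs y
    foldr-D-cong [] e y = e y
    foldr-D-cong {m} (a ∷ fs) e y = D-cong (suc m) a (λ w _ → foldr-D-cong fs e w) y

    -- The last operator sums over B alone, which stays below height `m` anyway, so truncating it
    -- changes nothing. This puts `pathSum` into the form to which the exchange relation applies.
    pathSum-snoc : ∀ m fs α → pathSum m (fs List.∷ʳ α) ≡ partialPathSum m fs α []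
    pathSum-snoc m fs α = trans (cong (λ f → f (top m m)) (foldr-∷ʳ fs))
      (foldr-D-cong fs (λ y → trans (D-δ (suc m) α y (Np.n≤1+n m)) (sym (D-δ m α y Np.≤-refl))) (top m m))
      where
      foldr-∷ʳ : ∀ fs → foldr (D (suc m)) δ (fs List.∷ʳ α) ≡ foldr (D (suc m)) (D (suc m) α δ) fs
      foldr-∷ʳ [] = refl
      foldr-∷ʳ (a ∷ fs) = cong (D (suc m) a) (foldr-∷ʳ fs)

    partialPathSum-exchange : ∀ m fs α β bs →
      β * partialPathSum m (fs List.∷ʳ α) β bs + α * partialPathSum m fs β (α ∷ bs) ≡
      α * partialPathSum m (fs List.∷ʳ α) β bs + β * partialPathSum m fs α (β ∷ bs)
    partialPathSum-exchange m fs α β bs =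
      subst (λ f → β * f (top m m) + α * partialPathSum m fs β (α ∷ bs) ≡ α * f (top m m) + β * partialPathSum m fs α (β ∷ bs))
        (sym (foldr-∷ʳ fs)) (foldr-D-exchange α β (foldr (D m) δ bs) fs (top m m) (top-decreasing m m))
      where
      foldr-∷ʳ : ∀ fs → foldr (D (suc m)) (D m β (foldr (D m) δ bs)) (fs List.∷ʳ α) ≡
        foldr (D (suc m)) (D (suc m) α (D m β (foldr (D m) δ bs))) fs
      foldr-∷ʳ [] = refl
      foldr-∷ʳ (a ∷ fs) = cong (D (suc m) a) (foldr-∷ʳ fs)

    -- Below height `suc x` and not below B, the last column has the single height `x` left.
    D-lastColumn : ∀ x α (h : Vec ℕ (suc x) → ℕ) t τ c → γ x α t x ≡ c →
      D (suc x) α h (t ∷ τ) ≡ c * ∑ (decreasings x (suc x)) (λ y → Γ α τ y * h (x ∷ y))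
    D-lastColumn x α h t τ c e = trans (∑-cons x x _) (trans (cong₂ _+_
        (∑-vanish x x _ (λ z y z<x → cong (λ q → q * Γ α τ y * h (z ∷ y)) (γ-low z<x)))
        (trans (∑-cong (decreasings x (suc x)) (λ y → trans (cong (λ q → q * Γ α τ y * h (x ∷ y)) e) (Np.*-assoc c _ _)))
          (∑-scale c (decreasings x (suc x)) _)))
        refl)

    back-lastColumn : ∀ x bs (τ : Vec ℕ x) →
      foldr (D (suc x)) δ bs (x ∷ τ) ≡ product bs * foldr (D (suc x)) δ bs τ
    back-lastColumn x [] τ = trans (δ-head τ) (sym (Np.*-identityˡ _))
    back-lastColumn x (b ∷ bs) τ = trans (D-lastColumn x b (foldr (D (suc x)) δ bs) x τ b (γ-equal Np.≤-refl))
      (trans (cong (b *_) (trans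
        (∑-cong (decreasings x (suc x)) (λ y → trans (cong (Γ b τ y *_) (back-lastColumn x bs y)) (*-exchange (Γ b τ y) (product bs) _)))
        (∑-scale (product bs) (decreasings x (suc x)) _))) (sym (Np.*-assoc b _ _)))

    -- A path below T has no contact with T, and its edges at height `M` cost `s M`. The same charge
    -- results from lowering T to height `M` with contact weight `s M`.
    Γ-top : ∀ M α {x} (y : Vec ℕ x) → x ≤ M → Decreasing (suc M) y → Γ α (top x (suc M)) y ≡ Γ (s M) (top x M) y
    Γ-top M α [] _ _ = refl
    Γ-top M α {suc x} (z ∷ y) x<M (s≤s z≤M ∷ d) = cong₂ _*_ head (Γ-top M α y (Np.<⇒≤ x<M) (decreasing-weaken (s≤s z≤M) d))
      where
      head : γ x α (suc M) z ≡ γ x (s M) M z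
      head with z <? x
      ... | yes z<x = trans (γ-low z<x) (sym (γ-low z<x))
      ... | no z≮x with z ≟ M
      ...   | yes refl = trans (γ-between (Np.≮⇒≥ z≮x) Np.≤-refl) (trans (σ-above x<M) (sym (γ-equal (Np.≮⇒≥ z≮x))))
      ...   | no z≢M = trans (γ-between (Np.≮⇒≥ z≮x) (s≤s z≤M)) (sym (γ-between (Np.≮⇒≥ z≮x) (Np.≤∧≢⇒< z≤M z≢M)))

    -- All paths share the edge at height `x` in the last column. It costs 1 for the first path,
    -- being on B, and a contact weight for each later one, whence `product bs`. The other columns
    -- form the smaller problem by `Γ-top`.
    partialPathSum-base : ∀ x α bs → partialPathSum (suc x) [] α bs ≡ product bs * pathSum x (s x ∷ bs)
    partialPathSum-base x α bs = trans
      (D-lastColumn x α (foldr (D (suc x)) δ bs) (suc x) (top x (suc x)) 1 (trans (γ-between Np.≤-refl Np.≤-refl) (σ-ground x)))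
      (trans (Np.*-identityˡ _) (trans
        (∑-cong∈ (decreasings x (suc x)) (λ y y∈ → trans
          (cong₂ _*_ (Γ-top x α y Np.≤-refl (∈-decreasings⁻ x (suc x) y∈)) (back-lastColumn x bs y))
          (*-exchange (Γ (s x) (top x x) y) (product bs) _)))
        (∑-scale (product bs) (decreasings x (suc x)) _)))

-- The nilCoxeter algebra and the commutation of its rows.

module NilCoxeter where
  open Sums
  open import Data.List.Relation.Unary.All using (All; []; _∷_)

  Fun : Set
  Fun = List ℕ → ℕ

  -- Generators of the nilCoxeter algebra acting on functions of words.
  u : ℕ → Fun → Fun
  u zero f (x ∷ y ∷ w) = if x <ᵇ y then f (y ∷ x ∷ w) else 0
  u zero f _ = 0
  u (suc j) f [] = 0
  u (suc j) f (x ∷ w) = u j (f ∘ (x ∷_)) w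

  u-cong : ∀ j {f g : Fun} → (∀ w → f w ≡ g w) → ∀ w → u j f w ≡ u j g w
  u-cong zero e [] = refl
  u-cong zero e (x ∷ []) = refl
  u-cong zero e (x ∷ y ∷ w) with x <ᵇ y
  ... | true = e _
  ... | false = refl
  u-cong (suc j) e [] = refl
  u-cong (suc j) e (x ∷ w) = u-cong j (λ v → e (x ∷ v)) w

  u-linear : ∀ j a b (f g : Fun) w → u j (λ v → a * f v + b * g v) w ≡ a * u j f w + b * u j g w
  u-linear zero a b f g [] = sym (cong₂ _+_ (Np.*-zeroʳ a) (Np.*-zeroʳ b))
  u-linear zero a b f g (x ∷ []) = sym (cong₂ _+_ (Np.*-zeroʳ a) (Np.*-zeroʳ b))
  u-linear zero a b f g (x ∷ y ∷ w) with x <ᵇ y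
  ... | true = refl
  ... | false = sym (cong₂ _+_ (Np.*-zeroʳ a) (Np.*-zeroʳ b))
  u-linear (suc j) a b f g [] = sym (cong₂ _+_ (Np.*-zeroʳ a) (Np.*-zeroʳ b))
  u-linear (suc j) a b f g (x ∷ w) = u-linear j a b (f ∘ (x ∷_)) (g ∘ (x ∷_)) w

  u-zero : ∀ j w → u j (λ _ → 0) w ≡ 0
  u-zero j w = u-linear j 0 0 (λ _ → 0) (λ _ → 0) w

  <ᵇ-asym : ∀ x y → (x <ᵇ y) ≡ true → (y <ᵇ x) ≡ false
  <ᵇ-asym zero (suc y) _ = refl
  <ᵇ-asym (suc x) (suc y) e = <ᵇ-asym x y e

  u-square : ∀ j (f : Fun) w → u j (u j f) w ≡ 0
  u-square zero f [] = refl
  u-square zero f (x ∷ []) = refl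
  u-square zero f (x ∷ y ∷ w) with x <ᵇ y in e
  ... | false = refl
  ... | true rewrite <ᵇ-asym x y e = refl
  u-square (suc j) f [] = refl
  u-square (suc j) f (x ∷ w) = u-square j (f ∘ (x ∷_)) w

  u-far : ∀ i j (f : Fun) w → suc i < j → u i (u j f) w ≡ u j (u i f) w
  u-far i .(suc _) f [] (s≤s _) = u-nil i
    where
    u-nil : ∀ i {f : Fun} → u i f [] ≡ 0
    u-nil zero = refl
    u-nil (suc i) = refl
  u-far zero (suc (suc j)) f (x ∷ []) _ = refl
  u-far zero (suc (suc j)) f (x ∷ y ∷ w) _ with x <ᵇ y
  ... | true = refl
  ... | false = sym (u-zero j w)
  u-far zero (suc zero) f (x ∷ w) (s≤s ())
  u-far (suc i) (suc j) f (x ∷ w) (s≤s p) = u-far i j (f ∘ (x ∷_)) w p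

  u-braid : ∀ j (f : Fun) w → u j (u (suc j) (u j f)) w ≡ u (suc j) (u j (u (suc j) f)) w
  u-braid zero f [] = refl
  u-braid zero f (x ∷ []) = refl
  u-braid zero f (x ∷ y ∷ []) with x <ᵇ y
  ... | true = refl
  ... | false = refl
  u-braid zero f (x ∷ y ∷ z ∷ w) with x <ᵇ y | y <ᵇ z | x <ᵇ z
  ... | true | true | true = refl
  ... | true | true | false = refl
  ... | true | false | true = refl
  ... | true | false | false = refl
  ... | false | true | true = refl
  ... | false | true | false = refl
  ... | false | false | true = refl
  ... | false | false | false = refl
  u-braid (suc j) f [] = refl
  u-braid (suc j) f (x ∷ w) = u-braid j (f ∘ (x ∷_)) w

  h : ℕ → ℕ → Fun → Fun
  h j α f w = α * f w + u j f w

  h-cong : ∀ j α {f g : Fun} → (∀ w → f w ≡ g w) → ∀ w → h j α f w ≡ h j α g w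
  h-cong j α e w = cong₂ (λ p q → α * p + q) (e w) (u-cong j e w)

  -- (α + u₀)(α + u₁)⋯(α + uₗ₋₁)
  row : ℕ → ℕ → Fun → Fun
  row zero α f = f
  row (suc l) α f = row l α (h l α f)

  row-cong : ∀ l α {f g : Fun} → (∀ w → f w ≡ g w) → ∀ w → row l α f w ≡ row l α g w
  row-cong zero α e = e
  row-cong (suc l) α e = row-cong l α (h-cong l α e)

  row-linear : ∀ l α a b (f g : Fun) w → row l α (λ v → a * f v + b * g v) w ≡ a * row l α f w + b * row l α g w
  row-linear zero α a b f g w = refl
  row-linear (suc l) α a b f g w = trans
    (row-cong l α (λ v → trans (cong (α * (a * f v + b * g v) +_) (u-linear l a b f g v)) (lem α a b (f v) (g v) (u l f v) (u l g v))) w)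
    (row-linear l α a b (h l α f) (h l α g) w)
    where
    lem : ∀ c a b p q r t → c * (a * p + b * q) + (a * r + b * t) ≡ a * (c * p + r) + b * (c * q + t)
    lem = solve-∀

  u-row : ∀ l α j (f : Fun) w → l < j → u j (row l α f) w ≡ row l α (u j f) w
  u-row zero α j f w _ = refl
  u-row (suc l) α j f w p = trans (u-row l α j (h l α f) w (Np.<⇒≤ p)) (row-cong l α
    (λ v → trans (u-cong j (λ x → cong (α * f x +_) (sym (Np.*-identityˡ (u l f x)))) v)
      (trans (u-linear j α 1 f (u l f) v) (cong (α * u j f v +_) (trans (Np.*-identityˡ _) (sym (u-far l j f v p)))))) w)

  -- What is used of a prefix operator: enough to expand the factors behind it without opening it.
  record Linear (X : Fun → Fun) : Set where
    field
      ext : ∀ {f g : Fun} → (∀ w → f w ≡ g w) → ∀ w → X f w ≡ X g w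
      linear : ∀ a b (f g : Fun) w → X (λ v → a * f v + b * g v) w ≡ a * X f w + b * X g w

    vanish : ∀ {f : Fun} → (∀ w → f w ≡ 0) → ∀ w → X f w ≡ 0
    vanish {f} e w = trans (ext {f} {λ v → 0 * f v + 0 * f v} e w) (linear 0 0 f f w)

    linear₁ : ∀ a (f g : Fun) w → X (λ v → a * f v + g v) w ≡ a * X f w + X g w
    linear₁ a f g w = trans (ext (λ v → cong (a * f v +_) (sym (Np.*-identityˡ (g v)))) w)
      (trans (linear a 1 f g w) (cong (a * X f w +_) (Np.*-identityˡ _)))

  open Linear

  row-Linear : ∀ l α → Linear (row l α)
  row-Linear l α = record { ext = row-cong l α ; linear = row-linear l α }

  u-Linear : ∀ j → Linear (u j)
  u-Linear j = record { ext = u-cong j ; linear = u-linear j }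

  ∘-Linear : ∀ {X Y} → Linear X → Linear Y → Linear (X ∘ Y)
  ∘-Linear {X} {Y} LX LY = record
    { ext = λ e → ext LX (ext LY e)
    ; linear = λ a b f g w → trans (ext LX (linear LY a b f g) w) (linear LX a b (Y f) (Y g) w) }

  module _ {X : Fun → Fun} (L : Linear X) (l α β : ℕ) (f : Fun) (w : List ℕ) where
    private
      U V : Fun → Fun
      U = u l
      V = u (suc l)

    -- The product `(α + V)(β + U)(β + V)` behind `X`; the one term that drops out is the square of
    -- `V`.
    expand : X (h (suc l) α (h l β (h (suc l) β f))) w ≡
      α * (β * (β * X f w + X (V f) w) + (β * X (U f) w + X (U (V f)) w))
      + (β * (β * X (V f) w) + (β * X (V (U f)) w + X (V (U (V f))) w))
    expand = trans (linear₁ L α g (V g) w) (cong₂ (λ p q → α * p + q) Xg XVg)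
      where
      g' g : Fun
      g' = h (suc l) β f
      g = h l β g'
      XUg' : X (U g') w ≡ β * X (U f) w + X (U (V f)) w
      XUg' = linear₁ (∘-Linear L (u-Linear l)) β f (V f) w
      Xg : X g w ≡ β * (β * X f w + X (V f) w) + (β * X (U f) w + X (U (V f)) w)
      Xg = trans (linear₁ L β g' (U g') w) (cong₂ (λ p q → β * p + q) (linear₁ L β f (V f) w) XUg')
      XVg' : X (V g') w ≡ β * X (V f) w
      XVg' = trans (linear₁ (∘-Linear L (u-Linear (suc l))) β f (V f) w)
        (trans (cong (β * X (V f) w +_) (vanish L (u-square (suc l) f) w)) (Np.+-identityʳ _))
      XVg : X (V g) w ≡ β * (β * X (V f) w) + (β * X (V (U f)) w + X (V (U (V f))) w)
      XVg = trans (linear₁ (∘-Linear L (u-Linear (suc l))) β g' (U g') w)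
        (cong₂ (λ p q → β * p + q) XVg'
          (linear₁ (∘-Linear L (∘-Linear (u-Linear (suc l)) (u-Linear l))) β f (V f) w))

  Commute : ℕ → ℕ → ℕ → Set
  Commute l α β = ∀ (f : Fun) w → row l α (row l β f) w ≡ row l β (row l α f) w

  module _ (l α β : ℕ) (comm : Commute (suc l) α β) where
    X Y : Fun → Fun
    X f = row (suc l) α (row l β f)
    Y f = row (suc l) β (row l α f)

    X-Linear : Linear X
    X-Linear = ∘-Linear (row-Linear (suc l) α) (row-Linear l β)

    Y-Linear : Linear Y
    Y-Linear = ∘-Linear (row-Linear (suc l) β) (row-Linear l α)

    -- The commutation of rows of length `suc l`, with the last factor of the inner row multiplied
    -- out.
    commute₁ : ∀ f w → β * X f w + X (u l f) w ≡ α * Y f w + Y (u l f) w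
    commute₁ f w = trans (sym (linear₁ X-Linear β f (u l f) w)) (trans (comm f w) (linear₁ Y-Linear α f (u l f) w))

    -- Substituting `u l f` into `commute₁` kills the second term on each side, because `u l`
    -- squares to zero.
    commute₂ : ∀ f w → β * X (u l f) w ≡ α * Y (u l f) w
    commute₂ f w = begin
      β * X (u l f) w                         ≡⟨ sym (Np.+-identityʳ _) ⟩
      β * X (u l f) w + 0                     ≡⟨ cong (β * X (u l f) w +_) (sym (vanish X-Linear (u-square l f) w)) ⟩
      β * X (u l f) w + X (u l (u l f)) w     ≡⟨ commute₁ (u l f) w ⟩
      α * Y (u l f) w + Y (u l (u l f)) w     ≡⟨ cong (α * Y (u l f) w +_) (vanish Y-Linear (u-square l f) w) ⟩
      α * Y (u l f) w + 0                     ≡⟨ Np.+-identityʳ _ ⟩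
      α * Y (u l f) w ∎
      where open ≡-Reasoning

    -- Multiplied out, the sides differ only by `β * X (u l f)` against `α * Y (u l f)`, which
    -- `commute₂` equates. A row with its last factor replaced by the scalar is one whose last
    -- diagonal is forced to be present.
    row-exchange : ∀ f w → β * row (suc l) α (row (suc l) β f) w + α * row (suc l) β (λ v → α * row l α f v) w ≡
      α * row (suc l) α (row (suc l) β f) w + β * row (suc l) α (λ v → β * row l β f v) w
    row-exchange f w = begin
      β * αβ + α * row (suc l) β (λ v → α * row l α f v) w
        ≡⟨ cong₂ (λ p q → β * p + α * q) (linear₁ X-Linear β f (u l f) w) (scale (suc l) β α _) ⟩
      β * (β * x + xu) + α * (α * y)
        ≡⟨ lem₁ α β x xu y ⟩
      β * xu + (β * (β * x) + α * (α * y))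
        ≡⟨ cong (_+ (β * (β * x) + α * (α * y))) (commute₂ f w) ⟩
      α * yu + (β * (β * x) + α * (α * y))
        ≡⟨ lem₂ α β x y yu ⟩
      α * (α * y + yu) + β * (β * x)
        ≡⟨ sym (cong₂ (λ p q → α * p + β * q) (trans (linear₁ X-Linear β f (u l f) w) (commute₁ f w)) (scale (suc l) α β _)) ⟩
      α * αβ + β * row (suc l) α (λ v → β * row l β f v) w ∎
      where
      open ≡-Reasoning
      αβ = row (suc l) α (row (suc l) β f) w
      x = X f w
      xu = X (u l f) w
      y = Y f w
      yu = Y (u l f) w
      scale : ∀ l α c g → row l α (λ v → c * g v) w ≡ c * row l α g w
      scale l α c g = trans (row-cong l α (λ v → sym (Np.+-identityʳ (c * g v))) w)
        (trans (row-linear l α c 0 g g w) (Np.+-identityʳ _))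
      lem₁ : ∀ α β x xu y → β * (β * x + xu) + α * (α * y) ≡ β * xu + (β * (β * x) + α * (α * y))
      lem₁ = solve-∀
      lem₂ : ∀ α β x y yu → α * yu + (β * (β * x) + α * (α * y)) ≡ α * (α * y + yu) + β * (β * x)
      lem₂ = solve-∀

    -- The last generator of the outer row commutes with all but the last two factors of the inner
    -- row. Sliding it past them leaves the prefix `X`, respectively `Y`, followed by three factors
    -- in two adjacent generators.
    commute-step : Commute (suc (suc l)) α β
    commute-step f w = trans (slide α β) (trans main (sym (slide β α)))
      where
      U V : Fun → Fun
      U = u l
      V = u (suc l)
      slide : ∀ α β → row (suc (suc l)) α (row (suc (suc l)) β f) w ≡
        row (suc l) α (row l β (h (suc l) α (h l β (h (suc l) β f)))) w
      slide α β = row-cong (suc l) α (λ v →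
        trans (cong (α * row l β g v +_) (u-row l β (suc l) g v Np.≤-refl)) (sym (linear₁ (row-Linear l β) α g (V g) v))) w
        where g = h l β (h (suc l) β f)
      main : X (h (suc l) α (h l β (h (suc l) β f))) w ≡ Y (h (suc l) β (h l α (h (suc l) α f))) w
      main = trans (expand X-Linear l α β f w) (trans
        (lem α β _ _ _ _ _ _ _ _ _ _ _ _ (commute₁ f w) (commute₁ (V f) w)
          -- The braid relation rewrites `V (U (V f))` as `U (V (U f))`, which is the shape in which
          -- `commute₁` applies to `V (U f)`.
          (trans (cong (β * X (V (U f)) w +_) (sym (ext X-Linear (u-braid l f) w)))
            (trans (commute₁ (V (U f)) w) (cong (α * Y (V (U f)) w +_) (ext Y-Linear (u-braid l f) w))))
          (commute₂ (V f) w))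
        (sym (expand Y-Linear l β α f w)))
        where
        lem : ∀ α β x xu xv xuv xvu xvuv y yu yv yuv yvu yvuv →
          β * x + xu ≡ α * y + yu → β * xv + xuv ≡ α * yv + yuv →
          β * xvu + xvuv ≡ α * yvu + yvuv → β * xuv ≡ α * yuv →
          α * (β * (β * x + xv) + (β * xu + xuv)) + (β * (β * xv) + (β * xvu + xvuv)) ≡
          β * (α * (α * y + yv) + (α * yu + yuv)) + (α * (α * yv) + (α * yvu + yvuv))
        -- Adding `β * xuv` completes the expansion to three instances of `commute₁`, for `f`, `V f`
        -- and `V (U f)`. By `commute₂` the summand equals `α * yuv`, which completes the other side
        -- in the same way.
        lem α β x xu xv xuv xvu xvuv y yu yv yuv yvu yvuv e₁ e₂ e₃ e₄ = Np.+-cancelʳ-≡ (β * xuv) _ _ (begin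
          α * (β * (β * x + xv) + (β * xu + xuv)) + (β * (β * xv) + (β * xvu + xvuv)) + β * xuv
            ≡⟨ l1 α β x xu xv xuv xvu xvuv ⟩
          α * β * (β * x + xu) + (α + β) * (β * xv + xuv) + (β * xvu + xvuv)
            ≡⟨ cong₂ _+_ (cong₂ (λ p q → α * β * p + (α + β) * q) e₁ e₂) e₃ ⟩
          α * β * (α * y + yu) + (α + β) * (α * yv + yuv) + (α * yvu + yvuv)
            ≡⟨ l2 α β y yu yv yuv yvu yvuv ⟩
          β * (α * (α * y + yv) + (α * yu + yuv)) + (α * (α * yv) + (α * yvu + yvuv)) + α * yuv
            ≡⟨ cong (β * (α * (α * y + yv) + (α * yu + yuv)) + (α * (α * yv) + (α * yvu + yvuv)) +_) (sym e₄) ⟩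
          β * (α * (α * y + yv) + (α * yu + yuv)) + (α * (α * yv) + (α * yvu + yvuv)) + β * xuv ∎)
          where
          open ≡-Reasoning
          l1 : ∀ α β x xu xv xuv xvu xvuv →
            α * (β * (β * x + xv) + (β * xu + xuv)) + (β * (β * xv) + (β * xvu + xvuv)) + β * xuv ≡
            α * β * (β * x + xu) + (α + β) * (β * xv + xuv) + (β * xvu + xvuv)
          l1 = solve-∀
          l2 : ∀ α β y yu yv yuv yvu yvuv →
            α * β * (α * y + yu) + (α + β) * (α * yv + yuv) + (α * yvu + yvuv) ≡
            β * (α * (α * y + yv) + (α * yu + yuv)) + (α * (α * yv) + (α * yvu + yvuv)) + α * yuv
          l2 = solve-∀

  -- These are the commuting factors in the Fomin-Stanley approach to Schubert polynomials. Length 1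
  -- is a separate start, since the inductive step passes from `suc l` to `suc (suc l)`.
  row-commute : ∀ l α β → Commute l α β
  row-commute zero α β f w = refl
  row-commute (suc zero) α β f w = trans (lin α β) (trans (lem α β (f w) (u 0 f w) _ (u-square 0 f w)) (sym (lin β α)))
    where
    lin : ∀ α β → h 0 α (h 0 β f) w ≡ α * (β * f w + u 0 f w) + (β * u 0 f w + u 0 (u 0 f) w)
    lin α β = cong (α * h 0 β f w +_) (linear₁ (u-Linear 0) β f (u 0 f) w)
    lem : ∀ α β p q z → z ≡ 0 → α * (β * p + q) + (β * q + z) ≡ β * (α * p + q) + (α * q + z)
    lem α β p q _ refl = l α β p q
      where
      l : ∀ α β p q → α * (β * p + q) + (β * q + 0) ≡ β * (α * p + q) + (α * q + 0)
      l = solve-∀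
  row-commute (suc (suc l)) α β = commute-step l α β (row-commute (suc l) α β)

-- Equality of the two generating functions at distinct weights.

module Comparison where
  open Sums
  open PathTransfer
  open NilCoxeter
  open import Relation.Binary.PropositionalEquality using (setoid)
  open import Data.List.Reverse using (Reverse; []; _∶_∶ʳ_; reverseView)
  open import Data.List.Relation.Unary.All using (All; []; _∷_)
  open import Data.List.Relation.Unary.AllPairs using ([]; _∷_)
  open import Data.List.Relation.Unary.Unique.Propositional using (Unique)
  open import Data.List.Relation.Binary.Permutation.Propositional using (_↭_; ↭-refl; ↭-trans; prep; swap; ↭⇒↭ₛ)

  Word : Set
  Word = List ℕ

  start target : ℕ → ℕ → Word
  start c zero = c ∷ []
  start c (suc m) = c ∷ start (suc c) m
  target c zero = c ∷ []
  target c (suc m) = target (suc c) m List.∷ʳ c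

  start-length : ∀ c m → List.length (start c m) ≡ suc m
  start-length c zero = refl
  start-length c (suc m) = cong suc (start-length (suc c) m)

  start-above : ∀ b c m → b < c → All (b <_) (start c m)
  start-above b c zero p = p ∷ []
  start-above b c (suc m) p = p ∷ start-above b (suc c) m (Np.m<n⇒m<1+n p)

  indicator : Word → Fun
  indicator t w = when (Lp.≡-dec _≟_ w t) 1

  -- f' describes f on words of length suc L ending in c, and f vanishes on the
  -- other words of that length.
  Restricts : ℕ → ℕ → Fun → Fun → Set
  Restricts c L f f' = ∀ w z → List.length w ≡ L → f (w List.∷ʳ z) ≡ when (z ≟ c) (f' w)

  restricts-indicator : ∀ c L t → Restricts c L (indicator (t List.∷ʳ c)) (indicator t)
  restricts-indicator c L t w z _ with z ≟ c
  ... | no z≢c = when-no (Lp.≡-dec _≟_ (w List.∷ʳ z) (t List.∷ʳ c)) (λ e → z≢c (proj₂ (Lp.∷ʳ-injective w t e)))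
  ... | yes refl with Lp.≡-dec _≟_ w t
  ...   | yes refl = when-yes (Lp.≡-dec _≟_ (w List.∷ʳ z) (w List.∷ʳ z)) refl
  ...   | no w≢t = when-no (Lp.≡-dec _≟_ (w List.∷ʳ z) (t List.∷ʳ z)) (λ e → w≢t (proj₁ (Lp.∷ʳ-injective w t e)))

  when-zero : (d : Dec A) → 0 ≡ when d 0
  when-zero (yes _) = refl
  when-zero (no _) = refl

  restricts-u : ∀ {c} j {L f f'} → suc (suc j) ≤ L → Restricts c L f f' → Restricts c L (u j f) (u j f')
  restricts-u zero p r [] z refl with () ← p
  restricts-u zero p r (x ∷ []) z refl with s≤s () ← p
  restricts-u {c} zero p r (x ∷ y ∷ w) z e with x <ᵇ y
  ... | true = r (y ∷ x ∷ w) z e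
  ... | false = when-zero (z ≟ c)
  restricts-u (suc j) () r [] z refl
  restricts-u (suc j) (s≤s p) r (x ∷ w) z refl = restricts-u j p (λ v y e → r (x ∷ v) y (cong suc e)) w z refl

  when-h : (d : Dec A) (α p q : ℕ) → α * when d p + when d q ≡ when d (α * p + q)
  when-h (yes _) α p q = refl
  when-h (no _) α p q = trans (Np.+-identityʳ (α * 0)) (Np.*-zeroʳ α)

  restricts-row : ∀ {c} l α {L f f'} → suc l ≤ L → Restricts c L f f' → Restricts c L (row l α f) (row l α f')
  restricts-row zero α p r = r
  restricts-row {c} (suc l) α {f' = f'} p r = restricts-row l α (Np.<⇒≤ p) λ w z e →
    trans (cong₂ (λ a b → α * a + b) (r w z e) (restricts-u l p r w z e)) (when-h (z ≟ c) α (f' w) (u l f' w))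

  u-vanish : ∀ j {P : ℕ → Set} {g : Fun} w → (∀ v → List.length v ≡ List.length w → All P v → g v ≡ 0) → All P w → u j g w ≡ 0
  u-vanish zero [] e _ = refl
  u-vanish zero (x ∷ []) e _ = refl
  u-vanish zero (x ∷ y ∷ w) e (px ∷ py ∷ pw) with x <ᵇ y
  ... | true = e _ refl (py ∷ px ∷ pw)
  ... | false = refl
  u-vanish (suc j) [] e _ = refl
  u-vanish (suc j) (x ∷ w) e (px ∷ pw) = u-vanish j w (λ v l a → e (x ∷ v) (cong suc l) (px ∷ a)) pw

  -- The letter c has to be carried to the last position by the first row.
  module FirstRow (c L : ℕ) where
    -- At `j = L` a nonzero value requires `c` in the last place. Absorbing the factor `α + u j`
    -- relaxes this by one place, see `vanishes-h`.
    Vanishes : ℕ → Fun → Set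
    Vanishes j f = ∀ as bs → List.length as < j → List.length as + List.length bs ≡ L → All (c <_) bs → f (as ++ c ∷ bs) ≡ 0

    u-beyond : ∀ j {f : Fun} as bs → List.length as < j → All (c <_) bs →
      (∀ v → List.length v ≡ List.length bs → All (c <_) v → f (as ++ c ∷ v) ≡ 0) → u j f (as ++ c ∷ bs) ≡ 0
    u-beyond (suc j) [] bs _ a e = u-vanish j bs e a
    u-beyond (suc j) (x ∷ as) bs (s≤s p) a e = u-beyond j as bs p a e

    vanishes-h : ∀ j α {f} → Vanishes (suc j) f → Vanishes j (h j α f)
    vanishes-h j α {f} v as bs p e a
      rewrite v as bs (Np.m<n⇒m<1+n p) e a
            | u-beyond j {f} as bs p a (λ w l aw → v as w (Np.m<n⇒m<1+n p) (trans (cong (List.length as +_) l) e) aw)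
      = trans (Np.+-identityʳ _) (Np.*-zeroʳ α)

    u-at : ∀ as y bs (f : Fun) → c < y → u (List.length as) f (as ++ c ∷ y ∷ bs) ≡ f (as ++ y ∷ c ∷ bs)
    u-at [] y bs f p with c <ᵇ y in e
    ... | true = refl
    ... | false = ⊥-elim (subst T e (Np.<⇒<ᵇ p))
    u-at (x ∷ as) y bs f p = u-at as y bs (f ∘ (x ∷_)) p

    -- The scalar in a factor would leave `c` at a place from which the later factors give zero.
    -- Hence each factor has to move `c`, the smallest letter, one place to the right, and the
    -- weight of the row does not appear in the result.
    carry : ∀ j α f → Vanishes j f → ∀ xs ys → List.length xs ≡ j → List.length xs + List.length ys ≡ L →
      All (c <_) xs → All (c <_) ys → row j α f (c ∷ xs ++ ys) ≡ f (xs ++ c ∷ ys)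
    carry zero α f v [] ys _ _ _ _ = refl
    carry (suc j) α f v xs ys lx lT ax ay with reverseView xs
    ... | [] with () ← lx
    ... | xs₀ ∶ _ ∶ʳ y = begin
      row j α (h j α f) (c ∷ (xs₀ List.∷ʳ y) ++ ys) ≡⟨ cong (λ q → row j α (h j α f) (c ∷ q)) (Lp.++-assoc xs₀ (y ∷ []) ys) ⟩
      row j α (h j α f) (c ∷ xs₀ ++ y ∷ ys)         ≡⟨ carry j α (h j α f) (vanishes-h j α v) xs₀ (y ∷ ys) l₀ lT' (proj₁ aa) (proj₂ (Allₚ.∷ʳ⁻ ax) ∷ ay) ⟩
      α * f (xs₀ ++ c ∷ y ∷ ys) + u j f (xs₀ ++ c ∷ y ∷ ys)
        ≡⟨ cong₂ (λ p q → α * p + q) (v xs₀ (y ∷ ys) (subst (_< suc j) (sym l₀) Np.≤-refl) lT' (proj₂ aa ∷ ay))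
             (trans (cong (λ i → u i f (xs₀ ++ c ∷ y ∷ ys)) (sym l₀)) (u-at xs₀ y ys f (proj₂ aa))) ⟩
      α * 0 + f (xs₀ ++ y ∷ c ∷ ys)                 ≡⟨ cong (_+ f (xs₀ ++ y ∷ c ∷ ys)) (Np.*-zeroʳ α) ⟩
      f (xs₀ ++ y ∷ c ∷ ys)                         ≡⟨ cong f (sym (Lp.++-assoc xs₀ (y ∷ []) (c ∷ ys))) ⟩
      f ((xs₀ List.∷ʳ y) ++ c ∷ ys) ∎
      where
      open ≡-Reasoning
      aa = Allₚ.∷ʳ⁻ ax
      l₀ : List.length xs₀ ≡ j
      l₀ = Np.suc-injective (trans (sym (trans (Lp.length-++ xs₀) (Np.+-comm _ 1))) lx)
      lT' : List.length xs₀ + suc (List.length ys) ≡ L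
      lT' = trans (Np.+-suc _ _) (trans (cong (_+ List.length ys) (sym (trans (Lp.length-++ xs₀) (Np.+-comm _ 1)))) lT)

    restricts⇒vanishes : ∀ {f f'} → Restricts c L f f' → Vanishes L f
    restricts⇒vanishes {f} r as bs p e a with reverseView bs
    ... | [] = ⊥-elim (Np.<-irrefl (trans (sym (Np.+-identityʳ _)) e) p)
    ... | bs₀ ∶ _ ∶ʳ z = trans (cong f (sym (Lp.++-assoc as (c ∷ bs₀) (z ∷ []))))
      (trans (r (as ++ c ∷ bs₀) z len) (when-no (z ≟ c) (λ z≡c → Np.<-irrefl (sym z≡c) (proj₂ (Allₚ.∷ʳ⁻ a)))))
      where
      len : List.length (as ++ c ∷ bs₀) ≡ L
      len = trans (Lp.length-++ as) (trans (cong (List.length as +_) (sym (trans (Lp.length-++ bs₀) (Np.+-comm _ 1)))) e)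

  foldr-snoc : (f : ℕ → A → A) (e : A) → ∀ xs x → foldr f e (xs List.∷ʳ x) ≡ foldr f (f x e) xs
  foldr-snoc f e xs x = Lp.foldr-++ f e xs (x ∷ [])

  foldr-row-cong : ∀ l αs {f g : Fun} → (∀ w → f w ≡ g w) → ∀ w → foldr (row l) f αs w ≡ foldr (row l) g αs w
  foldr-row-cong l [] e = e
  foldr-row-cong l (a ∷ αs) e = row-cong l a (foldr-row-cong l αs e)

  foldr-row-linear : ∀ l αs a b (f g : Fun) w →
    foldr (row l) (λ v → a * f v + b * g v) αs w ≡ a * foldr (row l) f αs w + b * foldr (row l) g αs w
  foldr-row-linear l [] a b f g w = refl
  foldr-row-linear l (α ∷ αs) a b f g w = trans (row-cong l α (foldr-row-linear l αs a b f g) w) (row-linear l α a b _ _ w)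

  row-scale : ∀ l α c (f : Fun) w → row l α (λ v → c * f v) w ≡ c * row l α f w
  row-scale l α c f w = trans (row-cong l α (λ v → sym (Np.+-identityʳ (c * f v))) w)
    (trans (row-linear l α c 0 f f w) (Np.+-identityʳ _))

  foldr-row-rotate : ∀ l a αs (f : Fun) w → foldr (row l) f (a ∷ αs) w ≡ foldr (row l) f (αs List.∷ʳ a) w
  foldr-row-rotate l a [] f w = refl
  foldr-row-rotate l a (b ∷ αs) f w = trans (row-commute l a b _ w) (row-cong l b (foldr-row-rotate l a αs f) w)

  module PipeOperators (s : ℕ → ℕ) where
    -- The rows of the vertices with fewer than `m` nontrivial diagonals to later ones, each one
    -- letter shorter than its predecessor.
    tailRows : ℕ → Fun → Fun
    tailRows zero f = f
    tailRows (suc l) f = row l (s l) (tailRows l f)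

    pipeSum : ℕ → ℕ → List ℕ → ℕ
    pipeSum m c αs = foldr (row m) (tailRows m (indicator (target c m))) αs (start c m)

    -- The truncated row: one of length `suc l` in which the factor `b + u l` is replaced by `b`.
    scaledRow : ℕ → ℕ → Fun → Fun
    scaledRow l b f w = b * row l b f w

    partialPipeSum : ℕ → ℕ → List ℕ → ℕ → List ℕ → ℕ
    partialPipeSum l c fs α bs =
      foldr (row (suc l)) (row (suc l) α (foldr (scaledRow l) (tailRows (suc l) (indicator (target c (suc l)))) bs)) fs (start c (suc l))

    pipeSum-snoc : ∀ l c fs α → pipeSum (suc l) c (fs List.∷ʳ α) ≡ partialPipeSum l c fs α []
    pipeSum-snoc l c fs α = cong (λ f → f (start c (suc l))) (foldr-snoc (row (suc l)) _ fs α)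

    partialPipeSum-exchange : ∀ l c fs α β bs →
      β * partialPipeSum l c (fs List.∷ʳ α) β bs + α * partialPipeSum l c fs β (α ∷ bs) ≡
      α * partialPipeSum l c (fs List.∷ʳ α) β bs + β * partialPipeSum l c fs α (β ∷ bs)
    partialPipeSum-exchange l c fs α β bs
      rewrite foldr-snoc (row (suc l)) (row (suc l) β (foldr (scaledRow l) (tailRows (suc l) (indicator (target c (suc l)))) bs)) fs α
      = trans (sym (foldr-row-linear (suc l) fs β α _ _ w))
          (trans (foldr-row-cong (suc l) fs (row-exchange l α β (row-commute (suc l) α β) g) w)
            (foldr-row-linear (suc l) fs α β _ _ w))
      where
      w = start c (suc l)
      g = foldr (scaledRow l) (tailRows (suc l) (indicator (target c (suc l)))) bs

    foldr-scaledRow : ∀ l bs f w → foldr (scaledRow l) f bs w ≡ product bs * foldr (row l) f bs w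
    foldr-scaledRow l [] f w = sym (Np.+-identityʳ _)
    foldr-scaledRow l (b ∷ bs) f w = trans
      (cong (b *_) (trans (row-cong l b (foldr-scaledRow l bs f) w) (row-scale l b (product bs) _ w)))
      (sym (Np.*-assoc b (product bs) _))

    restricts-tailRows : ∀ {c L} l {f f'} → l ≤ L → Restricts c L f f' → Restricts c L (tailRows l f) (tailRows l f')
    restricts-tailRows zero p r = r
    restricts-tailRows (suc l) p r = restricts-row l (s l) p (restricts-tailRows l (Np.<⇒≤ p) r)

    restricts-foldr : ∀ {c L} l αs {f f'} → suc l ≤ L → Restricts c L f f' → Restricts c L (foldr (row l) f αs) (foldr (row l) f' αs)
    restricts-foldr l [] p r = r
    restricts-foldr l (α ∷ αs) p r = restricts-row l α p (restricts-foldr l αs p r)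

    -- Rows behind the first have at most `l` letters and never touch the last place, so the first
    -- row must carry `c` there. Removing `c` leaves the same problem on the letters from `suc c`
    -- on; the longest row of the tail now has full length and joins the others.
    partialPipeSum-base : ∀ l c α bs → partialPipeSum l c [] α bs ≡ product bs * pipeSum l (suc c) (bs List.∷ʳ s l)
    partialPipeSum-base l c α bs = begin
      row (suc l) α (foldr (scaledRow l) R bs) (c ∷ xs)
        ≡⟨ row-cong (suc l) α (foldr-scaledRow l bs R) (c ∷ xs) ⟩
      row (suc l) α (λ w → product bs * foldr (row l) R bs w) (c ∷ xs)
        ≡⟨ row-scale (suc l) α (product bs) (foldr (row l) R bs) (c ∷ xs) ⟩
      product bs * row (suc l) α (foldr (row l) R bs) (c ∷ xs)
        ≡⟨ cong (product bs *_) (begin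
          row (suc l) α (foldr (row l) R bs) (c ∷ xs)
            ≡⟨ cong (λ q → row (suc l) α (foldr (row l) R bs) (c ∷ q)) (sym (Lp.++-identityʳ xs)) ⟩
          row (suc l) α (foldr (row l) R bs) (c ∷ xs ++ [])
            ≡⟨ carry (suc l) α (foldr (row l) R bs) (restricts⇒vanishes {foldr (row l) R bs} {foldr (row l) R' bs} restr) xs []
                 (start-length (suc c) l) (trans (Np.+-identityʳ _) (start-length (suc c) l))
                 (start-above c (suc c) l Np.≤-refl) [] ⟩
          foldr (row l) R bs (xs List.∷ʳ c)
            ≡⟨ restr xs c (start-length (suc c) l) ⟩
          when (c ≟ c) (foldr (row l) R' bs xs)
            ≡⟨ when-yes (c ≟ c) refl ⟩
          foldr (row l) R' bs xs
            ≡⟨ cong (λ f → f xs) (sym (foldr-snoc (row l) (tailRows l (indicator (target (suc c) l))) bs (s l))) ⟩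
          pipeSum l (suc c) (bs List.∷ʳ s l) ∎) ⟩
      product bs * pipeSum l (suc c) (bs List.∷ʳ s l) ∎
      where
      open ≡-Reasoning
      open FirstRow c (suc l)
      R R' : Fun
      R = tailRows (suc l) (indicator (target c (suc l)))
      R' = tailRows (suc l) (indicator (target (suc c) l))
      xs = start (suc c) l
      restr : Restricts c (suc l) (foldr (row l) R bs) (foldr (row l) R' bs)
      restr = restricts-foldr l bs Np.≤-refl (restricts-tailRows (suc l) Np.≤-refl
        (restricts-indicator c (suc l) (target (suc c) l)))

  cancel-absurd : ∀ {α β p q} → α ≢ β → ∀ a a' →
    β * a + q ≡ α * a + p → β * a' + q ≡ α * a' + p → a < a' → ⊥
  cancel-absurd {α} {β} {p} {q} α≢β a a' e e' a<a' with Np.m≤n⇒∃[o]m+o≡n a<a'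
  ... | o , refl = α≢β (Np.*-cancelʳ-≡ α β (suc o) (Np.+-cancelˡ-≡ (β * a + q + (α * a + p)) _ _
      (trans (l₁ α β a o p q) (trans (cong₂ _+_ e (sym e')) (l₂ α β a o p q)))))
    where
    l₁ : ∀ α β a o p q → (β * a + q) + (α * a + p) + α * (1 + o) ≡ (β * a + q) + (α * (1 + a + o) + p)
    l₁ = solve-∀
    l₂ : ∀ α β a o p q → (α * a + p) + (β * (1 + a + o) + q) ≡ (β * a + q) + (α * a + p) + β * (1 + o)
    l₂ = solve-∀

  -- Subtracting the equations would give `(β - α)(a - a') = 0`; in the natural numbers a case
  -- distinction on the order of `a` and `a'` replaces the subtraction.
  cancel-exchange : ∀ {α β a a' p q} → α ≢ β →
    β * a + q ≡ α * a + p → β * a' + q ≡ α * a' + p → a ≡ a'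
  cancel-exchange {α} {β} {a} {a'} {p} {q} α≢β e e' with Np.<-cmp a a'
  ... | tri≈ _ a≡a' _ = a≡a'
  ... | tri< a<a' _ _ = ⊥-elim (cancel-absurd α≢β a a' e e' a<a')
  ... | tri> _ _ a'<a = ⊥-elim (cancel-absurd α≢β a' a e' e a'<a)

  unique-↭ : {xs ys : List ℕ} → xs ↭ ys → Unique xs → Unique ys
  unique-↭ p = PmS.Unique-resp-↭ (setoid ℕ) (↭⇒↭ₛ p)

  Exchange : (List ℕ → ℕ → List ℕ → ℕ) → Set
  Exchange Φ = ∀ fs α β bs →
    β * Φ (fs List.∷ʳ α) β bs + α * Φ fs β (α ∷ bs) ≡ α * Φ (fs List.∷ʳ α) β bs + β * Φ fs α (β ∷ bs)

  -- The exchange relation is a linear equation for `Φ (fs ∷ʳ a) b bs` with coefficient `b - a`, and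
  -- the other two values in it have the shorter front `fs`. The list `rest` carries along the
  -- weights whose distinctness the base case needs.
  exchange-unique : (Φ Ψ : List ℕ → ℕ → List ℕ → ℕ) → Exchange Φ → Exchange Ψ → (rest : List ℕ) →
    (∀ α bs → Unique (α ∷ bs ++ rest) → Φ [] α bs ≡ Ψ [] α bs) →
    ∀ {fs} → Reverse fs → ∀ α bs → Unique (fs ++ α ∷ bs ++ rest) → Φ fs α bs ≡ Ψ fs α bs
  exchange-unique Φ Ψ exΦ exΨ rest base [] α bs uq = base α bs uq
  exchange-unique Φ Ψ exΦ exΨ rest base (fs ∶ r ∶ʳ a) b bs uq = cancel-exchange {a} {b} a≢b
    (exΦ fs a b bs)
    (trans (cong (λ q → b * Ψ (fs List.∷ʳ a) b bs + a * q) (exchange-unique Φ Ψ exΦ exΨ rest base r b (a ∷ bs) uq₂))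
      (trans (exΨ fs a b bs) (cong (λ q → a * Ψ (fs List.∷ʳ a) b bs + b * q) (sym (exchange-unique Φ Ψ exΦ exΨ rest base r a (b ∷ bs) uq₁)))))
    where
    uq₁ : Unique (fs ++ a ∷ b ∷ bs ++ rest)
    uq₁ = subst Unique (Lp.++-assoc fs (a ∷ []) (b ∷ bs ++ rest)) uq
    uq₂ : Unique (fs ++ b ∷ a ∷ bs ++ rest)
    uq₂ = unique-↭ (Pm.++⁺ˡ fs (swap a b ↭-refl)) uq₁
    a≢b : a ≢ b
    a≢b with unique-↭ (↭-trans (Pm.shift a fs (b ∷ bs ++ rest)) (prep a (Pm.shift b fs (bs ++ rest)))) uq₁
    ... | (a≢b ∷ _) ∷ _ = a≢b

  module Equality (s : ℕ → ℕ) where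
    open PathOperators s
    open PipeOperators s

    -- Induction on `m`: the two base formulas have the common factor `product bs` and lead to size
    -- `l`, where `s l` has become one of the free weights. A nonempty `αs` supplies the factor in
    -- the middle position of the exchange relation.
    pathSum≡pipeSum : ∀ m c αs → αs ≢ [] → Unique (αs ++ List.map s (List.downFrom m)) →
      pathSum m αs ≡ pipeSum m c αs
    pathSum≡pipeSum zero c αs _ _ = trans (path1 αs) (sym (pipe1 αs))
      where
      open PathAlgebra s
      path1 : ∀ as → pathSum 0 as ≡ 1
      path1 [] = refl
      path1 (a ∷ as) = trans (l _) (path1 as)
        where
        l : ∀ p → 1 * p + 0 ≡ p
        l = solve-∀
      pipe1 : ∀ as → foldr (row 0) (indicator (target c 0)) as (c ∷ []) ≡ 1
      pipe1 [] = when-yes (Lp.≡-dec _≟_ (c ∷ []) (c ∷ [])) refl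
      pipe1 (a ∷ as) = pipe1 as
    pathSum≡pipeSum (suc l) c αs ne uq with reverseView αs
    ... | [] = ⊥-elim (ne refl)
    ... | fs ∶ r ∶ʳ b = trans (pathSum-snoc (suc l) fs b) (trans
        (exchange-unique (partialPathSum (suc l)) (partialPipeSum l c)
          (partialPathSum-exchange (suc l)) (partialPipeSum-exchange l c) rest base r b []
          (subst Unique (Lp.++-assoc fs (b ∷ []) rest) uq))
        (sym (pipeSum-snoc l c fs b)))
      where
      rest = List.map s (List.downFrom (suc l))
      base : ∀ α bs → Unique (α ∷ bs ++ rest) → partialPathSum (suc l) [] α bs ≡ partialPipeSum l c [] α bs
      base α bs (_ ∷ uq) = trans (partialPathSum-base l α bs) (trans
        (cong (product bs *_) (trans (pathSum≡pipeSum l (suc c) (s l ∷ bs) (λ ()) (unique-↭ (Pm.shift (s l) bs _) uq))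
          -- The path side places the new weight `s l` first, the row side last; commuting rows
          -- reconcile the two.
          (foldr-row-rotate l (s l) bs _ _)))
        (sym (partialPipeSum-base l c α bs)))

-- Coefficients from integer evaluations, and bijections between fibres of equal size.

module Coefficients where
  open Sums
  open PathTransfer using (when; when-yes; when-no)
  open import Data.Nat.DivMod using ([m+kn]%n≡m%n; m<n⇒m%n≡m)
  open import Data.Fin using (Fin; zero; suc; cast)
  open import Data.List.Membership.Propositional using (_∈_)
  open import Data.List.Membership.Propositional.Properties using (∈-filter⁺; ∈-filter⁻; ∈-lookup)
  open import Data.List.Relation.Unary.Any using (here; there; index)
  open import Data.List.Relation.Unary.Any.Properties using (lookup-index)
  open import Data.List.Relation.Unary.All using (All; []; _∷_)
  open import Data.List.Relation.Unary.AllPairs using ([]; _∷_)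
  open import Data.List.Relation.Unary.Unique.Propositional using (Unique)
  open import Data.List.Relation.Unary.Unique.Propositional.Properties using (filter⁺)
  open import Data.Vec.Relation.Unary.All as VAll using ([]; _∷_)
  open import Function.Bundles using (Inverse)
  open import Relation.Binary.PropositionalEquality using (setoid)

  digits-unique : ∀ M .{{_ : NonZero M}} {z z' q q'} → z < M → z' < M → z + q * M ≡ z' + q' * M → z ≡ z' × q ≡ q'
  digits-unique M {z} {z'} {q} {q'} z<M z'<M e = z≡z' , Np.*-cancelʳ-≡ q q' M (Np.+-cancelˡ-≡ z _ _ (trans e (cong (_+ q' * M) (sym z≡z'))))
    where
    open import Data.Nat.DivMod using (_%_)
    z≡z' : z ≡ z'
    z≡z' = trans (sym (m<n⇒m%n≡m z<M)) (trans (sym ([m+kn]%n≡m%n z q M))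
      (trans (cong (_% M) e) (trans ([m+kn]%n≡m%n z' q' M) (m<n⇒m%n≡m z'<M))))

  occurrences : ℕ → List ℕ → ℕ
  occurrences v cs = ∑ cs λ c → when (c ≟ v) 1

  -- For a sum of powers of `M` given by its exponents, this removes the part of exponent 0 and
  -- divides the rest by `M`.
  predecessors : List ℕ → List ℕ
  predecessors [] = []
  predecessors (zero ∷ cs) = predecessors cs
  predecessors (suc c ∷ cs) = c ∷ predecessors cs

  length-predecessors : ∀ cs → List.length (predecessors cs) ≤ List.length cs
  length-predecessors [] = z≤n
  length-predecessors (zero ∷ cs) = Np.m≤n⇒m≤1+n (length-predecessors cs)
  length-predecessors (suc c ∷ cs) = s≤s (length-predecessors cs)

  occurrences-≤ : ∀ v cs → occurrences v cs ≤ List.length cs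
  occurrences-≤ v [] = z≤n
  occurrences-≤ v (c ∷ cs) with c ≟ v
  ... | yes _ = s≤s (occurrences-≤ v cs)
  ... | no _ = Np.m≤n⇒m≤1+n (occurrences-≤ v cs)

  occurrences-suc : ∀ v cs → occurrences (suc v) cs ≡ occurrences v (predecessors cs)
  occurrences-suc v [] = refl
  occurrences-suc v (zero ∷ cs) = occurrences-suc v cs
  occurrences-suc v (suc c ∷ cs) with c ≟ v
  ... | yes refl = cong₂ _+_ (when-yes (suc c ≟ suc c) refl) (occurrences-suc c cs)
  ... | no c≢v = cong₂ _+_ (when-no (suc c ≟ suc v) (c≢v ∘ Np.suc-injective)) (occurrences-suc v cs)

  ∑-powers : ∀ M cs → ∑ cs (M ^_) ≡ occurrences 0 cs + ∑ (predecessors cs) (M ^_) * M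
  ∑-powers M [] = refl
  ∑-powers M (zero ∷ cs) = cong suc (∑-powers M cs)
  ∑-powers M (suc c ∷ cs) = trans (cong (M * M ^ c +_) (∑-powers M cs))
    (lem M (M ^ c) (occurrences 0 cs) (∑ (predecessors cs) (M ^_)))
    where
    lem : ∀ M p z q → M * p + (z + q * M) ≡ z + (p + q) * M
    lem = solve-∀

  -- The multiplicities of the exponents are the base `M` digits of the sum; lists shorter than `M`
  -- produce no carry.
  powers-determine : ∀ M .{{_ : NonZero M}} v cs ds → List.length cs < M → List.length ds < M →
    ∑ cs (M ^_) ≡ ∑ ds (M ^_) → occurrences v cs ≡ occurrences v ds
  powers-determine M v cs ds lc ld e = go v
    where
    split : occurrences 0 cs ≡ occurrences 0 ds × ∑ (predecessors cs) (M ^_) ≡ ∑ (predecessors ds) (M ^_)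
    split = digits-unique M (Np.≤-<-trans (occurrences-≤ 0 cs) lc) (Np.≤-<-trans (occurrences-≤ 0 ds) ld)
      (trans (sym (∑-powers M cs)) (trans e (∑-powers M ds)))
    go : ∀ v → occurrences v cs ≡ occurrences v ds
    go zero = proj₁ split
    go (suc v) = trans (occurrences-suc v cs) (trans
      (powers-determine M v (predecessors cs) (predecessors ds)
        (Np.≤-<-trans (length-predecessors cs) lc) (Np.≤-<-trans (length-predecessors ds) ld) (proj₂ split))
      (sym (occurrences-suc v ds)))

  monomial : ∀ {N} → (ℕ → ℕ) → Vec ℕ N → ℕ
  monomial x [] = 1
  monomial x (d ∷ ds) = x 0 ^ d * monomial (x ∘ suc) ds

  code : ∀ {N} → ℕ → Vec ℕ N → ℕ
  code K [] = 0
  code K (d ∷ ds) = d + code K ds * K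

  -- The scale `c` is there for the induction: the variables of the tail have the same form with
  -- `c * K` in its place.
  monomial-code : ∀ {N} M K c (ds : Vec ℕ N) {x : ℕ → ℕ} → (∀ j → x j ≡ M ^ (c * K ^ j)) → monomial x ds ≡ M ^ (c * code K ds)
  monomial-code M K c [] e = sym (cong (M ^_) (Np.*-zeroʳ c))
  monomial-code M K c (d ∷ ds) {x} e = begin
    x 0 ^ d * monomial (x ∘ suc) ds     ≡⟨ cong₂ (λ p q → p ^ d * q) (trans (e 0) (cong (M ^_) (Np.*-identityʳ c)))
                                            (monomial-code M K (c * K) ds (λ j → trans (e (suc j)) (cong (M ^_) (sym (Np.*-assoc c K _))))) ⟩
    (M ^ c) ^ d * M ^ (c * K * code K ds) ≡⟨ cong (_* M ^ (c * K * code K ds)) (Np.^-*-assoc M c d) ⟩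
    M ^ (c * d) * M ^ (c * K * code K ds) ≡⟨ sym (Np.^-distribˡ-+-* M (c * d) _) ⟩
    M ^ (c * d + c * K * code K ds)       ≡⟨ cong (M ^_) (lem c d K (code K ds)) ⟩
    M ^ (c * (d + code K ds * K)) ∎
    where
    open ≡-Reasoning
    lem : ∀ c d K q → c * d + c * K * q ≡ c * (d + q * K)
    lem = solve-∀

  code-injective : ∀ {N} K .{{_ : NonZero K}} {d e : Vec ℕ N} → VAll.All (_< K) d → VAll.All (_< K) e → code K d ≡ code K e → d ≡ e
  code-injective K [] [] _ = refl
  code-injective K (p ∷ ps) (q ∷ qs) eq with digits-unique K p q eq
  ... | refl , eq' = cong (_ ∷_) (code-injective K ps qs eq')

  entries-≤-sum : ∀ {N} (d : Vec ℕ N) {b} → Vec.sum d ≤ b → VAll.All (_< suc b) d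
  entries-≤-sum [] _ = []
  entries-≤-sum (x ∷ d) {b} p = s≤s (Np.≤-trans (Np.m≤m+n x _) p) ∷ entries-≤-sum d (Np.≤-trans (Np.m≤n+m _ x) p)

  term-≤-∑ : {xs : List A} (f : A → ℕ) {a : A} → a ∈ xs → f a ≤ ∑ xs f
  term-≤-∑ f (here refl) = Np.m≤m+n _ _
  term-≤-∑ f (there p) = Np.≤-trans (term-≤-∑ f p) (Np.m≤n+m _ _)

  module _ {N : ℕ} (LX : List A) (LY : List B) (wX : A → Vec ℕ N) (wY : B → Vec ℕ N) where

    -- Evaluate at the integers M^(K^j): the value of a monomial then is M to
    -- the number whose base K digits are the exponents.
    coefficients-agree :
      (∀ x → (∀ i j → x i ≡ x j → i ≡ j) → ∑ LX (monomial x ∘ wX) ≡ ∑ LY (monomial x ∘ wY)) →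
      ∀ d → ∑ LX (λ a → when (Vp.≡-dec _≟_ (wX a) d) 1) ≡ ∑ LY (λ b → when (Vp.≡-dec _≟_ (wY b) d) 1)
    coefficients-agree evaluations d = begin
      ∑ LX (λ a → when (Vp.≡-dec _≟_ (wX a) d) 1)
        ≡⟨ toCode LX wX (λ a a∈ → Np.≤-trans (term-≤-∑ (Vec.sum ∘ wX) a∈) (Np.≤-trans (Np.m≤m+n sX sY) (Np.m≤m+n (sX + sY) sd))) ⟩
      occurrences (code K d) cX
        ≡⟨ powers-determine M (code K d) cX cY
             (s≤s (subst (_≤ 1 + (List.length LX + List.length LY)) (sym (Lp.length-map _ LX)) (Np.m≤n⇒m≤1+n (Np.m≤m+n (List.length LX) _))))
             (s≤s (subst (_≤ 1 + (List.length LX + List.length LY)) (sym (Lp.length-map _ LY)) (Np.m≤n⇒m≤1+n (Np.m≤n+m (List.length LY) _)))) eq ⟩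
      occurrences (code K d) cY
        ≡⟨ sym (toCode LY wY (λ b b∈ → Np.≤-trans (term-≤-∑ (Vec.sum ∘ wY) b∈) (Np.≤-trans (Np.m≤n+m sY sX) (Np.m≤m+n (sX + sY) sd)))) ⟩
      ∑ LY (λ b → when (Vp.≡-dec _≟_ (wY b) d) 1) ∎
      where
      open ≡-Reasoning
      sX = ∑ LX (Vec.sum ∘ wX)
      sY = ∑ LY (Vec.sum ∘ wY)
      sd = Vec.sum d
      -- Exceeds every exponent that occurs and every entry of `d`, so codes are injective on them;
      -- being at least 2, it also makes the evaluation points increase.
      K = 2 + (sX + sY + sd)
      cX = List.map (code K ∘ wX) LX
      cY = List.map (code K ∘ wY) LY
      -- Exceeds the length of either list, hence every multiplicity, and is at least 2 for the same
      -- reason as `K`.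
      M = 2 + (List.length LX + List.length LY)
      x : ℕ → ℕ
      x j = M ^ (1 * K ^ j)
      x-increasing : ∀ {i j} → i < j → x i < x j
      x-increasing {i} {j} i<j = Np.^-monoʳ-< M (s≤s (s≤s z≤n))
        (subst₂ _<_ (sym (Np.*-identityˡ (K ^ i))) (sym (Np.*-identityˡ (K ^ j))) (Np.^-monoʳ-< K (s≤s (s≤s z≤n)) i<j))
      x-injective : ∀ i j → x i ≡ x j → i ≡ j
      x-injective i j e with Np.<-cmp i j
      ... | tri< i<j _ _ = ⊥-elim (Np.<-irrefl e (x-increasing i<j))
      ... | tri≈ _ i≡j _ = i≡j
      ... | tri> _ _ j<i = ⊥-elim (Np.<-irrefl (sym e) (x-increasing j<i))
      toPowers : {C : Set} (L : List C) (w : C → Vec ℕ N) → ∑ (List.map (code K ∘ w) L) (M ^_) ≡ ∑ L (monomial x ∘ w)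
      toPowers L w = trans (∑-map (code K ∘ w) L (M ^_)) (∑-cong L (λ a →
        sym (trans (monomial-code M K 1 (w a) (λ _ → refl)) (cong (M ^_) (Np.*-identityˡ (code K (w a)))))))
      eq : ∑ (List.map (code K ∘ wX) LX) (M ^_) ≡ ∑ (List.map (code K ∘ wY) LY) (M ^_)
      eq = trans (toPowers LX wX) (trans (evaluations x x-injective) (sym (toPowers LY wY)))
      toCode : {C : Set} (L : List C) (w : C → Vec ℕ N) →
        (∀ a → a ∈ L → Vec.sum (w a) ≤ sX + sY + sd) →
        ∑ L (λ a → when (Vp.≡-dec _≟_ (w a) d) 1) ≡ occurrences (code K d) (List.map (code K ∘ w) L)
      toCode L w small = trans (∑-cong∈ L same) (sym (∑-map (code K ∘ w) L (λ c → when (c ≟ code K d) 1)))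
        where
        same : ∀ a → a ∈ L → when (Vp.≡-dec _≟_ (w a) d) 1 ≡ when (code K (w a) ≟ code K d) 1
        same a a∈ with Vp.≡-dec _≟_ (w a) d
        ... | yes refl = sym (when-yes (code K d ≟ code K d) refl)
        ... | no ne = sym (when-no (code K (w a) ≟ code K d) (λ e → ne (code-injective K
                (entries-≤-sum (w a) (Np.m≤n⇒m≤1+n (small a a∈)))
                (entries-≤-sum d (Np.m≤n⇒m≤1+n (Np.m≤n+m sd (sX + sY)))) e)))

  length-filter : {P : A → Set} (P? : ∀ a → Dec (P a)) (xs : List A) → List.length (List.filter P? xs) ≡ ∑ xs (λ a → when (P? a) 1)
  length-filter P? [] = refl
  length-filter P? (x ∷ xs) with P? x
  ... | yes _ = cong suc (length-filter P? xs)
  ... | no _ = length-filter P? xs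

  lookup-unique : {xs : List A} → Unique xs → ∀ {i j} → List.lookup xs i ≡ List.lookup xs j → i ≡ j
  lookup-unique (_ ∷ _) {zero} {zero} _ = refl
  lookup-unique {xs = x ∷ xs} (p ∷ _) {zero} {suc j} e = ⊥-elim (All.lookup p (∈-lookup {xs = xs} j) e)
  lookup-unique {xs = x ∷ xs} (p ∷ _) {suc i} {zero} e = ⊥-elim (All.lookup p (∈-lookup {xs = xs} i) (sym e))
  lookup-unique (_ ∷ uq) {suc i} {suc j} e = cong suc (lookup-unique uq e)

  -- Elements correspond by their positions. Uniqueness makes the image independent of the
  -- membership proof, as required by setoids that compare only the underlying data.
  module Transfer {A B : Set} {xs : List A} {ys : List B} (ux : Unique xs) (uy : Unique ys)
    (eq : List.length xs ≡ List.length ys) where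

    transfer : ∀ {x} → x ∈ xs → B
    transfer p = List.lookup ys (cast eq (index p))

    transfer-∈ : ∀ {x} (p : x ∈ xs) → transfer p ∈ ys
    transfer-∈ p = ∈-lookup {xs = ys} (cast eq (index p))

    transfer-cong : ∀ {x x'} (p : x ∈ xs) (p' : x' ∈ xs) → x ≡ x' → transfer p ≡ transfer p'
    transfer-cong p p' e = cong (List.lookup ys ∘ cast eq)
      (lookup-unique ux (trans (sym (lookup-index p)) (trans e (lookup-index p'))))

  transfer-inverse : {A B : Set} {xs : List A} {ys : List B} (ux : Unique xs) (uy : Unique ys)
    (eq : List.length xs ≡ List.length ys) (eq' : List.length ys ≡ List.length xs) {y : B} {x : A} (p : y ∈ ys) (q : x ∈ xs) →
    x ≡ Transfer.transfer uy ux eq' p → Transfer.transfer ux uy eq q ≡ y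
  transfer-inverse {xs = xs} {ys} ux uy eq eq' p q e = trans
    (cong (List.lookup ys) (trans (cong (cast eq) (lookup-unique ux (trans (sym (lookup-index q)) e)))
      (trans (Fp.cast-trans eq' eq (index p)) (Fp.cast-is-id _ (index p)))))
    (sym (lookup-index p))

  module _ {N : ℕ} {X Y : Set} (LX : List X) (LY : List Y) (wX : X → Vec ℕ N) (wY : Y → Vec ℕ N)
    (uX : Unique LX) (uY : Unique LY)
    {PX : X → Set} {PY : Y → Set} {W : Y → Set} (d : Vec ℕ N)
    (X⇒ : ∀ {x} → PX x → x ∈ LX) (X⇐ : ∀ {x} → x ∈ LX → PX x)
    (Y⇒ : ∀ {y} → PY y → y ∈ LY) (Y⇐ : ∀ {y} → y ∈ LY → PY y)
    (W⇒ : ∀ {y} → W y → wY y ≡ d) (W⇐ : ∀ {y} → wY y ≡ d → W y)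
    (evaluations : ∀ x → (∀ i j → x i ≡ x j → i ≡ j) → ∑ LX (monomial x ∘ wX) ≡ ∑ LY (monomial x ∘ wY)) where

    fibres-inverse : Inverse
      (On.setoid {B = Σ X λ x → PX x × wX x ≡ d} (setoid X) proj₁)
      (On.setoid {B = Σ Y λ y → PY y × W y} (setoid Y) proj₁)
    fibres-inverse = record
      { to = λ t → T₁.transfer (mX t) , toY (T₁.transfer-∈ (mX t))
      ; from = λ t → T₂.transfer (mY t) , toX (T₂.transfer-∈ (mY t))
      ; to-cong = λ {t} {t'} e → T₁.transfer-cong (mX t) (mX t') e
      ; from-cong = λ {t} {t'} e → T₂.transfer-cong (mY t) (mY t') e
      ; inverse = (λ {t} {t'} e → transfer-inverse ufX ufY len (sym len) (mY t) (mX t') e)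
                , (λ {t} {t'} e → transfer-inverse ufY ufX (sym len) len (mX t) (mY t') e)
      }
      where
      X? : ∀ x → Dec (wX x ≡ d)
      X? x = Vp.≡-dec _≟_ (wX x) d
      Y? : ∀ y → Dec (wY y ≡ d)
      Y? y = Vp.≡-dec _≟_ (wY y) d
      fX = List.filter X? LX
      fY = List.filter Y? LY
      ufX = filter⁺ X? uX
      ufY = filter⁺ Y? uY
      len : List.length fX ≡ List.length fY
      len = trans (length-filter X? LX) (trans (coefficients-agree LX LY wX wY evaluations d) (sym (length-filter Y? LY)))
      module T₁ = Transfer ufX ufY len
      module T₂ = Transfer ufY ufX (sym len)
      mX : (t : Σ X λ x → PX x × wX x ≡ d) → proj₁ t ∈ fX
      mX (x , p , e) = ∈-filter⁺ X? (X⇒ p) e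
      mY : (t : Σ Y λ y → PY y × W y) → proj₁ t ∈ fY
      mY (y , p , e) = ∈-filter⁺ Y? (Y⇒ p) (W⇒ e)
      toX : ∀ {x} → x ∈ fX → PX x × wX x ≡ d
      toX x∈ = let q = ∈-filter⁻ X? {xs = LX} x∈ in X⇐ (proj₁ q) , proj₂ q
      toY : ∀ {y} → y ∈ fY → PY y × W y
      toY y∈ = let q = ∈-filter⁻ Y? {xs = LY} y∈ in Y⇐ (proj₁ q) , W⇐ (proj₂ q)

-- Step lists versus heights of east steps.

module LatticePaths where
  open import Defs using (Step; N; E; countN; take; eastFrom; eastSteps; WeaklyAbove; ValidPath; Tpath; Bpath)
  open Sums
  open import Data.List using (length; replicate)
  open import Data.List.Membership.Propositional using (_∈_)
  open import Data.List.Membership.Propositional.Properties using (∈-++⁺ʳ; ∈-++⁻)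
  open import Data.List.Relation.Unary.Any using (here; there)

  countE : List Step → ℕ
  countE [] = 0
  countE (N ∷ p) = countE p
  countE (E ∷ p) = suc (countE p)

  count-length : ∀ p → countE p + countN p ≡ length p
  count-length [] = refl
  count-length (N ∷ p) = trans (Np.+-suc _ _) (cong suc (count-length p))
  count-length (E ∷ p) = cong suc (count-length p)

  countN-++ : ∀ p q → countN (p ++ q) ≡ countN p + countN q
  countN-++ [] q = refl
  countN-++ (N ∷ p) q = cong suc (countN-++ p q)
  countN-++ (E ∷ p) q = countN-++ p q

  record SplitAt (x y x₀ y₀ : ℕ) (p : List Step) : Set where
    constructor split
    field
      before after : List Step
      path≡ : p ≡ before ++ E ∷ after
      x≡ : x ≡ x₀ + countE before
      y≡ : y ≡ y₀ + countN before

  ∈⇒split : ∀ {x y} x₀ y₀ p → (x , y) ∈ eastFrom x₀ y₀ p → SplitAt x y x₀ y₀ p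
  ∈⇒split x₀ y₀ (N ∷ p) m with ∈⇒split x₀ (suc y₀) p m
  ... | split a c refl ex ey = split (N ∷ a) c refl ex (trans ey (sym (Np.+-suc y₀ _)))
  ∈⇒split x₀ y₀ (E ∷ p) (here refl) = split [] p refl (sym (Np.+-identityʳ _)) (sym (Np.+-identityʳ _))
  ∈⇒split x₀ y₀ (E ∷ p) (there m) with ∈⇒split (suc x₀) y₀ p m
  ... | split a c refl ex ey = split (E ∷ a) c refl (trans ex (sym (Np.+-suc x₀ _))) ey

  split⇒∈ : ∀ x₀ y₀ a c → (x₀ + countE a , y₀ + countN a) ∈ eastFrom x₀ y₀ (a ++ E ∷ c)
  split⇒∈ x₀ y₀ [] c = here (cong₂ _,_ (Np.+-identityʳ _) (Np.+-identityʳ _))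
  split⇒∈ x₀ y₀ (N ∷ a) c rewrite Np.+-suc y₀ (countN a) = split⇒∈ x₀ (suc y₀) a c
  split⇒∈ x₀ y₀ (E ∷ a) c rewrite Np.+-suc x₀ (countE a) = there (split⇒∈ (suc x₀) y₀ a c)

  take-++ : ∀ t a c → t ≤ length a → take t (a ++ c) ≡ take t a
  take-++ zero a c _ = refl
  take-++ (suc t) (x ∷ a) c (s≤s p) = cong (x ∷_) (take-++ t a c p)

  take-all : ∀ t a → length a ≤ t → take t a ≡ a
  take-all zero [] _ = refl
  take-all (suc t) [] _ = refl
  take-all (suc t) (x ∷ a) (s≤s p) = cong (x ∷_) (take-all t a p)

  take-through : ∀ a c → countN (take (suc (length a)) (a ++ E ∷ c)) ≡ countN a
  take-through [] c = refl
  take-through (N ∷ a) c = cong suc (take-through a c)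
  take-through (E ∷ a) c = take-through a c

  take-count : ∀ t p → t ≤ length p → countE (take t p) + countN (take t p) ≡ t
  take-count zero p _ = refl
  take-count (suc t) (N ∷ p) (s≤s le) = trans (Np.+-suc _ _) (cong suc (take-count t p le))
  take-count (suc t) (E ∷ p) (s≤s le) = cong suc (take-count t p le)

  countE-take : ∀ t p → countE (take t p) ≤ countE p
  countE-take zero p = z≤n
  countE-take (suc t) [] = z≤n
  countE-take (suc t) (N ∷ p) = countE-take t p
  countE-take (suc t) (E ∷ p) = s≤s (countE-take t p)

  countN-take : ∀ t p → countN (take t p) ≤ countN p
  countN-take zero p = z≤n
  countN-take (suc t) [] = z≤n
  countN-take (suc t) (N ∷ p) = s≤s (countN-take t p)
  countN-take (suc t) (E ∷ p) = countN-take t p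

  split-exists : ∀ p x → x < countE p → Σ (List Step) λ a → Σ (List Step) λ c → p ≡ a ++ E ∷ c × countE a ≡ x
  split-exists (N ∷ p) x lt with split-exists p x lt
  ... | a , c , refl , e = N ∷ a , c , refl , e
  split-exists (E ∷ p) zero lt = [] , p , refl , refl
  split-exists (E ∷ p) (suc x) (s≤s lt) with split-exists p x lt
  ... | a , c , refl , e = E ∷ a , c , refl , cong suc e

  take-prefix : ∀ t p → Σ (List Step) λ c → p ≡ take t p ++ c
  take-prefix zero p = p , refl
  take-prefix (suc t) [] = [] , refl
  take-prefix (suc t) (x ∷ p) with take-prefix t p
  ... | c , e = c , cong (x ∷_) e

  -- Comparison column by column, whereas `WeaklyAbove` compares at equal times; the next two lemmas
  -- relate the two for paths.
  Dominates : List Step → List Step → Set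
  Dominates p q = ∀ {x y z} → (x , y) ∈ eastSteps p → (x , z) ∈ eastSteps q → z ≤ y

  -- Look at the time just after `p` has made its east step in the column. If `q` ran higher there,
  -- it would by then have made no more east steps than precede that column, hence more north steps
  -- than `p`.
  above⇒dominates : ∀ p q → WeaklyAbove p q → Dominates p q
  above⇒dominates p q above {x} {y} {z} xy∈ xz∈ with ∈⇒split 0 0 p xy∈ | ∈⇒split 0 0 q xz∈
  ... | split a c refl refl refl | split a' c' refl e refl = Np.≮⇒≥ λ y<z →
    Np.<⇒≱ (enough y<z) (subst (countN (take (suc (length a)) (a' ++ E ∷ c')) ≤_) (take-through a c) (above (suc (length a))))
    where
    enough : countN a < countN a' → countN a < countN (take (suc (length a)) (a' ++ E ∷ c'))
    enough lt = Np.+-cancelˡ-≤ (countE a) _ _ (begin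
      countE a + suc (countN a)            ≡⟨ Np.+-suc _ _ ⟩
      suc (countE a + countN a)            ≡⟨ cong suc (count-length a) ⟩
      suc (length a)                       ≡⟨ sym (take-count (suc (length a)) a' t≤) ⟩
      countE (take (suc (length a)) a') + countN (take (suc (length a)) a')
        ≤⟨ Np.+-monoˡ-≤ _ (countE-take (suc (length a)) a') ⟩
      countE a' + countN (take (suc (length a)) a')
        ≡⟨ cong₂ (λ i l → i + countN l) (sym e) (sym (take-++ (suc (length a)) a' (E ∷ c') t≤)) ⟩
      countE a + countN (take (suc (length a)) (a' ++ E ∷ c')) ∎)
      where
      open Np.≤-Reasoning
      t≤ : suc (length a) ≤ length a'
      t≤ = subst₂ _≤_ (trans (Np.+-suc _ _) (cong suc (count-length a))) (trans (cong (_+ countN a') e) (count-length a'))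
             (Np.+-monoʳ-≤ (countE a) lt)

  -- If `q` is higher at time `t`, it has made fewer east steps. In the next column of `q`, the step
  -- of `p` is already done, at most at the current height of `p`, while that of `q` is still to
  -- come, at least at the current height of `q`.
  dominates⇒above : ∀ m p q → ValidPath m p → ValidPath m q → Dominates p q → WeaklyAbove p q
  dominates⇒above m p q (lp , np) (lq , nq) dom t with t ≤? m + m
  ... | no t≰ = Np.≤-reflexive (trans (cong countN (take-all t q (Np.≤-trans (Np.≤-reflexive lq) (Np.<⇒≤ (Np.≰⇒> t≰)))))
    (trans nq (trans (sym np) (cong countN (sym (take-all t p (Np.≤-trans (Np.≤-reflexive lp) (Np.<⇒≤ (Np.≰⇒> t≰)))))))))
  ... | yes t≤ = Np.≮⇒≥ λ lt → absurd lt
    where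
    tp tq : List Step
    tp = take t p
    tq = take t q
    countE≡m : countE q ≡ m
    countE≡m = Np.+-cancelʳ-≡ m _ _ (trans (cong (countE q +_) (sym nq)) (trans (count-length q) lq))
    countE-p≡m : countE p ≡ m
    countE-p≡m = Np.+-cancelʳ-≡ m _ _ (trans (cong (countE p +_) (sym np)) (trans (count-length p) lp))
    cp : countE tp + countN tp ≡ t
    cp = take-count t p (subst (t ≤_) (sym lp) t≤)
    cq : countE tq + countN tq ≡ t
    cq = take-count t q (subst (t ≤_) (sym lq) t≤)
    absurd : countN tp < countN tq → ⊥
    absurd lt = contradict (split-exists tp (countE tq) fewer) (split-exists q (countE tq) (subst (countE tq <_) (sym countE≡m) below-m))
      where
      fewer : countE tq < countE tp
      fewer = Np.≰⇒> λ le → Np.<-irrefl (trans cp (sym cq)) (Np.+-mono-≤-< le lt)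
      below-m : countE tq < m
      below-m = Np.<-≤-trans fewer (subst (countE tp ≤_) countE-p≡m (countE-take t p))
      contradict : (Σ (List Step) λ a → Σ (List Step) λ c → tp ≡ a ++ E ∷ c × countE a ≡ countE tq) →
        (Σ (List Step) λ a → Σ (List Step) λ c → q ≡ a ++ E ∷ c × countE a ≡ countE tq) → ⊥
      contradict (a , c , ea , ca) (a' , c' , eb , cb) =
        Np.<⇒≱ (Np.≤-<-trans a≤ (Np.<-≤-trans lt q≤)) (dom in-p in-q)
        where
        rest = proj₁ (take-prefix t p)
        p≡ : p ≡ a ++ E ∷ (c ++ rest)
        p≡ = trans (proj₂ (take-prefix t p)) (trans (cong (_++ rest) ea) (Lp.++-assoc a (E ∷ c) rest))
        in-p : (countE tq , countN a) ∈ eastSteps p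
        in-p = subst₂ (λ w v → (v , countN a) ∈ eastSteps w) (sym p≡) ca (split⇒∈ 0 0 a (c ++ rest))
        in-q : (countE tq , countN a') ∈ eastSteps q
        in-q = subst₂ (λ w v → (v , countN a') ∈ eastSteps w) (sym eb) cb (split⇒∈ 0 0 a' c')
        a≤ : countN a ≤ countN tp
        a≤ = subst (λ w → countN a ≤ countN w) (sym ea) (subst (countN a ≤_) (sym (countN-++ a (E ∷ c))) (Np.m≤m+n (countN a) (countN c)))
        long : t ≤ length a'
        long = Np.≮⇒≥ λ short → Np.<-irrefl refl (begin-strict
          countE tq                             ≡⟨ sym cb ⟩
          countE a'                             <⟨ Np.n<1+n _ ⟩
          suc (countE a')                       ≡⟨ sym (countE-snoc a') ⟩
          countE (a' List.∷ʳ E)                 ≤⟨ countE-prefix (a' List.∷ʳ E) c' t (subst (_≤ t) (sym (trans (Lp.length-++ a') (Np.+-comm _ 1))) short) ⟩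
          countE (take t ((a' List.∷ʳ E) ++ c')) ≡⟨ cong (λ w → countE (take t w)) (trans (Lp.++-assoc a' (E ∷ []) c') (sym eb)) ⟩
          countE tq ∎)
          where
          open Np.≤-Reasoning
          countE-snoc : ∀ a → countE (a List.∷ʳ E) ≡ suc (countE a)
          countE-snoc [] = refl
          countE-snoc (N ∷ a) = countE-snoc a
          countE-snoc (E ∷ a) = cong suc (countE-snoc a)
          countE-prefix : ∀ a c t → length a ≤ t → countE a ≤ countE (take t (a ++ c))
          countE-prefix [] c t _ = z≤n
          countE-prefix (N ∷ a) c (suc t) (s≤s le) = countE-prefix a c t le
          countE-prefix (E ∷ a) c (suc t) (s≤s le) = s≤s (countE-prefix a c t le)
        q≤ : countN tq ≤ countN a'
        q≤ = subst (λ w → countN (take t w) ≤ countN a') (sym eb)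
          (subst (λ w → countN w ≤ countN a') (sym (take-++ t a' (E ∷ c') long)) (countN-take t a'))

  -- The path with the given heights (last column first) up to height top,
  -- followed by acc.
  pathTo : Vec ℕ m → ℕ → List Step → List Step
  pathTo [] top acc = replicate top N ++ acc
  pathTo (y ∷ ys) top acc = pathTo ys y (E ∷ replicate (top ∸ y) N ++ acc)

  path : Vec ℕ m → List Step
  path {m} ys = pathTo ys m []

  columns : Vec ℕ m → List (ℕ × ℕ)
  columns [] = []
  columns {suc x} (y ∷ ys) = columns ys List.∷ʳ (x , y)

  eastFrom-climb : ∀ x y d acc → eastFrom x y (replicate d N ++ acc) ≡ eastFrom x (y + d) acc
  eastFrom-climb x y zero acc = cong (λ q → eastFrom x q acc) (sym (Np.+-identityʳ y))
  eastFrom-climb x y (suc d) acc = trans (eastFrom-climb x (suc y) d acc) (cong (λ q → eastFrom x q acc) (sym (Np.+-suc y d)))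

  eastSteps-pathTo : ∀ {m} (ys : Vec ℕ m) top acc → Decreasing (suc top) ys →
    eastSteps (pathTo ys top acc) ≡ columns ys ++ eastFrom m top acc
  eastSteps-pathTo [] top acc _ = eastFrom-climb 0 0 top acc
  eastSteps-pathTo {suc x} (y ∷ ys) top acc (s≤s y≤top ∷ d) = begin
    eastSteps (pathTo ys y (E ∷ replicate (top ∸ y) N ++ acc))
      ≡⟨ eastSteps-pathTo ys y _ d ⟩
    columns ys ++ (x , y) ∷ eastFrom (suc x) y (replicate (top ∸ y) N ++ acc)
      ≡⟨ cong (λ q → columns ys ++ (x , y) ∷ q) (trans (eastFrom-climb (suc x) y (top ∸ y) acc) (cong (λ q → eastFrom (suc x) q acc) (Np.m+[n∸m]≡n y≤top))) ⟩
    columns ys ++ (x , y) ∷ eastFrom (suc x) top acc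
      ≡⟨ sym (Lp.++-assoc (columns ys) _ _) ⟩
    columns (y ∷ ys) ++ eastFrom (suc x) top acc ∎
    where open ≡-Reasoning

  eastSteps-path : {ys : Vec ℕ m} → Decreasing (suc m) ys → eastSteps (path ys) ≡ columns ys
  eastSteps-path {m} {ys} d = trans (eastSteps-pathTo ys m [] d) (Lp.++-identityʳ _)

  countN-climb : ∀ d acc → countN (replicate d N ++ acc) ≡ d + countN acc
  countN-climb zero acc = refl
  countN-climb (suc d) acc = cong suc (countN-climb d acc)

  countE-climb : ∀ d acc → countE (replicate d N ++ acc) ≡ countE acc
  countE-climb zero acc = refl
  countE-climb (suc d) acc = countE-climb d acc

  countN-pathTo : (ys : Vec ℕ m) → ∀ top acc → Decreasing (suc top) ys → countN (pathTo ys top acc) ≡ top + countN acc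
  countN-pathTo [] top acc _ = countN-climb top acc
  countN-pathTo (y ∷ ys) top acc (s≤s y≤top ∷ d) = trans (countN-pathTo ys y _ d)
    (trans (cong (y +_) (countN-climb (top ∸ y) acc)) (trans (sym (Np.+-assoc y _ _)) (cong (_+ countN acc) (Np.m+[n∸m]≡n y≤top))))

  countE-pathTo : (ys : Vec ℕ m) → ∀ top acc → countE (pathTo ys top acc) ≡ m + countE acc
  countE-pathTo [] top acc = countE-climb top acc
  countE-pathTo {suc x} (y ∷ ys) top acc = trans (countE-pathTo ys y _) (trans (Np.+-suc x _) (cong (λ q → suc (x + q)) (countE-climb (top ∸ y) acc)))

  path-valid : {ys : Vec ℕ m} → Decreasing (suc m) ys → ValidPath m (path ys)
  path-valid {m} {ys} d = trans (sym (count-length (path ys)))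
      (cong₂ _+_ (trans (countE-pathTo ys m []) (Np.+-identityʳ m)) n≡) , n≡
    where
    n≡ : countN (path ys) ≡ m
    n≡ = trans (countN-pathTo ys m [] d) (Np.+-identityʳ m)

  climb-snoc : ∀ d acc → replicate d N ++ N ∷ acc ≡ replicate (suc d) N ++ acc
  climb-snoc zero acc = refl
  climb-snoc (suc d) acc = cong (N ∷_) (climb-snoc d acc)

  pathTo-N : (ys : Vec ℕ m) → ∀ top acc → Decreasing (suc top) ys → pathTo ys top (N ∷ acc) ≡ pathTo ys (suc top) acc
  pathTo-N [] top acc _ = climb-snoc top acc
  pathTo-N (y ∷ ys) top acc (s≤s y≤top ∷ _) = cong (λ q → pathTo ys y (E ∷ q))
    (trans (climb-snoc (top ∸ y) acc) (cong (λ d → replicate d N ++ acc) (sym (Np.+-∸-assoc 1 y≤top))))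

  -- The state of a left-to-right reading: `ys` holds the finished columns, `top` the current
  -- height, `p` the steps still to be read.
  heights-from : ∀ p {x} (ys : Vec ℕ x) top → Decreasing (suc top) ys →
    Σ (Vec ℕ (countE p + x)) λ zs → Decreasing (suc (countN p + top)) zs × pathTo zs (countN p + top) [] ≡ pathTo ys top p
  heights-from [] ys top d = ys , d , refl
  heights-from (N ∷ p) ys top d with heights-from p ys (suc top) (decreasing-weaken (Np.n≤1+n _) d)
  ... | zs , dz , e rewrite Np.+-suc (countN p) top = zs , dz , trans e (sym (pathTo-N ys top p d))
  heights-from (E ∷ p) {x} ys top d with heights-from p (top ∷ ys) top (Np.≤-refl ∷ d)
  ... | zs , dz , e rewrite Np.+-suc (countE p) x =
    zs , dz , trans e (cong (λ q → pathTo ys top (E ∷ replicate q N ++ p)) (Np.n∸n≡0 top))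

  path-heights : ∀ {m} p → ValidPath m p → Σ (Vec ℕ m) λ ys → Decreasing (suc m) ys × path ys ≡ p
  path-heights {m} p (l , n) with heights-from p [] 0 []
  ... | zs , d , e = go e₁ e₂ zs d e
    where
    e₁ : countE p + 0 ≡ m
    e₁ = trans (Np.+-identityʳ _) (Np.+-cancelʳ-≡ m _ _ (trans (cong (countE p +_) (sym n)) (trans (count-length p) l)))
    e₂ : countN p + 0 ≡ m
    e₂ = trans (Np.+-identityʳ _) n
    go : ∀ {x y} → x ≡ m → y ≡ m → (zs : Vec ℕ x) → Decreasing (suc y) zs → pathTo zs y [] ≡ p →
      Σ (Vec ℕ m) λ ys → Decreasing (suc m) ys × path ys ≡ p
    go refl refl zs d e = zs , d , e

  replicate-snoc : ∀ d (acc : List Step) → replicate d E ++ E ∷ acc ≡ E ∷ replicate d E ++ acc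
  replicate-snoc zero acc = refl
  replicate-snoc (suc d) acc = cong (E ∷_) (replicate-snoc d acc)

  Tpath-heights : ∀ m → Tpath m ≡ path (top m m)
  Tpath-heights m = sym (trans (go m []) (cong (replicate m N ++_) (Lp.++-identityʳ _)))
    where
    go : ∀ x acc → pathTo (top x m) m acc ≡ replicate m N ++ replicate x E ++ acc
    go zero acc = refl
    go (suc x) acc rewrite Np.n∸n≡0 m = trans (go x (E ∷ acc)) (cong (replicate m N ++_) (replicate-snoc x acc))

  Bpath-heights : ∀ m → Bpath m ≡ path (ground m)
  Bpath-heights m = sym (trans (go m []) (Lp.++-identityʳ _))
    where
    snoc : ∀ x acc → Bpath x ++ E ∷ N ∷ acc ≡ E ∷ N ∷ Bpath x ++ acc
    snoc zero acc = refl
    snoc (suc x) acc = cong (λ q → E ∷ N ∷ q) (snoc x acc)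
    go : ∀ x acc → pathTo (ground x) x acc ≡ Bpath x ++ acc
    go zero acc = refl
    go (suc x) acc rewrite Np.+-∸-assoc 1 (Np.≤-refl {x}) | Np.n∸n≡0 x = trans (go x (E ∷ N ∷ acc)) (snoc x acc)

  ∈-columns-bound : (ys : Vec ℕ m) → ∀ {i y} → (i , y) ∈ columns ys → i < m
  ∈-columns-bound {suc x} (y ∷ ys) p with ∈-++⁻ (columns ys) p
  ... | inj₁ q = Np.m<n⇒m<1+n (∈-columns-bound ys q)
  ... | inj₂ (here refl) = Np.≤-refl

  columns-head : ∀ {x y z} (ys : Vec ℕ x) → (x , z) ∈ columns (y ∷ ys) → z ≡ y
  columns-head ys p with ∈-++⁻ (columns ys) p
  ... | inj₁ q = ⊥-elim (Np.<-irrefl refl (∈-columns-bound ys q))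
  ... | inj₂ (here refl) = refl

  columns-tail : ∀ {x y i z} (ys : Vec ℕ x) → i < x → (i , z) ∈ columns (y ∷ ys) → (i , z) ∈ columns ys
  columns-tail ys lt p with ∈-++⁻ (columns ys) p
  ... | inj₁ q = q
  ... | inj₂ (here refl) = ⊥-elim (Np.<-irrefl refl lt)

  ∈-columns-head : ∀ {x y} (ys : Vec ℕ x) → (x , y) ∈ columns (y ∷ ys)
  ∈-columns-head ys = ∈-++⁺ʳ (columns ys) (here refl)

  columns-injective : (ys zs : Vec ℕ m) → columns ys ≡ columns zs → ys ≡ zs
  columns-injective [] [] _ = refl
  columns-injective (y ∷ ys) (z ∷ zs) e with Lp.∷ʳ-injective (columns ys) (columns zs) e
  ... | e₁ , refl = cong (y ∷_) (columns-injective ys zs e₁)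

  path-injective : {ys zs : Vec ℕ m} → Decreasing (suc m) ys → Decreasing (suc m) zs → path ys ≡ path zs → ys ≡ zs
  path-injective {ys = ys} {zs} dy dz e = columns-injective ys zs (trans (sym (eastSteps-path dy)) (trans (cong eastSteps e) (eastSteps-path dz)))

-- Chains of height vectors and the parameters of a path family.

module PathChains where
  open import Defs hiding (take)
  open Sums
  open PathTransfer using (when; when-yes; when-no)
  open Coefficients
  open LatticePaths
  open import Data.Bool using (_∨_)
  open import Data.Bool.ListAction using (any)
  open import Data.Fin using (Fin; zero; suc)
  open import Data.Product.Properties using (≡-dec)
  open import Data.List.Membership.Propositional using (_∈_)
  open import Data.List.Membership.Propositional.Properties using (∈-++⁺ˡ; ∈-map⁻; ∈-cartesianProductWith⁺; ∈-cartesianProductWith⁻)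
  open import Data.List.Membership.DecPropositional (≡-dec _≟_ _≟_) using (_∈?_)
  open import Data.List.Relation.Unary.Any using (here; there)
  open import Data.List.Relation.Unary.All as All using (All; []; _∷_)
  open import Data.List.Relation.Unary.AllPairs using ([]; _∷_)
  open import Data.List.Relation.Unary.Unique.Propositional using (Unique)
  open import Data.Vec.Relation.Binary.Pointwise.Inductive as Pw using (Pointwise; []; _∷_)
  open import Data.Vec.Relation.Unary.All as VAll using ([]; _∷_)
  open import Relation.Nullary.Decidable using (dec-true; dec-false; _×-dec_)

  variable
    k : ℕ

  _⊑_ : Vec ℕ m → Vec ℕ m → Set
  _⊑_ = Pointwise _≤_

  ⊑-trans : {a b c : Vec ℕ m} → a ⊑ b → b ⊑ c → a ⊑ c
  ⊑-trans = Pw.trans Np.≤-trans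

  ⊑-refl : {a : Vec ℕ m} → a ⊑ a
  ⊑-refl = Pw.refl Np.≤-refl

  ⊑-top : ∀ {x t} {y : Vec ℕ x} → Decreasing (suc t) y → y ⊑ top x t
  ⊑-top [] = []
  ⊑-top (s≤s p ∷ d) = p ∷ ⊑-top (decreasing-weaken (s≤s p) d)

  ⊑⇒columns : {a b : Vec ℕ m} → a ⊑ b → ∀ {x y z} → (x , y) ∈ columns b → (x , z) ∈ columns a → z ≤ y
  ⊑⇒columns {suc l} {a ∷ as} {b ∷ bs} (p ∷ ps) {x} p∈ q∈ with x ≟ l
  ... | yes refl rewrite columns-head bs p∈ | columns-head as q∈ = p
  ... | no x≢ = ⊑⇒columns ps (columns-tail bs lt p∈) (columns-tail as lt q∈)
    where lt = Np.≤∧≢⇒< (Np.≤-pred (∈-columns-bound (b ∷ bs) p∈)) x≢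

  columns⇒⊑ : (a b : Vec ℕ m) → (∀ {x y z} → (x , y) ∈ columns b → (x , z) ∈ columns a → z ≤ y) → a ⊑ b
  columns⇒⊑ [] [] _ = []
  columns⇒⊑ (a ∷ as) (b ∷ bs) f = f (∈-columns-head bs) (∈-columns-head as)
    ∷ columns⇒⊑ as bs (λ p q → f (∈-++⁺ˡ p) (∈-++⁺ˡ q))

  module _ {a b : Vec ℕ m} (da : Decreasing (suc m) a) (db : Decreasing (suc m) b) where
    above⇒⊑ : WeaklyAbove (path b) (path a) → a ⊑ b
    above⇒⊑ ab = columns⇒⊑ a b λ p q → above⇒dominates (path b) (path a) ab
      (subst (_ ∈_) (sym (eastSteps-path db)) p) (subst (_ ∈_) (sym (eastSteps-path da)) q)

    ⊑⇒above : a ⊑ b → WeaklyAbove (path b) (path a)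
    ⊑⇒above le = dominates⇒above _ (path b) (path a) (path-valid db) (path-valid da)
      λ p q → ⊑⇒columns le (subst (_ ∈_) (eastSteps-path db) p) (subst (_ ∈_) (eastSteps-path da) q)

  -- Ends at B, so a chain starting from T contains both boundary conditions as well as the nesting
  -- of the paths.
  Chain : Vec ℕ m → Vec (Vec ℕ m) k → Set
  Chain {m} τ [] = ground m ⊑ τ
  Chain τ (y ∷ ys) = y ⊑ τ × Chain y ys

  chain? : (τ : Vec ℕ m) (ys : Vec (Vec ℕ m) k) → Dec (Chain τ ys)
  chain? {m} τ [] = Pw.decidable _≤?_ (ground m) τ
  chain? τ (y ∷ ys) = Pw.decidable _≤?_ y τ ×-dec chain? y ys

  chain-ground : {τ : Vec ℕ m} (ys : Vec (Vec ℕ m) k) → Chain τ ys → ground m ⊑ τ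
  chain-ground [] c = c
  chain-ground (y ∷ ys) (p , c) = ⊑-trans (chain-ground ys c) p

  tuples : ∀ m k → List (Vec (Vec ℕ m) k)
  tuples m zero = [] ∷ []
  tuples m (suc k) = cartesianProductWith _∷_ (decreasings m (suc m)) (tuples m k)

  ∈-tuples⁻ : ∀ m k {ys : Vec (Vec ℕ m) k} → ys ∈ tuples m k → VAll.All (Decreasing (suc m)) ys
  ∈-tuples⁻ m zero {[]} _ = []
  ∈-tuples⁻ m (suc k) ys∈ with ∈-cartesianProductWith⁻ _∷_ (decreasings m (suc m)) (tuples m k) ys∈
  ... | y , ys , p , q , refl = ∈-decreasings⁻ m (suc m) p ∷ ∈-tuples⁻ m k q

  ∈-tuples⁺ : ∀ {m k} {ys : Vec (Vec ℕ m) k} → VAll.All (Decreasing (suc m)) ys → ys ∈ tuples m k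
  ∈-tuples⁺ [] = here refl
  ∈-tuples⁺ (d ∷ ds) = ∈-cartesianProductWith⁺ _∷_ (∈-decreasings⁺ d) (∈-tuples⁺ ds)

  unique-decreasings : ∀ m Y → Unique (decreasings m Y)
  unique-decreasings zero Y = [] ∷ []
  unique-decreasings (suc m) zero = []
  unique-decreasings (suc m) (suc z) = Uq.++⁺ (unique-decreasings (suc m) z)
    (Uq.map⁺ Vp.∷-injectiveʳ (unique-decreasings m (suc z))) disjoint
    where
    disjoint : ∀ {y} → y ∈ decreasings (suc m) z × y ∈ List.map (z ∷_) (decreasings m (suc z)) → ⊥
    disjoint (p , q) with ∈-map⁻ (z ∷_) q
    ... | _ , _ , refl with ∈-decreasings⁻ (suc m) z p
    ... | z<z ∷ _ = Np.<-irrefl refl z<z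

  unique-tuples : ∀ m k → Unique (tuples m k)
  unique-tuples m zero = [] ∷ []
  unique-tuples m (suc k) = Uq.cartesianProductWith⁺ _∷_ Vp.∷-injective (unique-decreasings m (suc m)) (unique-tuples m k)

  unique-map : {f : A → B} (xs : List A) → (∀ {a b} → a ∈ xs → b ∈ xs → f a ≡ f b → a ≡ b) → Unique xs → Unique (List.map f xs)
  unique-map [] inj _ = []
  unique-map (x ∷ xs) inj (p ∷ u) = Allₚ.map⁺ (All.tabulate λ b∈ e → All.lookup p b∈ (inj (here refl) (there b∈) e))
    ∷ unique-map xs (λ p q → inj (there p) (there q)) u

  ind : Bool → ℕ
  ind true = 1
  ind false = 0

  ind≤1 : ∀ b → ind b ≤ 1
  ind≤1 true = s≤s z≤n
  ind≤1 false = z≤n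

  coincidences : Vec ℕ m → Vec ℕ m → ℕ
  coincidences [] [] = 0
  coincidences (t ∷ τ) (z ∷ y) = when (z ≟ t) 1 + coincidences τ y

  length-filterᵇ-snoc : (p : A → Bool) (xs : List A) (x : A) →
    List.length (List.filterᵇ p (xs List.∷ʳ x)) ≡ ind (p x) + List.length (List.filterᵇ p xs)
  length-filterᵇ-snoc p [] x with p x
  ... | true = refl
  ... | false = refl
  length-filterᵇ-snoc p (y ∷ xs) x with p y
  ... | true = trans (cong suc (length-filterᵇ-snoc p xs x)) (sym (Np.+-suc _ _))
  ... | false = length-filterᵇ-snoc p xs x

  ind-does : {P Q : Set} (p : Dec P) (q : Dec Q) → (P → Q) → (Q → P) → ind (does p) ≡ when q 1
  ind-does (yes p) q f g = sym (when-yes q (f p))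
  ind-does (no p) q f g = sym (when-no q (p ∘ g))

  -- The edge list `L` stays complete while the induction removes columns; it has to agree with `y`
  -- only in the columns that remain.
  common-columns : (L : List (ℕ × ℕ)) (τ y : Vec ℕ m) →
    (∀ {i z} → i < m → (i , z) ∈ L → (i , z) ∈ columns y) → (∀ {i z} → i < m → (i , z) ∈ columns y → (i , z) ∈ L) →
    List.length (List.filterᵇ (λ e → does (e ∈? L)) (columns τ)) ≡ coincidences τ y
  common-columns L [] [] _ _ = refl
  common-columns {suc x} L (t ∷ τ) (z ∷ y) to from = trans (length-filterᵇ-snoc (λ e → does (e ∈? L)) (columns τ) (x , t)) (cong₂ _+_
    (ind-does ((x , t) ∈? L) (z ≟ t) (λ p → sym (columns-head y (to Np.≤-refl p)))
      (λ { refl → from Np.≤-refl (∈-columns-head y) }))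
    (common-columns L τ y (λ lt p → columns-tail y lt (to (Np.m<n⇒m<1+n lt) p))
      (λ lt p → from (Np.m<n⇒m<1+n lt) (∈-++⁺ˡ p))))

  common-path : {τ y : Vec ℕ m} → Decreasing (suc m) τ → Decreasing (suc m) y → common (path τ) (path y) ≡ coincidences τ y
  common-path {τ = τ} {y} dτ dy rewrite eastSteps-path dτ | eastSteps-path dy =
    common-columns (columns y) τ y (λ _ p → p) (λ _ p → p)

  coincidenceList : Vec ℕ m → Vec (Vec ℕ m) k → List ℕ
  coincidenceList {m} τ [] = coincidences τ (ground m) ∷ []
  coincidenceList τ (y ∷ ys) = coincidences τ y ∷ coincidenceList y ys

  common-list : {τ : Vec ℕ m} (ys : Vec (Vec ℕ m) k) → Decreasing (suc m) τ → VAll.All (Decreasing (suc m)) ys →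
    List.zipWith common (path τ ∷ Vec.toList (Vec.map path ys) ++ path (ground m) ∷ []) (Vec.toList (Vec.map path ys) ++ path (ground m) ∷ [])
    ≡ coincidenceList τ ys
  common-list [] dτ [] = cong (_∷ []) (common-path dτ (decreasing-weaken (Np.n≤1+n _) (ground-decreasing _)))
  common-list (y ∷ ys) dτ (dy ∷ ds) = cong₂ _∷_ (common-path dτ dy) (common-list ys dy ds)

  choose : Dec A → B → B → B
  choose (yes _) b c = b
  choose (no _) b c = c

  choose-yes : (d : Dec A) {b c : B} → A → choose d b c ≡ b
  choose-yes (yes _) _ = refl
  choose-yes (no n) a = ⊥-elim (n a)

  choose-no : (d : Dec A) {b c : B} → ¬ A → choose d b c ≡ c
  choose-no (yes a) n = ⊥-elim (n a)
  choose-no (no _) _ = refl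

  does-choose : {P Q : Set} (p : Dec P) (q : Dec Q) → (P → Q) → (Q → P) → does p ≡ choose q true false
  does-choose (yes p) q f g = sym (choose-yes q (f p))
  does-choose (no p) q f g = sym (choose-no q (p ∘ g))

  does-iff : {P Q : Set} (p : Dec P) (q : Dec Q) → (P → Q) → (Q → P) → does p ≡ does q
  does-iff (yes p) q f g = sym (dec-true q (f p))
  does-iff (no p) q f g = sym (dec-false q (p ∘ g))

  at : Vec ℕ m → ℕ → ℕ → Bool
  at [] x h = false
  at {suc l} (z ∷ y) x h = choose (x ≟ l) (choose (z ≟ h) true false) (at y x h)

  at-head : ∀ {l} z (y : Vec ℕ l) h → at (z ∷ y) l h ≡ choose (z ≟ h) true false
  at-head {l} z y h = choose-yes (l ≟ l) refl

  at-tail : ∀ {l} z (y : Vec ℕ l) {x} h → x ≢ l → at (z ∷ y) x h ≡ at y x h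
  at-tail {l} z y {x} h ne = choose-no (x ≟ l) ne

  at-uses : (y : Vec ℕ m) → ∀ x h → does ((x , h) ∈? columns y) ≡ at y x h
  at-uses [] x h = refl
  at-uses {suc l} (z ∷ y) x h = by-cases (x ≟ l)
    where
    by-cases : Dec (x ≡ l) → does ((x , h) ∈? columns (z ∷ y)) ≡ at (z ∷ y) x h
    by-cases (yes refl) = trans (does-choose ((x , h) ∈? columns (z ∷ y)) (z ≟ h)
      (λ p → sym (columns-head y p)) (λ { refl → ∈-columns-head y })) (sym (at-head z y h))
    by-cases (no x≢l) = trans (does-iff ((x , h) ∈? columns (z ∷ y)) ((x , h) ∈? columns y)
        (λ p → columns-tail y (Np.≤∧≢⇒< (Np.≤-pred (∈-columns-bound (z ∷ y) p)) x≢l) p) ∈-++⁺ˡ)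
      (trans (at-uses y x h) (sym (at-tail z y h x≢l)))

  hit : Vec (Vec ℕ m) k → ℕ → ℕ → Bool
  hit [] x h = false
  hit (y ∷ ys) x h = at y x h ∨ hit ys x h

  any-uses : (ys : Vec (Vec ℕ m) k) → VAll.All (Decreasing (suc m)) ys → ∀ x h →
    any (λ P → uses P (x , h)) (Vec.toList (Vec.map path ys)) ≡ hit ys x h
  any-uses [] [] x h = refl
  any-uses (y ∷ ys) (d ∷ ds) x h rewrite eastSteps-path d = cong₂ _∨_ (at-uses y x h) (any-uses ys ds x h)

  at-⊑ : {a b : Vec ℕ m} → a ⊑ b → ∀ x h → at b x h ≡ true → at a x h ≡ false → ∀ {c : Vec ℕ m} → c ⊑ a → at c x h ≡ false
  at-⊑ {suc l} {a ∷ as} {b ∷ bs} (p ∷ ps) x h eb ea {c ∷ cs} (q ∷ qs) with x ≟ l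
  ... | no _ = at-⊑ ps x h eb ea qs
  ... | yes _ with b ≟ h | a ≟ h
  ...   | yes refl | no a≢h = choose-no (c ≟ b) λ { refl → a≢h (Np.≤-antisym p q) }

  hit-⊑ : {a b : Vec ℕ m} → a ⊑ b → ∀ x h → at b x h ≡ true → at a x h ≡ false → (ys : Vec (Vec ℕ m) k) → Chain a ys → hit ys x h ≡ false
  hit-⊑ le x h eb ea [] _ = refl
  hit-⊑ le x h eb ea (y ∷ ys) (p , c) rewrite at-⊑ le x h eb ea p = hit-⊑ (⊑-trans p le) x h eb (at-⊑ le x h eb ea p) ys c

-- The predicted degrees as exponents of the path weights.

module PathTuples where
  open import Defs hiding (take; N; E)
  open Sums
  open PathTransfer using (when; when-yes; when-no; product; module PathOperators)
  open Comparison using (when-zero)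
  open Coefficients
  open LatticePaths
  open PathChains
  open import Data.Bool using (_∨_)
  open import Data.Bool.ListAction using (any)
  open import Data.Fin using (Fin; zero; suc; toℕ)
  open import Data.List.Membership.Propositional using (_∈_)
  open import Data.List.Membership.Propositional.Properties using (∈-downFrom⁻; ∈-filter⁺; ∈-filter⁻; ∈-map⁺; ∈-map⁻)
  open import Data.List.Relation.Unary.All as All using (All; []; _∷_)
  open import Data.List.Relation.Unary.Unique.Propositional using (Unique)
  open import Data.Vec.Relation.Binary.Pointwise.Inductive as Pw using (Pointwise; []; _∷_)
  open import Data.Vec.Relation.Unary.All as VAll using ([]; _∷_)

  monomial-cong : ∀ x {N} {f g : Fin N → ℕ} → (∀ j → f j ≡ g j) → monomial x (Vec.tabulate f) ≡ monomial x (Vec.tabulate g)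
  monomial-cong x e = cong (monomial x) (Vp.tabulate-cong e)

  monomial-unit : ∀ x {N} v (f g : ℕ → ℕ) → v < N → (∀ j → f j ≡ when (v ≟ j) 1 + g j) →
    monomial x (Vec.tabulate {n = N} (f ∘ toℕ)) ≡ x v * monomial x (Vec.tabulate {n = N} (g ∘ toℕ))
  monomial-unit x {suc N} zero f g _ e = trans
    (cong₂ (λ p q → x 0 ^ p * q) (e 0) (monomial-cong (x ∘ suc) {N} (λ j → e (suc (toℕ j)))))
    (Np.*-assoc (x 0) _ _)
  monomial-unit x {suc N} (suc v) f g (s≤s lt) e = trans
    (cong₂ (λ p q → x 0 ^ p * q) (e 0) (monomial-unit (x ∘ suc) v (f ∘ suc) (g ∘ suc) lt
      (λ j → trans (e (suc j)) (cong (_+ g (suc j)) (shift j)))))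
    (lem (x 0 ^ g 0) (x (suc v)) _)
    where
    shift : ∀ j → when (suc v ≟ suc j) 1 ≡ when (v ≟ j) 1
    shift j with v ≟ j
    ... | yes refl = when-yes (suc v ≟ suc v) refl
    ... | no ne = when-no (suc v ≟ suc j) (ne ∘ Np.suc-injective)
    lem : ∀ a b c → a * (b * c) ≡ b * (a * c)
    lem = solve-∀

  monomial-zero : ∀ x N → monomial x (Vec.tabulate {n = N} (λ _ → 0)) ≡ 1
  monomial-zero x zero = refl
  monomial-zero x (suc N) = trans (Np.+-identityʳ _) (monomial-zero (x ∘ suc) N)

  monomial-occurrences : ∀ x {N} vs → All (_< N) vs →
    product (List.map x vs) ≡ monomial x (Vec.tabulate {n = N} (λ j → occurrences (toℕ j) vs))
  monomial-occurrences x {N} [] [] = sym (monomial-zero x N)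
  monomial-occurrences x {N} (v ∷ vs) (lt ∷ a) = trans (cong (x v *_) (monomial-occurrences x vs a))
    (sym (monomial-unit x v (λ j → occurrences j (v ∷ vs)) (λ j → occurrences j vs) lt (λ _ → refl)))

  product-map-++ : ∀ (x : ℕ → ℕ) vs ws → product (List.map x (vs ++ ws)) ≡ product (List.map x vs) * product (List.map x ws)
  product-map-++ x [] ws = sym (Np.+-identityʳ _)
  product-map-++ x (v ∷ vs) ws = trans (cong (x v *_) (product-map-++ x vs ws)) (sym (Np.*-assoc (x v) _ _))

  <ᵇ-irrefl : ∀ h → (h <ᵇ h) ≡ false
  <ᵇ-irrefl zero = refl
  <ᵇ-irrefl (suc h) = <ᵇ-irrefl h

  <⇒<ᵇ≡true : ∀ {a b} → a < b → (a <ᵇ b) ≡ true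
  <⇒<ᵇ≡true {zero} {suc b} _ = refl
  <⇒<ᵇ≡true {suc a} {suc b} (s≤s p) = <⇒<ᵇ≡true p

  ≥⇒<ᵇ≡false : ∀ {a b} → b ≤ a → (a <ᵇ b) ≡ false
  ≥⇒<ᵇ≡false {a} {zero} _ = refl
  ≥⇒<ᵇ≡false {suc a} {suc b} (s≤s p) = ≥⇒<ᵇ≡false p

  ∑-upTo : ∀ n f → ∑ (List.upTo n) f ≡ ∑ (List.downFrom n) f
  ∑-upTo zero f = refl
  ∑-upTo (suc n) f = trans (cong (λ L → ∑ L f) (sym (Lp.upTo-∷ʳ n)))
    (trans (∑-++ (List.upTo n) (n ∷ []) f) (trans (cong₂ _+_ (∑-upTo n f) (Np.+-identityʳ (f n))) (Np.+-comm _ (f n))))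

  ∑-below : ∀ {h} M (q : ℕ → Bool) → h ≤ M → ∑ (List.downFrom M) (λ c → ind (q c ∧ (c <ᵇ h))) ≡ ∑ (List.downFrom h) (ind ∘ q)
  ∑-below {h} M q le with h ≟ M
  ... | yes refl = ∑-cong∈ (List.downFrom h) λ c c∈ → cong ind (trans (cong (q c ∧_) (<⇒<ᵇ≡true (∈-downFrom⁻ c∈))) (∧-true (q c)))
    where
    ∧-true : ∀ b → (b ∧ true) ≡ b
    ∧-true true = refl
    ∧-true false = refl
  ∑-below {zero} zero q le | no ne = ⊥-elim (ne refl)
  ∑-below {h} (suc M) q le | no ne = trans
    (cong (_+ ∑ (List.downFrom M) (λ c → ind (q c ∧ (c <ᵇ h)))) (cong ind (trans (cong (q M ∧_) (≥⇒<ᵇ≡false h≤M)) (Bp.∧-zeroʳ (q M)))))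
    (∑-below M q h≤M)
    where
    h≤M : h ≤ M
    h≤M = Np.≤-pred (Np.≤∧≢⇒< le ne)

  filterᵇ-complement : (q : A → Bool) (xs : List A) → List.length (List.filterᵇ (not ∘ q) xs) + ∑ xs (ind ∘ q) ≡ List.length xs
  filterᵇ-complement q [] = refl
  filterᵇ-complement q (x ∷ xs) with q x
  ... | true = trans (Np.+-suc _ _) (cong suc (filterᵇ-complement q xs))
  ... | false = cong suc (filterᵇ-complement q xs)

  filterᵇ-cong : {p q : A → Bool} → (∀ x → p x ≡ q x) → (xs : List A) → List.length (List.filterᵇ p xs) ≡ List.length (List.filterᵇ q xs)
  filterᵇ-cong e [] = refl
  filterᵇ-cong {p = p} {q} e (x ∷ xs) with p x | q x | e x
  ... | true | .true | refl = cong suc (filterᵇ-cong e xs)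
  ... | false | .false | refl = filterᵇ-cong e xs

  at-top : ∀ l {t h} c → t ≢ h → at (top l t) c h ≡ false
  at-top zero c ne = refl
  at-top (suc l) {t} {h} c ne with c ≟ l
  ... | yes _ = choose-no (t ≟ h) ne
  ... | no _ = at-top l c ne

  at-ground : ∀ l c h → (at (ground l) c h ∧ (c <ᵇ h)) ≡ false
  at-ground zero c h = refl
  at-ground (suc l) c h with c ≟ l
  ... | no _ = at-ground l c h
  ... | yes refl with c ≟ h
  ...   | no _ = refl
  ...   | yes refl = <ᵇ-irrefl c

  -- A chain of paths, read as the list of the variables it contributes: the
  -- contact variable i for a common east step of paths i and i + 1, and the
  -- variable k + m ∸ z for an interior edge at height z used first by path
  -- i + 1.
  module Exponents (k m : ℕ) where
    K : ℕ
    K = k + m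

    cell : ℕ → ℕ → ℕ → ℕ → List ℕ
    cell i l t z = choose (z ≟ t) (i ∷ []) (choose (z ≟ l) [] (K ∸ z ∷ []))

    step : ∀ {l} → ℕ → Vec ℕ l → Vec ℕ l → List ℕ
    step i [] [] = []
    step {suc l} i (t ∷ τ) (z ∷ y) = cell i l t z ++ step i τ y

    variables : ∀ {k'} → ℕ → Vec ℕ m → Vec (Vec ℕ m) k' → List ℕ
    variables i τ [] = step i τ (ground m)
    variables i τ (y ∷ ys) = step i τ y ++ variables (suc i) y ys

    K∸z>k : ∀ {z} → z < m → k < K ∸ z
    K∸z>k {z} lt = subst (k <_) (sym (Np.+-∸-assoc k (Np.<⇒≤ lt))) (Np.m<m+n k (Np.m<n⇒0<n∸m lt))

    cell-occurrences : ∀ i l {t z j} → z ≤ t → t ≤ m → j ≤ k → occurrences j (cell i l t z) ≡ when (i ≟ j) (when (z ≟ t) 1)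
    cell-occurrences i l {t} {z} {j} z≤t t≤m j≤k with z ≟ t
    ... | yes _ = Np.+-identityʳ _
    ... | no z≢t with z ≟ l
    ...   | yes _ = when-zero (i ≟ j)
    ...   | no _ = trans (cong (_+ 0) (when-no (K ∸ z ≟ j) (λ { refl → Np.<⇒≱ (K∸z>k (Np.<-≤-trans (Np.≤∧≢⇒< z≤t z≢t) t≤m)) j≤k }))) (when-zero (i ≟ j))

    step-occurrences : ∀ {l} i {τ y : Vec ℕ l} {j} → y ⊑ τ → τ ⊑ top l m → j ≤ k → occurrences j (step i τ y) ≡ when (i ≟ j) (coincidences τ y)
    step-occurrences i {[]} {[]} {j} [] [] _ with i ≟ j
    ... | yes _ = refl
    ... | no _ = refl
    step-occurrences {suc l} i {t ∷ τ} {z ∷ y} {j} (p ∷ ps) (q ∷ qs) j≤k = trans (∑-++ (cell i l t z) (step i τ y) _)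
      (trans (cong₂ _+_ (cell-occurrences i l p q j≤k) (step-occurrences i ps qs j≤k)) (when-+ (i ≟ j)))
      where
      when-+ : (d : Dec A) {a b : ℕ} → when d a + when d b ≡ when d (a + b)
      when-+ (yes _) = refl
      when-+ (no _) = refl

    variables-absent : ∀ {k'} i τ (ys : Vec (Vec ℕ m) k') {j} → Chain τ ys → τ ⊑ top m m → j ≤ k → j < i → occurrences j (variables i τ ys) ≡ 0
    variables-absent i τ [] {j} c q j≤k j<i = trans (step-occurrences i c q j≤k) (when-no (i ≟ j) (λ e → Np.<⇒≢ j<i (sym e)))
    variables-absent i τ (y ∷ ys) {j} (p , c) q j≤k j<i = trans (∑-++ (step i τ y) _ _) (cong₂ _+_
      (trans (step-occurrences i p q j≤k) (when-no (i ≟ j) (λ e → Np.<⇒≢ j<i (sym e))))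
      (variables-absent (suc i) y ys c (⊑-trans p q) j≤k (Np.m<n⇒m<1+n j<i)))

    contact-occurrences : ∀ {k'} i τ (ys : Vec (Vec ℕ m) k') d → Chain τ ys → τ ⊑ top m m → i + d ≤ k →
      occurrences (i + d) (variables i τ ys) ≡ nth (coincidenceList τ ys) d
    contact-occurrences i τ [] zero c q le rewrite Np.+-identityʳ i = trans (step-occurrences i c q le) (when-yes (i ≟ i) refl)
    contact-occurrences i τ [] (suc d) c q le = trans (step-occurrences i c q le) (when-no (i ≟ i + suc d) (Np.m≢1+m+n i ∘ λ e → trans e (Np.+-suc i d)))
    contact-occurrences i τ (y ∷ ys) zero (p , c) q le rewrite Np.+-identityʳ i = trans (∑-++ (step i τ y) _ _) (trans (cong₂ _+_
      (trans (step-occurrences i p q le) (when-yes (i ≟ i) refl)) (variables-absent (suc i) y ys c (⊑-trans p q) le Np.≤-refl)) (Np.+-identityʳ _))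
    contact-occurrences i τ (y ∷ ys) (suc d) (p , c) q le = trans (∑-++ (step i τ y) _ _) (cong₂ _+_
      (trans (step-occurrences i p q le) (when-no (i ≟ i + suc d) (Np.m≢1+m+n i ∘ λ e → trans e (Np.+-suc i d))))
      (trans (cong (λ v → occurrences v (variables (suc i) y ys)) (Np.+-suc i d))
        (contact-occurrences (suc i) y ys d c (⊑-trans p q) (subst (_≤ k) (Np.+-suc i d) le))))

    module _ {h : ℕ} (h<m : h < m) where
      private
        v : ℕ
        v = K ∸ h

      -- A contact contributes the variable `i ≤ k`, which differs from `v > k`. The test `l <ᵇ h`
      -- discards the edge on B.
      cell-hit : ∀ i l t z → i ≤ k → l ≤ z → z ≤ t → t ≤ m → occurrences v (cell i l t z) ≡
        ind (not (choose (t ≟ h) true false) ∧ choose (z ≟ h) true false ∧ (l <ᵇ h))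
      cell-hit i l t z i≤k l≤z z≤t t≤m with z ≟ t
      ... | yes refl with z ≟ h
      ...   | yes _ = cong (_+ 0) (when-no (i ≟ v) (λ { refl → Np.<⇒≱ (K∸z>k h<m) i≤k }))
      ...   | no _ = cong (_+ 0) (when-no (i ≟ v) (λ { refl → Np.<⇒≱ (K∸z>k h<m) i≤k }))
      cell-hit i l t z i≤k l≤z z≤t t≤m | no z≢t with z ≟ l | z ≟ h | t ≟ h
      ... | yes _ | no _ | yes _ = refl
      ... | yes _ | no _ | no _ = refl
      ... | yes _ | yes _ | yes _ = refl
      ... | yes refl | yes refl | no _ = sym (cong ind (<ᵇ-irrefl h))
      ... | no _ | yes refl | yes refl = ⊥-elim (z≢t refl)
      ... | no z≢l | yes refl | no _ = trans (cong (_+ 0) (when-yes (K ∸ z ≟ K ∸ z) refl))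
              (sym (cong ind (<⇒<ᵇ≡true (Np.≤∧≢⇒< l≤z (z≢l ∘ sym)))))
      ... | no _ | no z≢h | yes _ = cong (_+ 0) (when-no (K ∸ z ≟ v) (λ e → z≢h (Np.∸-cancelˡ-≡ (Np.≤-trans (Np.≤-trans z≤t t≤m) (Np.m≤n+m m k)) (Np.≤-trans (Np.<⇒≤ h<m) (Np.m≤n+m m k)) e)))
      ... | no _ | no z≢h | no _ = cong (_+ 0) (when-no (K ∸ z ≟ v) (λ e → z≢h (Np.∸-cancelˡ-≡ (Np.≤-trans (Np.≤-trans z≤t t≤m) (Np.m≤n+m m k)) (Np.≤-trans (Np.<⇒≤ h<m) (Np.m≤n+m m k)) e)))

      step-hit : ∀ {l} i {τ y : Vec ℕ l} → i ≤ k → ground l ⊑ y → y ⊑ τ → τ ⊑ top l m → occurrences v (step i τ y) ≡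
        ∑ (List.downFrom l) (λ c → ind (not (at τ c h) ∧ at y c h ∧ (c <ᵇ h)))
      step-hit i {[]} {[]} _ _ _ _ = refl
      step-hit {suc l} i {t ∷ τ} {z ∷ y} i≤k (g ∷ gs) (p ∷ ps) (q ∷ qs) = trans (∑-++ (cell i l t z) (step i τ y) _) (cong₂ _+_
        (trans (cell-hit i l t z i≤k g p q) (cong₂ (λ a b → ind (not a ∧ b ∧ (l <ᵇ h))) (sym (at-head t τ h)) (sym (at-head z y h))))
        (trans (step-hit i i≤k gs ps qs) (∑-cong∈ (List.downFrom l) λ c c∈ →
          cong₂ (λ a b → ind (not a ∧ b ∧ (c <ᵇ h))) (sym (at-tail t τ h (Np.<⇒≢ (∈-downFrom⁻ c∈)))) (sym (at-tail z y h (Np.<⇒≢ (∈-downFrom⁻ c∈)))))))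

      -- An edge is charged by the first path through it, so adding up the steps of the chain counts
      -- each edge that is used at all; those of `τ` were charged before. Adding the two parts
      -- relies on `hit-⊑`.
      variables-hit : ∀ {k'} i τ (ys : Vec (Vec ℕ m) k') → i + k' ≤ k → Chain τ ys → τ ⊑ top m m → occurrences v (variables i τ ys) ≡
        ∑ (List.downFrom m) (λ c → ind (not (at τ c h) ∧ hit ys c h ∧ (c <ᵇ h)))
      variables-hit i τ [] le ch q = trans (step-hit i (Np.≤-trans (Np.m≤m+n i 0) le) ⊑-refl ch q)
        (∑-cong (List.downFrom m) λ c → cong (λ b → ind (not (at τ c h) ∧ b)) (at-ground m c h))
      variables-hit {suc k'} i τ (y ∷ ys) le (p , ch) q = trans (∑-++ (step i τ y) _ _) (trans (cong₂ _+_
        (step-hit i (Np.≤-trans (Np.m≤m+n i (suc k')) le) (chain-ground ys ch) p q)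
        (variables-hit (suc i) y ys (subst (_≤ k) (Np.+-suc i k') le) ch (⊑-trans p q)))
        (trans (sym (∑-add (List.downFrom m) _ _)) (∑-cong (List.downFrom m) λ c →
          merge (at τ c h) (at y c h) (hit ys c h) (c <ᵇ h) (λ eτ ey → hit-⊑ p c h eτ ey ys ch))))
        where
        merge : ∀ a b d e → (a ≡ true → b ≡ false → d ≡ false) →
          ind (not a ∧ b ∧ e) + ind (not b ∧ d ∧ e) ≡ ind (not a ∧ (b ∨ d) ∧ e)
        merge true true d e _ = refl
        merge true false d e f rewrite f refl refl = refl
        merge false true d e _ = Np.+-identityʳ (ind e)
        merge false false d e _ = refl

      -- T has no east step at height `h < m`, so starting the chain there excludes no edge; the
      -- columns left of `h` are those of the interior edges.
      used : ∀ (ys : Vec (Vec ℕ m) k) → Chain (top m m) ys → occurrences v (variables 0 (top m m) ys) ≡ ∑ (List.downFrom h) (λ c → ind (hit ys c h))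
      used ys ch = trans (variables-hit 0 (top m m) ys Np.≤-refl ch ⊑-refl) (trans
        (∑-cong (List.downFrom m) (λ c → cong (λ b → ind (not b ∧ hit ys c h ∧ (c <ᵇ h))) (at-top m c (λ e → Np.<⇒≢ h<m (sym e)))))
        (∑-below m (λ c → hit ys c h) (Np.<⇒≤ h<m)))

    cell-bound : ∀ i l t z → i ≤ k → l < m → l ≤ z → All (_< K) (cell i l t z)
    cell-bound i l t z i≤k l<m l≤z with z ≟ t
    ... | yes _ = Np.≤-<-trans i≤k (Np.m<m+n k (Np.≤-<-trans z≤n l<m)) ∷ []
    ... | no _ with z ≟ l
    ...   | yes _ = []
    ...   | no z≢l = ∸-< (Np.<-≤-trans (Np.≤-<-trans z≤n l<m) (Np.m≤n+m m k)) (Np.≤-<-trans z≤n (Np.≤∧≢⇒< l≤z (z≢l ∘ sym))) ∷ []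
      where
      ∸-< : ∀ {a b} → 0 < a → 0 < b → a ∸ b < a
      ∸-< {suc a} {suc b} _ _ = s≤s (Np.m∸n≤m a b)

    step-bound : ∀ {l} i {τ y : Vec ℕ l} → i ≤ k → l ≤ m → ground l ⊑ y → All (_< K) (step i τ y)
    step-bound i {[]} {[]} _ _ _ = []
    step-bound {suc l} i {t ∷ τ} {z ∷ y} i≤k le (g ∷ gs) = Allₚ.++⁺ (cell-bound i l t z i≤k le g) (step-bound i {τ} {y} i≤k (Np.<⇒≤ le) gs)

    variables-bound : ∀ {k'} i τ (ys : Vec (Vec ℕ m) k') → i + k' ≤ k → Chain τ ys → All (_< K) (variables i τ ys)
    variables-bound i τ [] le ch = step-bound i {τ} {ground m} (Np.≤-trans (Np.m≤m+n i 0) le) Np.≤-refl ⊑-refl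
    variables-bound {suc k'} i τ (y ∷ ys) le (p , ch) = Allₚ.++⁺
      (step-bound i {τ} {y} (Np.≤-trans (Np.m≤m+n i (suc k')) le) Np.≤-refl (chain-ground ys ch))
      (variables-bound (suc i) y ys (subst (_≤ k) (Np.+-suc i k') le) ch)

    module Weights (x : ℕ → ℕ) where
      s : ℕ → ℕ
      s l = x (K ∸ l)

      open PathAlgebra s
      open PathOperators s

      cell-weight : ∀ i {l t z} → l ≤ z → z ≤ t → γ l (x i) t z ≡ product (List.map x (cell i l t z))
      cell-weight i {l} {t} {z} l≤z z≤t with z ≟ t
      ... | yes refl = trans (γ-equal l≤z) (sym (Np.*-identityʳ (x i)))
      ... | no z≢t with z ≟ l
      ...   | yes refl = trans (γ-between l≤z (Np.≤∧≢⇒< z≤t z≢t)) (σ-ground l)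
      ...   | no z≢l = trans (γ-between l≤z (Np.≤∧≢⇒< z≤t z≢t))
                (trans (σ-above (Np.≤∧≢⇒< l≤z (z≢l ∘ sym))) (sym (Np.*-identityʳ (s z))))

      step-weight : ∀ {l} i {τ y : Vec ℕ l} → ground l ⊑ y → y ⊑ τ → Γ (x i) τ y ≡ product (List.map x (step i τ y))
      step-weight i {[]} {[]} _ _ = refl
      step-weight {suc l} i {t ∷ τ} {z ∷ y} (g ∷ gs) (p ∷ ps) = trans
        (cong₂ _*_ (cell-weight i g p) (step-weight i gs ps)) (sym (product-map-++ x (cell i l t z) (step i τ y)))

      step-zero : ∀ {l} α {τ y : Vec ℕ l} → ¬ (y ⊑ τ) → Γ α τ y ≡ 0
      step-zero α {[]} {[]} n = ⊥-elim (n [])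
      step-zero {suc l} α {t ∷ τ} {z ∷ y} n with z ≤? t
      ... | yes p = trans (cong (γ l α t z *_) (step-zero α (λ ps → n (p ∷ ps)))) (Np.*-zeroʳ (γ l α t z))
      ... | no z≰t = cong (_* Γ α τ y) (γ-high (Np.≰⇒> z≰t))

      chainWeight : ∀ {k'} → ℕ → Vec ℕ m → Vec (Vec ℕ m) k' → ℕ
      chainWeight i τ [] = Γ (x i) τ (ground m)
      chainWeight i τ (y ∷ ys) = Γ (x i) τ y * chainWeight (suc i) y ys

      chainWeight-chain : ∀ {k'} i τ (ys : Vec (Vec ℕ m) k') → Chain τ ys → chainWeight i τ ys ≡ product (List.map x (variables i τ ys))
      chainWeight-chain i τ [] ch = step-weight i ⊑-refl ch
      chainWeight-chain i τ (y ∷ ys) (p , ch) = trans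
        (cong₂ _*_ (step-weight i (chain-ground ys ch) p) (chainWeight-chain (suc i) y ys ch))
        (sym (product-map-++ x (step i τ y) _))

      chainWeight-zero : ∀ {k'} i τ (ys : Vec (Vec ℕ m) k') → ¬ Chain τ ys → chainWeight i τ ys ≡ 0
      chainWeight-zero i τ [] n = step-zero (x i) n
      chainWeight-zero i τ (y ∷ ys) n with Pw.decidable _≤?_ y τ
      ... | yes p = trans (cong (Γ (x i) τ y *_) (chainWeight-zero (suc i) y ys (λ ch → n (p , ch)))) (Np.*-zeroʳ (Γ (x i) τ y))
      ... | no np = cong (_* chainWeight (suc i) y ys) (step-zero (x i) np)

      -- Multiplies out the operators. The function `f` abstracts the shift of the variables caused
      -- by peeling off the first one.
      pathSum-tuples : ∀ k' i (f : ℕ → ℕ) → (∀ j → f j ≡ x (i + j)) → ∀ τ →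
        foldr (D (suc m)) δ (List.applyUpTo f (suc k')) τ ≡ ∑ (tuples m k') (chainWeight i τ)
      pathSum-tuples zero i f e τ = trans (D-δ (suc m) (f 0) τ (Np.n≤1+n m))
        (trans (cong (λ a → Γ a τ (ground m)) (trans (e 0) (cong x (Np.+-identityʳ i)))) (sym (Np.+-identityʳ _)))
      pathSum-tuples (suc k') i f e τ = begin
        D (suc m) (f 0) (foldr (D (suc m)) δ (List.applyUpTo (f ∘ suc) (suc k'))) τ
          ≡⟨ cong (λ a → D (suc m) a (foldr (D (suc m)) δ (List.applyUpTo (f ∘ suc) (suc k'))) τ) (trans (e 0) (cong x (Np.+-identityʳ i))) ⟩
        D (suc m) (x i) (foldr (D (suc m)) δ (List.applyUpTo (f ∘ suc) (suc k'))) τ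
          ≡⟨ ∑-cong (decreasings m (suc m)) (λ y → trans
               (cong (Γ (x i) τ y *_) (pathSum-tuples k' (suc i) (f ∘ suc) (λ j → trans (e (suc j)) (cong x (Np.+-suc i j))) y))
               (sym (∑-scale (Γ (x i) τ y) (tuples m k') (chainWeight (suc i) y)))) ⟩
        ∑ (decreasings m (suc m)) (λ y → ∑ (tuples m k') (λ ys → chainWeight i τ (y ∷ ys)))
          ≡⟨ sym (∑-product _∷_ (decreasings m (suc m)) (tuples m k') (chainWeight i τ)) ⟩
        ∑ (tuples m (suc k')) (chainWeight i τ) ∎
        where open ≡-Reasoning

  ∑-filter : {P : A → Set} (P? : ∀ a → Dec (P a)) (xs : List A) (f : A → ℕ) → ∑ (List.filter P? xs) f ≡ ∑ xs (λ a → when (P? a) (f a))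
  ∑-filter P? [] f = refl
  ∑-filter P? (a ∷ xs) f with P? a
  ... | yes _ = cong (f a +_) (∑-filter P? xs f)
  ... | no _ = ∑-filter P? xs f

  module PathEnumeration (k n : ℕ) (nEq : n ≡ suc (k + (k + msz n k))) where
    private
      M : ℕ
      M = msz n k
    open Exponents k M

    size : n ∸ k ∸ 1 ≡ K
    size = trans (Np.∸-+-assoc n k 1) (trans (cong₂ _∸_ nEq (Np.+-comm k 1)) (Np.m+n∸m≡n k K))

    prediction : Vec (List Step) k → Vec ℕ (n ∸ k ∸ 1)
    prediction Ps = Vec.tabulate λ j → predicted n k Ps (suc (toℕ j))

    predicted-contact : ∀ Ps j → j ≤ k → predicted n k Ps (suc j) ≡ hpar n k Ps j
    predicted-contact Ps j le rewrite <⇒<ᵇ≡true (s≤s le) = refl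

    -- For `i = K - h + 1` one has `n - i - k = h`, the number of interior edges at height `h`; so
    -- the prediction is the number of used ones.
    predicted-used : ∀ Ps h → h < M → predicted n k Ps (suc (K ∸ h)) ≡ h ∸ upar n k Ps (M ∸ h)
    predicted-used Ps h h<M rewrite ≥⇒<ᵇ≡false {K ∸ h} {suc k} (K∸z>k h<M) = cong₂ (λ a b → a ∸ upar n k Ps b) e₁ e₂
      where
      K∸h≡ : K ∸ h ≡ k + (M ∸ h)
      K∸h≡ = Np.+-∸-assoc k (Np.<⇒≤ h<M)
      e₁ : n ∸ suc (K ∸ h) ∸ k ≡ h
      e₁ = begin
        n ∸ suc (K ∸ h) ∸ k     ≡⟨ Np.∸-+-assoc n (suc (K ∸ h)) k ⟩
        n ∸ (suc (K ∸ h) + k)   ≡⟨ cong₂ (λ a b → a ∸ suc b) nEq (Np.+-comm (K ∸ h) k) ⟩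
        (k + K) ∸ (k + (K ∸ h)) ≡⟨ Np.[m+n]∸[m+o]≡n∸o k K (K ∸ h) ⟩
        K ∸ (K ∸ h)             ≡⟨ Np.m∸[m∸n]≡n (Np.≤-trans (Np.<⇒≤ h<M) (Np.m≤n+m M k)) ⟩
        h ∎
        where open ≡-Reasoning
      e₂ : suc (K ∸ h) ∸ k ∸ 1 ≡ M ∸ h
      e₂ = begin
        suc (K ∸ h) ∸ k ∸ 1       ≡⟨ Np.∸-+-assoc (suc (K ∸ h)) k 1 ⟩
        suc (K ∸ h) ∸ (k + 1)     ≡⟨ cong₂ (λ a b → suc a ∸ b) K∸h≡ (Np.+-comm k 1) ⟩
        (k + (M ∸ h)) ∸ k         ≡⟨ Np.m+n∸m≡n k (M ∸ h) ⟩
        M ∸ h ∎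
        where open ≡-Reasoning

    module _ (ys : Vec (Vec ℕ M) k) (ds : VAll.All (Decreasing (suc M)) ys) (ch : Chain (top M M) ys) where
      Ps : Vec (List Step) k
      Ps = Vec.map path ys

      hpar-coincidences : ∀ i → hpar n k Ps i ≡ nth (coincidenceList (top M M) ys) i
      hpar-coincidences i rewrite Tpath-heights M | Bpath-heights M =
        cong (λ L → nth L i) (common-list ys (top-decreasing M M) ds)

      upar-hits : ∀ h → h ≤ M → h ∸ upar n k Ps (M ∸ h) ≡ ∑ (List.downFrom h) (λ c → ind (hit ys c h))
      upar-hits h h≤M rewrite Np.m∸[m∸n]≡n h≤M = begin
        h ∸ List.length (List.filterᵇ (λ c → not (any (λ P → uses P (c , h)) (Vec.toList Ps))) (List.upTo h))
          ≡⟨ cong (h ∸_) (filterᵇ-cong (λ c → cong not (any-uses ys ds c h)) (List.upTo h)) ⟩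
        h ∸ free
          ≡⟨ cong (_∸ free) (trans (sym (Lp.length-upTo h)) (sym (filterᵇ-complement (λ c → hit ys c h) (List.upTo h)))) ⟩
        free + ∑ (List.upTo h) (λ c → ind (hit ys c h)) ∸ free
          ≡⟨ Np.m+n∸m≡n free _ ⟩
        ∑ (List.upTo h) (λ c → ind (hit ys c h))
          ≡⟨ ∑-upTo h _ ⟩
        ∑ (List.downFrom h) (λ c → ind (hit ys c h)) ∎
        where
        open ≡-Reasoning
        free = List.length (List.filterᵇ (λ c → not (hit ys c h)) (List.upTo h))

      predicted-occurrences : ∀ j → j < K → predicted n k Ps (suc j) ≡ occurrences j (variables 0 (top M M) ys)
      predicted-occurrences j j<K with j ≤? k
      ... | yes j≤k = trans (predicted-contact Ps j j≤k) (trans (hpar-coincidences j)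
              (sym (contact-occurrences 0 (top M M) ys j ch ⊑-refl j≤k)))
      ... | no j≰k = subst (λ i → predicted n k Ps (suc i) ≡ occurrences i (variables 0 (top M M) ys)) (Np.m∸[m∸n]≡n (Np.<⇒≤ j<K))
              (trans (predicted-used Ps (K ∸ j) h<M) (trans (upar-hits (K ∸ j) (Np.<⇒≤ h<M)) (sym (used h<M ys ch))))
        where
        h<M : K ∸ j < M
        h<M = subst (K ∸ j <_) (Np.m+n∸m≡n k M) (Np.∸-monoʳ-< (Np.≰⇒> j≰k) (Np.<⇒≤ j<K))

      prediction-monomial : ∀ x → monomial x (prediction Ps) ≡ product (List.map x (variables 0 (top M M) ys))
      prediction-monomial x = trans
        (monomial-cong x (λ j → predicted-occurrences (toℕ j) (subst (toℕ j <_) size (Fp.toℕ<n j))))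
        (sym (monomial-occurrences x _ (subst (λ N → All (_< N) (variables 0 (top M M) ys)) (sym size)
          (variables-bound 0 (top M M) ys Np.≤-refl ch))))

    pathTuples : List (Vec (List Step) k)
    pathTuples = List.map (Vec.map path) (List.filter (chain? (top M M)) (tuples M k))

    pathTuples-sum : ∀ x → ∑ pathTuples (monomial x ∘ prediction) ≡
      PathOperators.pathSum (Weights.s x) M (List.applyUpTo x (suc k))
    pathTuples-sum x = begin
      ∑ pathTuples (monomial x ∘ prediction)
        ≡⟨ ∑-map (Vec.map path) (List.filter (chain? (top M M)) (tuples M k)) (monomial x ∘ prediction) ⟩
      ∑ (List.filter (chain? (top M M)) (tuples M k)) (λ ys → monomial x (prediction (Vec.map path ys)))
        ≡⟨ ∑-filter (chain? (top M M)) (tuples M k) _ ⟩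
      ∑ (tuples M k) (λ ys → when (chain? (top M M) ys) (monomial x (prediction (Vec.map path ys))))
        ≡⟨ ∑-cong∈ (tuples M k) (λ ys ys∈ → term ys (∈-tuples⁻ M k ys∈)) ⟩
      ∑ (tuples M k) (chainWeight 0 (top M M))
        ≡⟨ sym (pathSum-tuples k 0 x (λ _ → refl) (top M M)) ⟩
      PathOperators.pathSum (Weights.s x) M (List.applyUpTo x (suc k)) ∎
      where
      open ≡-Reasoning
      open Weights x
      term : ∀ ys → VAll.All (Decreasing (suc M)) ys →
        when (chain? (top M M) ys) (monomial x (prediction (Vec.map path ys))) ≡ chainWeight 0 (top M M) ys
      term ys ds with chain? (top M M) ys
      ... | yes ch = trans (prediction-monomial ys ds ch x) (sym (chainWeight-chain 0 (top M M) ys ch))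
      ... | no nch = sym (chainWeight-zero 0 (top M M) ys nch)

    pathTuples-unique : Unique pathTuples
    pathTuples-unique = unique-map _ inj (Uq.filter⁺ (chain? (top M M)) (unique-tuples M k))
      where
      maps-injective : ∀ {k'} {ys zs : Vec (Vec ℕ M) k'} → VAll.All (Decreasing (suc M)) ys → VAll.All (Decreasing (suc M)) zs →
        Vec.map path ys ≡ Vec.map path zs → ys ≡ zs
      maps-injective [] [] _ = refl
      maps-injective (d ∷ ds) (e ∷ es) eq = cong₂ _∷_ (path-injective d e (Vp.∷-injectiveˡ eq)) (maps-injective ds es (Vp.∷-injectiveʳ eq))
      inj : ∀ {a b} → a ∈ List.filter (chain? (top M M)) (tuples M k) → b ∈ List.filter (chain? (top M M)) (tuples M k) →
        Vec.map path a ≡ Vec.map path b → a ≡ b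
      inj a∈ b∈ = maps-injective (∈-tuples⁻ M k (proj₁ (∈-filter⁻ (chain? (top M M)) {xs = tuples M k} a∈)))
        (∈-tuples⁻ M k (proj₁ (∈-filter⁻ (chain? (top M M)) {xs = tuples M k} b∈)))

    -- `InD` for tuples of any length, with the size `M` held fixed, so that a tuple can be
    -- traversed by induction.
    Family : ∀ {k'} → Vec (List Step) k' → Set
    Family {k'} Ps = (∀ i → ValidPath M (Vec.lookup Ps i)) × (∀ i → WeaklyAbove (Vec.lookup Ps i) (Bpath M)) ×
      (∀ i → WeaklyAbove (Tpath M) (Vec.lookup Ps i)) ×
      (∀ (i j : Fin k') → toℕ j ≡ suc (toℕ i) → WeaklyAbove (Vec.lookup Ps i) (Vec.lookup Ps j))

    heights-of : ∀ {k'} (Ps : Vec (List Step) k') → (∀ i → ValidPath M (Vec.lookup Ps i)) →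
      Σ (Vec (Vec ℕ M) k') λ ys → VAll.All (Decreasing (suc M)) ys × Vec.map path ys ≡ Ps
    heights-of [] _ = [] , [] , refl
    heights-of (P ∷ Ps) v with path-heights P (v zero) | heights-of Ps (v ∘ suc)
    ... | y , d , refl | ys , ds , refl = y ∷ ys , d ∷ ds , refl

    -- The comparison of `τ` with the first path is quantified over indices equal to 0, a form that
    -- also makes sense for the empty tuple.
    family⇒chain : ∀ {k'} {τ} (ys : Vec (Vec ℕ M) k') → Decreasing (suc M) τ → VAll.All (Decreasing (suc M)) ys →
      ground M ⊑ τ → (∀ i → toℕ i ≡ 0 → WeaklyAbove (path τ) (Vec.lookup (Vec.map path ys) i)) → Family (Vec.map path ys) → Chain τ ys
    family⇒chain [] dτ [] g _ _ = g
    family⇒chain {τ = τ} (y ∷ ys) dτ (d ∷ ds) g first (v , b , t , a) = above⇒⊑ d dτ (first zero refl) ,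
      family⇒chain ys d ds
        (above⇒⊑ (decreasing-weaken (Np.n≤1+n M) (ground-decreasing M)) d (subst (WeaklyAbove (path y)) (Bpath-heights M) (b zero)))
        (λ i e → a zero (suc i) (cong suc e))
        (v ∘ suc , b ∘ suc , t ∘ suc , λ i j e → a (suc i) (suc j) (cong suc e))

    chain⇒family : ∀ {k'} {τ} (ys : Vec (Vec ℕ M) k') → Decreasing (suc M) τ → VAll.All (Decreasing (suc M)) ys → Chain τ ys →
      (∀ i → toℕ i ≡ 0 → WeaklyAbove (path τ) (Vec.lookup (Vec.map path ys) i)) × Family (Vec.map path ys)
    chain⇒family [] dτ [] ch = (λ ()) , (λ ()) , (λ ()) , (λ ()) , λ ()
    chain⇒family {τ = τ} (y ∷ ys) dτ (d ∷ ds) (p , ch) with chain⇒family ys d ds ch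
    ... | first , v , b , t , a = (λ { zero _ → ⊑⇒above d dτ p }) ,
      (λ { zero → path-valid d ; (suc i) → v i }) ,
      (λ { zero → subst (WeaklyAbove (path y)) (sym (Bpath-heights M)) (⊑⇒above (decreasing-weaken (Np.n≤1+n M) (ground-decreasing M)) d (chain-ground ys ch)) ; (suc i) → b i }) ,
      (λ { zero → subst (λ T → WeaklyAbove T (path y)) (sym (Tpath-heights M)) (⊑⇒above d (top-decreasing M M) (⊑-top d)) ; (suc i) → t i }) ,
      λ { zero (suc j) e → first j (Np.suc-injective e) ; (suc i) (suc j) e → a i j (Np.suc-injective e) }

    ground⊑top : ground M ⊑ top M M
    ground⊑top = ⊑-top (decreasing-weaken (Np.n≤1+n M) (ground-decreasing M))

    InD⇒∈ : ∀ {Ps} → InD n k Ps → Ps ∈ pathTuples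
    InD⇒∈ {Ps} fam@(v , _) with heights-of Ps v
    ... | ys , ds , refl = ∈-map⁺ (Vec.map path) (∈-filter⁺ (chain? (top M M)) (∈-tuples⁺ ds)
      (family⇒chain ys (top-decreasing M M) ds ground⊑top
        (λ i _ → subst (λ T → WeaklyAbove T (Vec.lookup (Vec.map path ys) i)) (Tpath-heights M) (proj₁ (proj₂ (proj₂ fam)) i)) fam))

    ∈⇒InD : ∀ {Ps} → Ps ∈ pathTuples → InD n k Ps
    ∈⇒InD Ps∈ with ∈-map⁻ (Vec.map path) Ps∈
    ... | ys , ys∈ , refl with ∈-filter⁻ (chain? (top M M)) {xs = tuples M k} ys∈
    ... | t∈ , ch = proj₂ (chain⇒family ys (top-decreasing M M) (∈-tuples⁻ M k t∈) ch)

-- Sorting processes and longest chains of cells.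

module Sorting where
  open Sums
  open Comparison using (Word; start; target; start-length)
  open PathChains using (ind; ind≤1)
  open PathTuples using (<⇒<ᵇ≡true; ≥⇒<ᵇ≡false)
  open import Data.Nat.ListAction using (sum)
  open import Data.List.Relation.Binary.Pointwise using (Pointwise; []; _∷_)

  -- The 0-Hecke counterpart of `u`: a descent is left alone instead of giving zero, so every set of
  -- diagonals defines a sorting process. Whether a step was an honest transposition is recorded by
  -- `strict`.
  stick : ℕ → Word → Word
  stick zero (x ∷ y ∷ w) = if x <ᵇ y then y ∷ x ∷ w else x ∷ y ∷ w
  stick zero w = w
  stick (suc j) [] = []
  stick (suc j) (x ∷ w) = x ∷ stick j w

  strict : ℕ → Word → Bool
  strict zero (x ∷ y ∷ w) = x <ᵇ y
  strict zero w = false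
  strict (suc j) [] = false
  strict (suc j) (x ∷ w) = strict j w

  stick-id : ∀ j w → strict j w ≡ false → stick j w ≡ w
  stick-id zero [] _ = refl
  stick-id zero (x ∷ []) _ = refl
  stick-id zero (x ∷ y ∷ w) e rewrite e = refl
  stick-id (suc j) [] _ = refl
  stick-id (suc j) (x ∷ w) e = cong (x ∷_) (stick-id j w e)

  stick-length : ∀ j w → List.length (stick j w) ≡ List.length w
  stick-length zero [] = refl
  stick-length zero (x ∷ []) = refl
  stick-length zero (x ∷ y ∷ w) with x <ᵇ y
  ... | true = refl
  ... | false = refl
  stick-length (suc j) [] = refl
  stick-length (suc j) (x ∷ w) = cong suc (stick-length j w)

  stick-sum : ∀ j w → sum (stick j w) ≡ sum w
  stick-sum zero [] = refl
  stick-sum zero (x ∷ []) = refl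
  stick-sum zero (x ∷ y ∷ w) with x <ᵇ y
  ... | true = +-exchange y x (sum w)
  ... | false = refl
  stick-sum (suc j) [] = refl
  stick-sum (suc j) (x ∷ w) = cong (x +_) (stick-sum j w)

  below : ℕ → Word → ℕ
  below x [] = 0
  below x (y ∷ w) = ind (x <ᵇ y) + below x w

  -- The number of non-inversions, that is, of strict steps still missing; it drops by one in each
  -- of them.
  ascents : Word → ℕ
  ascents [] = 0
  ascents (x ∷ w) = below x w + ascents w

  below-stick : ∀ x j w → below x (stick j w) ≡ below x w
  below-stick x zero [] = refl
  below-stick x zero (y ∷ []) = refl
  below-stick x zero (y ∷ z ∷ w) with y <ᵇ z
  ... | true = +-exchange (ind (x <ᵇ z)) (ind (x <ᵇ y)) (below x w)
  ... | false = refl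
  below-stick x (suc j) [] = refl
  below-stick x (suc j) (y ∷ w) = cong (ind (x <ᵇ y) +_) (below-stick x j w)

  ascents-stick : ∀ j w → ascents (stick j w) + ind (strict j w) ≡ ascents w
  ascents-stick zero [] = refl
  ascents-stick zero (x ∷ []) = refl
  ascents-stick zero (x ∷ y ∷ w) with x <ᵇ y in e
  ... | false = trans (Np.+-identityʳ _) (cong (λ b → (ind b + below x w) + (below y w + ascents w)) e)
  ... | true rewrite ≥⇒<ᵇ≡false {y} {x} (Np.<⇒≤ (Np.<ᵇ⇒< x y (subst T (sym e) tt))) = lem (below y w) (below x w) (ascents w)
    where
    lem : ∀ a b c → (0 + a) + (b + c) + 1 ≡ (1 + b) + (a + c)
    lem = solve-∀
  ascents-stick (suc j) [] = refl
  ascents-stick (suc j) (x ∷ w) = trans (Np.+-assoc (below x (stick j w)) _ _) (cong₂ _+_ (below-stick x j w) (ascents-stick j w))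

  runRow : (ℕ → Bool) → ℕ → Word → Word
  runRow p zero w = w
  runRow p (suc l) w = if p l then runRow p l w else stick l (runRow p l w)

  validRow : (ℕ → Bool) → ℕ → Word → Bool
  validRow p zero w = true
  validRow p (suc l) w = validRow p l w ∧ (if p l then true else strict l (runRow p l w))

  absent : (ℕ → Bool) → ℕ → ℕ
  absent p l = ∑ (List.downFrom l) λ j → ind (not (p j))

  runRow-length : ∀ p l w → List.length (runRow p l w) ≡ List.length w
  runRow-length p zero w = refl
  runRow-length p (suc l) w with p l
  ... | true = runRow-length p l w
  ... | false = trans (stick-length l _) (runRow-length p l w)

  runRow-sum : ∀ p l w → sum (runRow p l w) ≡ sum w
  runRow-sum p zero w = refl
  runRow-sum p (suc l) w with p l
  ... | true = runRow-sum p l w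
  ... | false = trans (stick-sum l _) (runRow-sum p l w)

  ascents-runRow : ∀ p l w → ascents w ≤ ascents (runRow p l w) + absent p l
  ascents-runRow p zero w = Np.≤-reflexive (sym (Np.+-identityʳ _))
  ascents-runRow p (suc l) w with p l
  ... | true = ascents-runRow p l w
  ... | false = Np.≤-trans (ascents-runRow p l w) (subst₂ _≤_ (cong (_+ absent p l) (ascents-stick l (runRow p l w)))
      (lem (ascents (stick l (runRow p l w))) (absent p l))
      (Np.+-monoˡ-≤ (absent p l) (Np.+-monoʳ-≤ (ascents (stick l (runRow p l w))) (ind≤1 (strict l (runRow p l w))))))
    where
    lem : ∀ a b → (a + 1) + b ≡ a + (1 + b)
    lem = solve-∀

  ∧-split : ∀ {a b} → (a ∧ b) ≡ true → a ≡ true × b ≡ true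
  ∧-split {true} {true} _ = refl , refl

  ascents-validRow : ∀ p l w → validRow p l w ≡ true → ascents (runRow p l w) + absent p l ≡ ascents w
  ascents-validRow p zero w _ = Np.+-identityʳ _
  ascents-validRow p (suc l) w e with p l | ∧-split {validRow p l w} e
  ... | true | v , _ = ascents-validRow p l w v
  ... | false | v , st = begin
    ascents (stick l (runRow p l w)) + (1 + absent p l) ≡⟨ sym (Np.+-assoc (ascents (stick l (runRow p l w))) 1 _) ⟩
    ascents (stick l (runRow p l w)) + 1 + absent p l   ≡⟨ cong (λ b → ascents (stick l (runRow p l w)) + ind b + absent p l) (sym st) ⟩
    ascents (stick l (runRow p l w)) + ind (strict l (runRow p l w)) + absent p l ≡⟨ cong (_+ absent p l) (ascents-stick l (runRow p l w)) ⟩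
    ascents (runRow p l w) + absent p l                 ≡⟨ ascents-validRow p l w v ⟩
    ascents w ∎
    where open ≡-Reasoning

  runRow-cong : ∀ {p q} l w → (∀ j → j < l → p j ≡ q j) → runRow p l w ≡ runRow q l w
  runRow-cong zero w e = refl
  runRow-cong {p} {q} (suc l) w e rewrite e l Np.≤-refl | runRow-cong {p} {q} l w (λ j lt → e j (Np.m<n⇒m<1+n lt)) = refl

  runRow-idle : ∀ {p q} l w j → j < l → p j ≡ false → strict j (runRow p j w) ≡ false → q j ≡ true →
    (∀ i → i ≢ j → p i ≡ q i) → runRow p l w ≡ runRow q l w
  runRow-idle {p} {q} (suc l) w j lt pj st qj e with j ≟ l
  ... | yes refl rewrite pj | qj = trans (stick-id j _ st) (runRow-cong l w (λ i i<l → e i (Np.<⇒≢ i<l)))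
  ... | no j≢l rewrite e l (j≢l ∘ sym) | runRow-idle {p} {q} l w j (Np.≤∧≢⇒< (Np.≤-pred lt) j≢l) pj st qj e = refl

  -- Thresholding at `c` makes the word a sequence of zeros and ones; these are its partial sums.
  count : ℕ → Word → ℕ → ℕ
  count c [] q = 0
  count c (x ∷ w) zero = 0
  count c (x ∷ w) (suc q) = ind (c ≤ᵇ x) + count c w q

  count-zero : ∀ c w → count c w 0 ≡ 0
  count-zero c [] = refl
  count-zero c (x ∷ w) = refl

  count-mono : ∀ c w q → count c w q ≤ count c w (suc q)
  count-mono c [] q = z≤n
  count-mono c (x ∷ w) zero = z≤n
  count-mono c (x ∷ w) (suc q) = Np.+-monoʳ-≤ (ind (c ≤ᵇ x)) (count-mono c w q)

  count-suc : ∀ c w q → count c w (suc q) ≤ suc (count c w q)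
  count-suc c [] q = z≤n
  count-suc c (x ∷ w) zero rewrite count-zero c w | Np.+-identityʳ (ind (c ≤ᵇ x)) with c ≤ᵇ x
  ... | true = Np.≤-refl
  ... | false = z≤n
  count-suc c (x ∷ w) (suc q) = subst (ind (c ≤ᵇ x) + count c w (suc q) ≤_) (Np.+-suc (ind (c ≤ᵇ x)) _) (Np.+-monoʳ-≤ (ind (c ≤ᵇ x)) (count-suc c w q))

  ≤ᵇ-mono : ∀ {c x y} → x ≤ y → (c ≤ᵇ x) ≡ true → (c ≤ᵇ y) ≡ true
  ≤ᵇ-mono {c} {x} {y} x≤y e = T⇒≡ (Np.≤⇒≤ᵇ (Np.≤-trans (Np.≤ᵇ⇒≤ c x (subst T (sym e) tt)) x≤y))
    where
    T⇒≡ : ∀ {b} → T b → b ≡ true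
    T⇒≡ {true} _ = refl

  count-stick-other : ∀ c j w q → q ≢ suc j → count c (stick j w) q ≡ count c w q
  count-stick-other c zero [] q _ = refl
  count-stick-other c zero (x ∷ []) q _ = refl
  count-stick-other c zero (x ∷ y ∷ w) q ne with x <ᵇ y
  ... | false = refl
  count-stick-other c zero (x ∷ y ∷ w) zero ne | true = refl
  count-stick-other c zero (x ∷ y ∷ w) (suc zero) ne | true = ⊥-elim (ne refl)
  count-stick-other c zero (x ∷ y ∷ w) (suc (suc q)) ne | true = +-exchange (ind (c ≤ᵇ y)) (ind (c ≤ᵇ x)) (count c w q)
  count-stick-other c (suc j) [] q _ = refl
  count-stick-other c (suc j) (x ∷ w) zero _ = refl
  count-stick-other c (suc j) (x ∷ w) (suc q) ne = cong (ind (c ≤ᵇ x) +_) (count-stick-other c j w q (ne ∘ cong suc))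

  -- After thresholding, a step moves a one to the front of its pair, so the partial sum inside the
  -- pair becomes as large as its two neighbours allow. This minimum is the recursion for longest
  -- chains.
  count-stick-at : ∀ c j w → suc j < List.length w → count c (stick j w) (suc j) ≡ suc (count c w j) ⊓ count c w (suc (suc j))
  count-stick-at c zero (x ∷ []) (s≤s ())
  count-stick-at c zero (x ∷ y ∷ w) _ rewrite count-zero c w with x <ᵇ y in e
  ... | true = go (c ≤ᵇ x) (c ≤ᵇ y) (≤ᵇ-mono {c} (Np.<⇒≤ (Np.<ᵇ⇒< x y (subst T (sym e) tt))))
    where
    go : ∀ a b → (a ≡ true → b ≡ true) → ind b + 0 ≡ 1 ⊓ (ind a + (ind b + 0))
    go true true _ = refl
    go true false f with () ← f refl
    go false true _ = refl
    go false false _ = refl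
  ... | false = go (c ≤ᵇ x) (c ≤ᵇ y) (≤ᵇ-mono {c} (Np.≮⇒≥ (λ lt → subst T e (Np.<⇒<ᵇ lt))))
    where
    go : ∀ a b → (b ≡ true → a ≡ true) → ind a + 0 ≡ 1 ⊓ (ind a + (ind b + 0))
    go true true _ = refl
    go true false _ = refl
    go false true f with () ← f refl
    go false false _ = refl
  count-stick-at c (suc j) (x ∷ w) (s≤s lt) = trans (cong (ind (c ≤ᵇ x) +_) (count-stick-at c j w lt))
    (trans (Np.+-distribˡ-⊓ (ind (c ≤ᵇ x)) _ _) (cong (_⊓ (ind (c ≤ᵇ x) + count c w (suc (suc j)))) (Np.+-suc (ind (c ≤ᵇ x)) _)))

  count-runRow-beyond : ∀ c p l w q → l < q → count c (runRow p l w) q ≡ count c w q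
  count-runRow-beyond c p zero w q _ = refl
  count-runRow-beyond c p (suc l) w q lt with p l
  ... | true = count-runRow-beyond c p l w q (Np.<⇒≤ lt)
  ... | false = trans (count-stick-other c l _ q (λ { refl → Np.<-irrefl refl lt })) (count-runRow-beyond c p l w q (Np.<⇒≤ lt))

  count-runRow-stable : ∀ c p l w q → q ≤ l → count c (runRow p (suc l) w) q ≡ count c (runRow p l w) q
  count-runRow-stable c p l w q le with p l
  ... | true = refl
  ... | false = count-stick-other c l _ q (λ { refl → Np.<-irrefl refl le })

  count-runRow-present : ∀ c p l w j → j < l → p j ≡ true → count c (runRow p l w) (suc j) ≡ count c w (suc j)
  count-runRow-present c p (suc l) w j lt pj with j ≟ l
  ... | yes refl rewrite pj = count-runRow-beyond c p l w (suc l) Np.≤-refl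
  ... | no j≢l = trans (count-runRow-stable c p l w (suc j) j<l) (count-runRow-present c p l w j j<l pj)
    where j<l = Np.≤∧≢⇒< (Np.≤-pred lt) j≢l

  count-runRow-absent : ∀ c p l w j → j < l → l < List.length w → p j ≡ false →
    count c (runRow p l w) (suc j) ≡ suc (count c (runRow p l w) j) ⊓ count c w (suc (suc j))
  count-runRow-absent c p (suc l) w j lt len pj with j ≟ l
  ... | yes refl = begin
    count c (runRow p (suc l) w) (suc l)
      ≡⟨ cong (λ b → count c (if b then runRow p l w else stick l (runRow p l w)) (suc l)) pj ⟩
    count c (stick l (runRow p l w)) (suc l)
      ≡⟨ count-stick-at c l (runRow p l w) (subst (suc l <_) (sym (runRow-length p l w)) len) ⟩
    suc (count c (runRow p l w) l) ⊓ count c (runRow p l w) (suc (suc l))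
      ≡⟨ cong₂ (λ a b → suc a ⊓ b) (sym (count-runRow-stable c p l w l Np.≤-refl)) (count-runRow-beyond c p l w (suc (suc l)) (Np.n≤1+n (suc l))) ⟩
    suc (count c (runRow p (suc l) w) l) ⊓ count c w (suc (suc l)) ∎
    where open ≡-Reasoning
  ... | no j≢l = trans (count-runRow-stable c p l w (suc j) j<l) (trans (count-runRow-absent c p l w j j<l (Np.<⇒≤ len) pj)
      (cong (λ a → suc a ⊓ count c w (suc (suc j))) (sym (count-runRow-stable c p l w j (Np.<⇒≤ j<l)))))
    where j<l = Np.≤∧≢⇒< (Np.≤-pred lt) j≢l

  count-≤ : ∀ c w q → count c w q ≤ q
  count-≤ c [] q = z≤n
  count-≤ c (x ∷ w) zero = z≤n
  count-≤ c (x ∷ w) (suc q) with c ≤ᵇ x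
  ... | true = s≤s (count-≤ c w q)
  ... | false = Np.m≤n⇒m≤1+n (count-≤ c w q)

  ≤⇒≤ᵇ≡true : ∀ {a b} → a ≤ b → (a ≤ᵇ b) ≡ true
  ≤⇒≤ᵇ≡true {zero} _ = refl
  ≤⇒≤ᵇ≡true {suc a} p = <⇒<ᵇ≡true p

  >⇒≤ᵇ≡false : ∀ {a b} → b < a → (a ≤ᵇ b) ≡ false
  >⇒≤ᵇ≡false {suc a} (s≤s p) = ≥⇒<ᵇ≡false p

  count-start-upper : ∀ c b m q → c ≤ b + q → c + count c (start b m) q ≤ b + q
  count-start-upper c b m q le with c ≤? b
  ... | yes c≤b = Np.+-mono-≤ c≤b (count-≤ c (start b m) q)
  count-start-upper c b zero zero le | no c≰b = ⊥-elim (c≰b (subst (c ≤_) (Np.+-identityʳ b) le))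
  count-start-upper c b (suc m) zero le | no c≰b = ⊥-elim (c≰b (subst (c ≤_) (Np.+-identityʳ b) le))
  count-start-upper c b zero (suc q) le | no c≰b rewrite >⇒≤ᵇ≡false (Np.≰⇒> c≰b) = subst (_≤ b + suc q) (sym (Np.+-identityʳ c)) le
  count-start-upper c b (suc m) (suc q) le | no c≰b rewrite >⇒≤ᵇ≡false (Np.≰⇒> c≰b) =
    subst (c + count c (start (suc b) m) q ≤_) (sym (Np.+-suc b q))
      (count-start-upper c (suc b) m q (subst (c ≤_) (Np.+-suc b q) le))

  count-start-all : ∀ c b m q → c ≤ b → q ≤ suc m → q ≤ count c (start b m) q
  count-start-all c b m zero _ _ = z≤n
  count-start-all c b zero (suc zero) p _ rewrite ≤⇒≤ᵇ≡true p = s≤s z≤n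
  count-start-all c b zero (suc (suc q)) p (s≤s ())
  count-start-all c b (suc m) (suc q) p (s≤s le) rewrite ≤⇒≤ᵇ≡true p = s≤s (count-start-all c (suc b) m q (Np.m≤n⇒m≤1+n p) le)

  count-start-lower : ∀ c b m q → b ≤ c → q ≤ suc m → b + q ≤ c + count c (start b m) q
  count-start-lower c b m q b≤c le with c ≤? b
  ... | yes c≤b = Np.+-mono-≤ b≤c (count-start-all c b m q c≤b le)
  count-start-lower c b m zero b≤c le | no c≰b = Np.+-mono-≤ b≤c z≤n
  count-start-lower c b zero (suc zero) b≤c le | no c≰b rewrite >⇒≤ᵇ≡false (Np.≰⇒> c≰b) =
    subst₂ _≤_ (Np.+-comm 1 b) (sym (Np.+-identityʳ c)) (Np.≰⇒> c≰b)
  count-start-lower c b zero (suc (suc q)) b≤c (s≤s ()) | no c≰b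
  count-start-lower c b (suc m) (suc q) b≤c (s≤s le) | no c≰b rewrite >⇒≤ᵇ≡false (Np.≰⇒> c≰b) =
    subst (_≤ c + count c (start (suc b) m) q) (sym (Np.+-suc b q)) (count-start-lower c (suc b) m q (Np.≰⇒> c≰b) le)

  target-cons : ∀ c m → target c (suc m) ≡ c + suc m ∷ target c m
  target-cons c zero = cong (_∷ c ∷ []) (Np.+-comm 1 c)
  target-cons c (suc m) = trans (cong (List._∷ʳ c) (target-cons (suc c) m)) (cong (_∷ target (suc c) m List.∷ʳ c) (sym (Np.+-suc c (suc m))))

  target≡downFrom : ∀ m → target 0 m ≡ List.downFrom (suc m)
  target≡downFrom zero = refl
  target≡downFrom (suc m) = trans (target-cons 0 m) (cong (suc m ∷_) (target≡downFrom m))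

  count-downFrom : ∀ c M → c ≤ M → count c (List.downFrom M) (M ∸ c) ≡ M ∸ c
  count-downFrom c M le with c ≟ M
  ... | yes refl rewrite Np.n∸n≡0 M = count-zero M (List.downFrom M)
  count-downFrom zero zero le | no ne = refl
  count-downFrom c (suc M) le | no ne rewrite Np.+-∸-assoc 1 (Np.≤-pred (Np.≤∧≢⇒< le ne)) | ≤⇒≤ᵇ≡true (Np.≤-pred (Np.≤∧≢⇒< le ne)) =
    cong suc (count-downFrom c M (Np.≤-pred (Np.≤∧≢⇒< le ne)))

  sum-start : ∀ c m → sum (start c m) ≡ sum (target c m)
  sum-start c zero = refl
  sum-start c (suc m) = trans (cong (c +_) (sum-start (suc c) m)) (trans (Np.+-comm c _) (sym (sum-snoc (target (suc c) m))))
    where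
    sum-snoc : ∀ w → sum (w List.∷ʳ c) ≡ sum w + c
    sum-snoc [] = Np.+-identityʳ c
    sum-snoc (x ∷ w) = trans (cong (x +_) (sum-snoc w)) (sym (Np.+-assoc x _ _))

  -- Together with `deficient` this avoids any talk of permutations: the sum of the letters is the
  -- only invariant that has to be tracked.
  dominating-equal : ∀ {w v} → Pointwise (λ x y → y ≤ x) w v → sum w ≡ sum v → w ≡ v
  dominating-sum : ∀ {w v} → Pointwise (λ x y → y ≤ x) w v → sum v ≤ sum w
  dominating-sum [] = z≤n
  dominating-sum (p ∷ ps) = Np.+-mono-≤ p (dominating-sum ps)
  dominating-equal [] _ = refl
  dominating-equal {x ∷ w} {y ∷ v} (p ∷ ps) e with x ≟ y
  ... | yes refl = cong (x ∷_) (dominating-equal ps (Np.+-cancelˡ-≡ x _ _ e))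
  ... | no x≢y = ⊥-elim (Np.<-irrefl (sym e) (Np.+-mono-<-≤ (Np.≤∧≢⇒< p (x≢y ∘ sym)) (dominating-sum ps)))

  -- If some letter is too small for its place, the threshold `c` is the letter expected there: it
  -- then fails among the first `M - c` places.
  deficient : ∀ M w → List.length w ≡ M →
    Pointwise (λ x y → y ≤ x) w (List.downFrom M) ⊎ (Σ ℕ λ c → c < M × count c w (M ∸ c) < M ∸ c)
  deficient zero [] _ = inj₁ []
  deficient (suc M) (x ∷ w) e with M ≤? x
  ... | no M≰x = inj₂ (M , Np.≤-refl , subst (λ q → count M (x ∷ w) q < q) (sym (Np.m+n∸n≡m 1 M))
          (subst (_< 1) (sym (trans (cong (λ b → ind b + count M w 0) (>⇒≤ᵇ≡false (Np.≰⇒> M≰x))) (count-zero M w))) (s≤s z≤n)))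
  ... | yes M≤x with deficient M w (Np.suc-injective e)
  ...   | inj₁ ps = inj₁ (M≤x ∷ ps)
  ...   | inj₂ (c , c<M , lt) = inj₂ (c , Np.m<n⇒m<1+n c<M ,
          subst (λ q → count c (x ∷ w) q < q) (sym (Np.+-∸-assoc 1 (Np.<⇒≤ c<M))) (Np.+-mono-≤-< (ind≤1 (c ≤ᵇ x)) lt))

  -- Chains of cells (a, a + k + q), increasing in both coordinates, bounded by
  -- row A and column k + B.
  data Cells (k c : ℕ) (P : ℕ → ℕ → Set) : ℕ → ℕ → ℕ → Set where
    nil  : ∀ {A B} → Cells k c P 0 A B
    snoc : ∀ {d A B} a q → Cells k c P d a (a + q) → P a (a + (k + q)) → c ≤ a + q → a < A → a + q < B → Cells k c P (suc d) A B

  cells-weaken : ∀ {k c P d A A' B B'} → A ≤ A' → B ≤ B' → Cells k c P d A B → Cells k c P d A' B'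
  cells-weaken _ _ nil = nil
  cells-weaken p q (snoc a r ch x y u v) = snoc a r ch x y (Np.≤-trans u p) (Np.≤-trans v q)

  cells-map : ∀ {k c P Q d A B} → (∀ {a b} → P a b → Q a b) → Cells k c P d A B → Cells k c Q d A B
  cells-map f nil = nil
  cells-map f (snoc a q ch p x y z) = snoc a q (cells-map f ch) (f p) x y z

  module Run (k m : ℕ) where
    K : ℕ
    K = k + m

    -- From vertex `a` the nontrivial diagonals to later vertices end at
    -- `a + k + 1, ..., a + k + m`, cut off at the last vertex `k + K`.
    rowLength : ℕ → ℕ
    rowLength a = m ⊓ (K ∸ a)

    rowLength≤m : ∀ a → rowLength a ≤ m
    rowLength≤m a = Np.m⊓n≤m m (K ∸ a)

    letters : (ℕ → ℕ → Bool) → ℕ → ℕ → Bool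
    letters e a j = e a (a + (k + suc j))

    state : (ℕ → ℕ → Bool) → ℕ → Word
    state e zero = start 0 m
    state e (suc a) = runRow (letters e a) (rowLength a) (state e a)

    state-length : ∀ e a → List.length (state e a) ≡ suc m
    state-length e zero = start-length 0 m
    state-length e (suc a) = trans (runRow-length _ (rowLength a) _) (state-length e a)

    state-sum : ∀ e a → sum (state e a) ≡ sum (target 0 m)
    state-sum e zero = sum-start 0 m
    state-sum e (suc a) = trans (runRow-sum _ (rowLength a) _) (state-sum e a)

    module _ (e : ℕ → ℕ → Bool) (c : ℕ) where
      -- The quantity `a + q - c - S a q` plays the role of the longest chain of present cells in
      -- rows before `a` and columns before `a + k + q`; `lower-bound` and `extract` are the two
      -- inequalities.
      S : ℕ → ℕ → ℕ
      S a q = count c (state e a) q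

      S-beyond : ∀ a q → rowLength a < q → S (suc a) q ≡ S a q
      S-beyond a q lt = count-runRow-beyond c (letters e a) (rowLength a) (state e a) q lt

      S-kept : ∀ a q → e a (a + (k + q)) ≡ true → S (suc a) q ≡ S a q
      S-kept a zero _ = trans (count-zero c (state e (suc a))) (sym (count-zero c (state e a)))
      S-kept a (suc j) p with suc j ≤? rowLength a
      ... | yes le = count-runRow-present c (letters e a) (rowLength a) (state e a) j le p
      ... | no nle = S-beyond a (suc j) (Np.≰⇒> nle)

      S-absent : ∀ a j → j < rowLength a → letters e a j ≡ false → S (suc a) (suc j) ≡ suc (S (suc a) j) ⊓ S a (suc (suc j))
      S-absent a j lt p = count-runRow-absent c (letters e a) (rowLength a) (state e a) j lt
        (subst (rowLength a <_) (sym (state-length e a)) (s≤s (rowLength≤m a))) p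

      S-down : ∀ a q → S (suc a) q ≤ S a (suc q)
      S-down a zero = Np.≤-trans (Np.≤-reflexive (count-zero c (state e (suc a)))) z≤n
      S-down a (suc j) with suc j ≤? rowLength a
      ... | no nle = Np.≤-trans (Np.≤-reflexive (S-beyond a (suc j) (Np.≰⇒> nle))) (count-mono c (state e a) (suc j))
      ... | yes le with letters e a j in p
      ...   | true = Np.≤-trans (Np.≤-reflexive (S-kept a (suc j) p)) (count-mono c (state e a) (suc j))
      ...   | false = Np.≤-trans (Np.≤-reflexive (S-absent a j le p)) (Np.m⊓n≤n _ _)

      S-downs : ∀ a r q → S (r + a) q ≤ S a (r + q)
      S-downs a zero q = Np.≤-refl
      S-downs a (suc r) q = Np.≤-trans (S-down (r + a) q) (subst (S (r + a) (suc q) ≤_) (cong (S a) (Np.+-suc r q)) (S-downs a r (suc q)))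

      S-right : ∀ a q r → S a (r + q) ≤ r + S a q
      S-right a q zero = Np.≤-refl
      S-right a q (suc r) = Np.≤-trans (count-suc c (state e a) (r + q)) (s≤s (S-right a q r))

      -- Without subtraction: `a + q - S a q` cannot decrease when the region grows. A step down in
      -- the rows at fixed column is `S-downs`, a step right is `S-right`.
      S-mono : ∀ a q a' q' → a ≤ a' → a + q ≤ a' + q' → S a' q' + (a + q) ≤ S a q + (a' + q')
      S-mono a q a' q' le le' with Np.m≤n⇒∃[o]m+o≡n le
      ... | r , refl with Np.m≤n⇒∃[o]m+o≡n (Np.+-cancelˡ-≤ a q (r + q') (subst (a + q ≤_) (Np.+-assoc a r q') le'))
      ...   | t , eq = subst₂ _≤_ (cong (λ z → S z q' + (a + q)) (Np.+-comm r a))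
              (trans (l1 t (S a q) a q) (cong (S a q +_) (trans (cong (a +_) eq) (sym (Np.+-assoc a r q')))))
              (Np.+-monoˡ-≤ (a + q) (Np.≤-trans (S-downs a r q')
                (subst (λ z → S a z ≤ t + S a q) (trans (Np.+-comm t q) eq) (S-right a q t))))
        where
        l1 : ∀ t s a q → (t + s) + (a + q) ≡ s + (a + (q + t))
        l1 = solve-∀

      -- A present cell leaves `S` unchanged while the row number grows by one, so each cell of a
      -- chain gains one unit.
      lower-bound : ∀ {P d A B} → (∀ {a b} → P a b → e a b ≡ true) → Cells k c P d A B →
        ∀ a' q' → A ≤ a' → B ≤ a' + q' → c ≤ a' + q' → d + (c + S a' q') ≤ a' + q'
      -- Before any row is read, the first `c` letters are `0, ..., c - 1`, all below the threshold.
      lower-bound f nil a' q' _ _ c≤ = subst₂ _≤_ (Np.+-comm _ c) (cong (_+ (a' + q')) S0≡0) (S-mono 0 c a' q' z≤n c≤)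
        where
        S0≡0 : S 0 c ≡ 0
        S0≡0 = Np.n≤0⇒n≡0 (Np.+-cancelˡ-≤ c _ _ (subst (c + S 0 c ≤_) (sym (Np.+-identityʳ c)) (count-start-upper c 0 m c Np.≤-refl)))
      lower-bound {d = suc d} f (snoc a q ch p c≤ a<A aq<B) a' q' A≤ B≤ _ = Np.+-cancelʳ-≤ (suc a + q) _ _ (begin
        suc d + (c + S a' q') + (suc a + q)   ≡⟨ l1 d c (S a' q') (suc a + q) ⟩
        suc (d + c) + (S a' q' + (suc a + q)) ≤⟨ Np.+-monoʳ-≤ (suc (d + c)) (S-mono (suc a) q a' q' (Np.≤-trans a<A A≤) (Np.≤-trans aq<B B≤)) ⟩
        suc (d + c) + (S (suc a) q + (a' + q')) ≡⟨ cong (λ z → suc (d + c) + (z + (a' + q'))) (S-kept a q (f p)) ⟩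
        suc (d + c) + (S a q + (a' + q'))     ≡⟨ l2 d c (S a q) (a' + q') ⟩
        a' + q' + suc (d + (c + S a q))       ≤⟨ Np.+-monoʳ-≤ (a' + q') (s≤s (lower-bound f ch a q Np.≤-refl Np.≤-refl c≤)) ⟩
        a' + q' + (suc a + q) ∎)
        where
        open Np.≤-Reasoning
        l1 : ∀ d c s r → suc d + (c + s) + r ≡ suc (d + c) + (s + r)
        l1 = solve-∀
        l2 : ∀ d c s r → suc (d + c) + (s + r) ≡ r + suc (d + (c + s))
        l2 = solve-∀

      module _ (trivial : ∀ a q → a + q < suc K → q ≤ suc m → q ≡ 0 ⊎ rowLength a < q → e a (a + (k + q)) ≡ true) where

        Extraction : ℕ → ℕ → ℕ → Set
        Extraction a q d = d + (c + S a q) ≤ a + q → q ≤ suc m → a + q ≤ suc K → Cells k c (λ a b → e a b ≡ true) d a (a + q)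

        extract-kept : ∀ a q d → Extraction a q d → e a (a + (k + q)) ≡ true → Extraction (suc a) q (suc d)
        extract-kept a q d previous p (s≤s le) q≤ lt = snoc a q (previous le' q≤ (Np.<⇒≤ lt)) p
            (Np.≤-trans (Np.≤-trans (Np.m≤m+n c _) (Np.m≤n+m _ d)) le') Np.≤-refl Np.≤-refl
          where le' = subst (λ z → d + (c + z) ≤ a + q) (S-kept a q p) le

        -- Backtracking through the recursion. A present cell is appended to a chain found in the
        -- rows before it; at an absent cell the minimum decides whether to continue one column to
        -- the left or one row up in the same column.
        extract-row : ∀ a → (∀ q d → Extraction a q d) → ∀ q d → Extraction (suc a) q d
        extract-row a previous q zero _ _ _ = nil
        extract-row a previous zero (suc d) le q≤ lt = extract-kept a zero d (previous zero d) (trivial a zero lt z≤n (inj₁ refl)) le q≤ lt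
        extract-row a previous (suc j) (suc d) le q≤ lt with suc j ≤? rowLength a
        ... | no nle = extract-kept a (suc j) d (previous (suc j) d) (trivial a (suc j) lt q≤ (inj₂ (Np.≰⇒> nle))) le q≤ lt
        ... | yes j<L with letters e a j in p
        ...   | true = extract-kept a (suc j) d (previous (suc j) d) p le q≤ lt
        ...   | false with Np.⊓-sel (suc (S (suc a) j)) (S a (suc (suc j)))
        ...     | inj₁ eq = cells-weaken Np.≤-refl (Np.+-monoʳ-≤ (suc a) (Np.n≤1+n j))
                  (extract-row a previous j (suc d) (Np.≤-pred (subst₂ _≤_ (l1 d c (S (suc a) j)) (Np.+-suc (suc a) j)
                    (subst (λ z → suc d + (c + z) ≤ suc a + suc j) (trans (S-absent a j j<L p) eq) le)))
                    (Np.<⇒≤ q≤) (Np.≤-trans (Np.+-monoʳ-≤ (suc a) (Np.n≤1+n j)) lt))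
          where
          l1 : ∀ d c s → suc d + (c + suc s) ≡ suc (suc d + (c + s))
          l1 = solve-∀
        ...     | inj₂ eq = cells-weaken (Np.n≤1+n a) (Np.≤-reflexive (Np.+-suc a (suc j)))
                  (previous (suc (suc j)) (suc d) (subst₂ (λ z r → suc d + (c + z) ≤ r) (trans (S-absent a j j<L p) eq) (sym (Np.+-suc a (suc j))) le)
                    (s≤s (Np.≤-trans j<L (rowLength≤m a))) (Np.≤-trans (Np.≤-reflexive (Np.+-suc a (suc j))) lt))

        extract : ∀ a q d → Extraction a q d
        extract zero q zero _ _ _ = nil
        extract zero q (suc d) le q≤ _ = ⊥-elim (Np.<-irrefl refl (Np.≤-trans le (Np.≤-trans (count-start-lower c 0 m q z≤n q≤) (Np.m≤n+m _ d))))
        extract (suc a) = extract-row a (extract a)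

    -- Rows from `k + c` on have at most `m - c` letters and do not reach the partial sum at
    -- `suc m - c`. So the test at threshold `c` is decided by the rows before `k + c`.
    frozen : ∀ e c r → c ≤ m → S e c (r + (k + c)) (suc m ∸ c) ≡ S e c (k + c) (suc m ∸ c)
    frozen e c zero _ = refl
    frozen e c (suc r) c≤m = trans (S-beyond e c (r + (k + c)) (suc m ∸ c) short) (frozen e c r c≤m)
      where
      short : rowLength (r + (k + c)) < suc m ∸ c
      short = subst (rowLength (r + (k + c)) <_) (sym (Np.+-∸-assoc 1 c≤m)) (s≤s (Np.≤-trans (Np.m⊓n≤n m _)
        (Np.≤-trans (Np.∸-monoʳ-≤ K (Np.m≤n+m (k + c) r)) (Np.≤-reflexive (Np.[m+n]∸[m+o]≡n∸o k m c)))))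

    -- The region tested at threshold `c` is a rectangle: rows before `k + c`, columns from `k + c`
    -- to the last vertex. Increasing chains inside it consist of mutually crossing diagonals.
    corner : ∀ c → c ≤ m → (k + c) + (suc m ∸ c) ≡ suc K
    corner c c≤m = trans (Np.+-assoc k c _) (trans (cong (k +_) (Np.m+[n∸m]≡n (Np.m≤n⇒m≤1+n c≤m))) (Np.+-suc k m))

    module _ (n : ℕ) (big : ∀ c → c ≤ m → k + c ≤ n) (e : ℕ → ℕ → Bool) where

      final-S : ∀ c → c ≤ m → S e c n (suc m ∸ c) ≡ S e c (k + c) (suc m ∸ c)
      final-S c c≤m with Np.m≤n⇒∃[o]m+o≡n (big c c≤m)
      ... | r , refl = subst (λ z → S e c z (suc m ∸ c) ≡ S e c (k + c) (suc m ∸ c)) (Np.+-comm r (k + c)) (frozen e c r c≤m)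

      unsorted⇒cells : (∀ a q → a + q < suc K → q ≤ suc m → q ≡ 0 ⊎ rowLength a < q → e a (a + (k + q)) ≡ true) →
        state e n ≢ target 0 m → Σ ℕ λ c → c ≤ m × Cells k c (λ a b → e a b ≡ true) (suc k) (k + c) (suc K)
      unsorted⇒cells trivial ne with deficient (suc m) (state e n) (state-length e n)
      ... | inj₁ ps = ⊥-elim (ne (trans (dominating-equal ps (trans (state-sum e n) (cong sum (target≡downFrom m)))) (sym (target≡downFrom m))))
      ... | inj₂ (c , s≤s c≤m , lt) = c , c≤m , subst (Cells k c (λ a b → e a b ≡ true) (suc k) (k + c)) (corner c c≤m)
            (extract e c trivial (k + c) (suc m ∸ c) (suc k) enough (Np.m∸n≤m (suc m) c) (Np.≤-reflexive (corner c c≤m)))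
        where
        enough : suc k + (c + S e c (k + c) (suc m ∸ c)) ≤ (k + c) + (suc m ∸ c)
        enough = subst (_≤ (k + c) + (suc m ∸ c)) (l1 k c (S e c (k + c) (suc m ∸ c)))
          (Np.+-monoʳ-≤ (k + c) (subst (_< suc m ∸ c) (final-S c c≤m) lt))
          where
          l1 : ∀ k c s → (k + c) + suc s ≡ suc k + (c + s)
          l1 = solve-∀

      cells⇒unsorted : ∀ {P c} → (∀ {a b} → P a b → e a b ≡ true) → c ≤ m → Cells k c P (suc k) (k + c) (suc K) → state e n ≢ target 0 m
      cells⇒unsorted {c = c} f c≤m ch sorted = Np.<-irrefl (trans (sym (final-S c c≤m)) full) few
        where
        full : S e c n (suc m ∸ c) ≡ suc m ∸ c
        full = trans (cong (λ w → count c w (suc m ∸ c)) (trans sorted (target≡downFrom m))) (count-downFrom c (suc m) (Np.m≤n⇒m≤1+n c≤m))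
        few : S e c (k + c) (suc m ∸ c) < suc m ∸ c
        few = Np.+-cancelˡ-≤ (k + c) _ _ (subst (_≤ (k + c) + (suc m ∸ c)) (sym (l1 k c (S e c (k + c) (suc m ∸ c))))
          (lower-bound e c f ch (k + c) (suc m ∸ c) Np.≤-refl (Np.≤-reflexive (sym (corner c c≤m)))
            (Np.≤-trans (Np.m≤n+m c k) (Np.m≤m+n (k + c) _))))
          where
          l1 : ∀ k c s → (k + c) + suc s ≡ suc k + (c + s)
          l1 = solve-∀

-- Crossings as chains, and k-triangulations as reduced sorting processes.

module KCrossings where
  open import Defs hiding (take; N; E)
  open Sums
  open Comparison using (start; target)
  open PathChains using (ind; choose; choose-yes; choose-no)
  open Sorting
  open import Data.List using (length)
  open import Data.Fin using (Fin; zero; suc; toℕ; fromℕ<)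
  open import Data.List.Relation.Unary.All as All using (All; []; _∷_)
  open import Data.List.Relation.Unary.AllPairs using (AllPairs; []; _∷_)

  lookupℕ : ∀ {n} → A → Vec A n → ℕ → A
  lookupℕ d [] i = d
  lookupℕ d (x ∷ v) zero = x
  lookupℕ d (x ∷ v) (suc i) = lookupℕ d v i

  lookupℕ-toℕ : ∀ {n} (d : A) (v : Vec A n) i → lookupℕ d v (toℕ i) ≡ Vec.lookup v i
  lookupℕ-toℕ d (x ∷ v) zero = refl
  lookupℕ-toℕ d (x ∷ v) (suc i) = lookupℕ-toℕ d v i

  lookupℕ-beyond : ∀ {n} (d : A) (v : Vec A n) i → n ≤ i → lookupℕ d v i ≡ d
  lookupℕ-beyond d [] i _ = refl
  lookupℕ-beyond d (x ∷ v) (suc i) (s≤s p) = lookupℕ-beyond d v i p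

  -- Total on natural numbers, as the sorting process demands; positions outside the polygon read as
  -- absent.
  entry : ∀ {n} → DiagSet n → ℕ → ℕ → Bool
  entry {n} D a b = lookupℕ false (lookupℕ (Vec.replicate n false) D a) b

  entry-toℕ : ∀ {n} (D : DiagSet n) i j → entry D (toℕ i) (toℕ j) ≡ Vec.lookup (Vec.lookup D i) j
  entry-toℕ {n} D i j = trans (cong (λ r → lookupℕ false r (toℕ j)) (lookupℕ-toℕ (Vec.replicate n false) D i)) (lookupℕ-toℕ false (Vec.lookup D i) j)

  lookupℕ-replicate : ∀ n i → lookupℕ false (Vec.replicate n false) i ≡ false
  lookupℕ-replicate zero i = refl
  lookupℕ-replicate (suc n) zero = refl
  lookupℕ-replicate (suc n) (suc i) = lookupℕ-replicate n i

  Located : ∀ {n} → (Fin n → Fin n → Set) → ℕ → ℕ → Set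
  Located {n} S a b = Σ (Fin n) λ i → Σ (Fin n) λ j → toℕ i ≡ a × toℕ j ≡ b × S i j

  entry⇒located : ∀ {n} (D : DiagSet n) {a b} → entry D a b ≡ true → Located (In D) a b
  entry⇒located {n} D {a} {b} e with a <? n | b <? n
  ... | yes p | yes q = fromℕ< p , fromℕ< q , Fp.toℕ-fromℕ< p , Fp.toℕ-fromℕ< q ,
    trans (sym (entry-toℕ D _ _)) (trans (cong₂ (entry D) (Fp.toℕ-fromℕ< p) (Fp.toℕ-fromℕ< q)) e)
  ... | no p | _ with () ← trans (sym e) (trans (cong (λ r → lookupℕ false r b) (lookupℕ-beyond (Vec.replicate n false) D a (Np.≮⇒≥ p))) (lookupℕ-replicate n b))
  ... | yes _ | no q with () ← trans (sym e) (lookupℕ-beyond false (lookupℕ (Vec.replicate n false) D a) b (Np.≮⇒≥ q))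

  Diagonal : ℕ → Set
  Diagonal n = Fin n × Fin n

  lower upper : ∀ {n} → Diagonal n → ℕ
  lower x = toℕ (proj₁ x)
  upper x = toℕ (proj₂ x)

  -- One of the two alternatives in `Cross`; mutually crossing diagonals are linearly ordered by it.
  _≻_ : ∀ {n} → Diagonal n → Diagonal n → Set
  x ≻ y = lower y < lower x × lower x < upper y × upper y < upper x

  module _ {n : ℕ} where
    -- The last component expresses that nothing but `x` and members of `L` occurs in the result,
    -- without mentioning permutations.
    insert : (x : Diagonal n) (L : List (Diagonal n)) → AllPairs _≻_ L → All (Cross x) L →
      Σ (List (Diagonal n)) λ L' → length L' ≡ suc (length L) × AllPairs _≻_ L' × (∀ {P : Diagonal n → Set} → P x → All P L → All P L')
    insert x [] _ _ = x ∷ [] , refl , [] ∷ [] , λ p _ → p ∷ []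
    insert x (h ∷ L) (h≻ ∷ s) (inj₂ x≻h ∷ cr) = x ∷ h ∷ L , refl , (x≻h ∷ All.zipWith dominate (h≻ , cr)) ∷ (h≻ ∷ s) , λ p ps → p ∷ ps
      where
      dominate : ∀ {l} → h ≻ l × Cross x l → x ≻ l
      dominate (h≻l , inj₂ x≻l) = x≻l
      dominate (h≻l , inj₁ l≻x) = ⊥-elim (Np.<-asym (Np.<-trans (proj₁ l≻x) (proj₁ h≻l)) (proj₁ x≻h))
    insert x (h ∷ L) (h≻ ∷ s) (inj₁ h≻x ∷ cr) with insert x L s cr
    ... | L' , len , s' , all = h ∷ L' , cong suc len , all h≻x h≻ ∷ s' , λ { p (q ∷ qs) → q ∷ all p qs }

    sorted-crossing : ∀ {S : Diagonal n → Set} d (f : Fin d → Diagonal n) → (∀ i → S (f i)) → (∀ i j → i ≢ j → Cross (f i) (f j)) →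
      Σ (List (Diagonal n)) λ L → length L ≡ d × AllPairs _≻_ L × All S L
        × (∀ {P : Diagonal n → Set} → (∀ i → P (f i)) → All P L)
    sorted-crossing zero f s c = [] , refl , [] , [] , λ _ → []
    sorted-crossing (suc d) f s c with sorted-crossing d (f ∘ suc) (s ∘ suc) (λ i j ne → c (suc i) (suc j) (ne ∘ Fp.suc-injective))
    ... | L , len , so , al , all with insert (f zero) L so (all (λ i → c zero (suc i) (λ ())))
    ...   | L' , len' , so' , all' = L' , trans len' (cong suc len) , so' , all' (s zero) al , λ p → all' (p zero) (all (p ∘ suc))

    lastUpper : Diagonal n → List (Diagonal n) → ℕ
    lastUpper x [] = upper x
    lastUpper x (y ∷ L) = lastUpper y L

    lastUpper-≤ : ∀ x L → AllPairs _≻_ (x ∷ L) → lastUpper x L + length L ≤ upper x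
    lastUpper-≤ x [] _ = Np.≤-reflexive (Np.+-identityʳ _)
    lastUpper-≤ x (y ∷ L) ((x≻y ∷ _) ∷ s) = subst (_≤ upper x) (sym (Np.+-suc _ _)) (Np.≤-trans (s≤s (lastUpper-≤ y L s)) (proj₂ (proj₂ x≻y)))

    length-≤-lower : ∀ (x : Diagonal n) L → AllPairs _≻_ (x ∷ L) → length L ≤ lower x
    length-≤-lower x [] _ = z≤n
    length-≤-lower x (y ∷ L) ((x≻y ∷ _) ∷ s) = Np.≤-trans (s≤s (length-≤-lower y L s)) (proj₁ x≻y)

    lower<lastUpper : ∀ x y L → All (x ≻_) (y ∷ L) → lower x < lastUpper y L
    lower<lastUpper x y [] (p ∷ _) = proj₁ (proj₂ p)
    lower<lastUpper x y (z ∷ L) (_ ∷ ps) = lower<lastUpper x z L ps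

  module Crossings (k m n : ℕ) (nEq : n ≡ suc (k + (k + m))) (1≤k : 1 ≤ k) where
    open Run k m

    Nontrivial : ℕ → ℕ → Set
    Nontrivial a b = a + k < b × b + k < a + n

    nontrivial? : ∀ a b → Dec (Nontrivial a b)
    nontrivial? a b = (a + k <? b) ×-dec (b + k <? a + n)
      where open import Relation.Nullary.Decidable using (_×-dec_)

    -- The number `r` counts the larger diagonals already removed. The ends of the `r` larger and
    -- `length L` smaller diagonals separate the ends of `x` on both sides by more than
    -- `k = r + length L` steps, so every member of a crossing is nontrivial.
    toCells : ∀ {S : Fin n → Fin n → Set} x (L : List (Diagonal n)) r {A B c} → AllPairs _≻_ (x ∷ L) → All (λ y → S (proj₁ y) (proj₂ y)) (x ∷ L) →
      r + length L ≡ k → lower x + r < lastUpper x L → upper x + r < n → c + k ≤ lastUpper x L → lower x < A → upper x < k + B →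
      Cells k c (λ a b → Located S a b × Nontrivial a b) (suc (length L)) A B
    toCells {S} x L r {A} {B} {c} so@(x≻ ∷ so') (sx ∷ sL) len a+r b+r c+k a<A b<B =
      snoc (lower x) q deeper ((proj₁ x , proj₂ x , refl , sym b≡ , sx) , subst (lower x + k <_) (sym b≡) a+k<b , subst (λ z → z + k < lower x + n) (sym b≡) b+k<)
        c≤ a<A (Np.+-cancelˡ-< k _ _ (subst (_< k + B) b≡' b<B))
      where
      last≤ : lastUpper x L + length L ≤ upper x
      last≤ = lastUpper-≤ x L so
      a+k<b : lower x + k < upper x
      a+k<b = subst (λ z → lower x + z < upper x) len (subst (_< upper x) (Np.+-assoc (lower x) r _)
        (Np.<-≤-trans (Np.+-monoˡ-< (length L) a+r) last≤))
      b+k< : upper x + k < lower x + n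
      b+k< = subst (λ z → upper x + z < lower x + n) len (subst₂ _<_ (Np.+-assoc (upper x) r _) (Np.+-comm n (lower x))
        (Np.+-mono-<-≤ b+r (length-≤-lower x L so)))
      q : ℕ
      q = upper x ∸ (lower x + k)
      b≡ : lower x + (k + q) ≡ upper x
      b≡ = trans (sym (Np.+-assoc (lower x) k q)) (Np.m+[n∸m]≡n (Np.<⇒≤ a+k<b))
      l1 : ∀ a k q → a + (k + q) ≡ k + (a + q)
      l1 = solve-∀
      b≡' : upper x ≡ k + (lower x + q)
      b≡' = trans (sym b≡) (l1 (lower x) k q)
      c≤ : c ≤ lower x + q
      c≤ = Np.+-cancelˡ-≤ k _ _ (subst₂ _≤_ (Np.+-comm c k) b≡' (Np.≤-trans c+k (Np.≤-trans (Np.m≤m+n _ (length L)) last≤)))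
      deeper : Cells k c (λ a b → Located S a b × Nontrivial a b) (length L) (lower x) (lower x + q)
      deeper = go L x≻ so' sL len a+r c+k
        where
        go : ∀ L → All (x ≻_) L → AllPairs _≻_ L → All (λ y → S (proj₁ y) (proj₂ y)) L → r + length L ≡ k → lower x + r < lastUpper x L → c + k ≤ lastUpper x L →
          Cells k c (λ a b → Located S a b × Nontrivial a b) (length L) (lower x) (lower x + q)
        go [] _ _ _ _ _ _ = nil
        go (y ∷ L) (x≻y ∷ _) so sL len a+r c+k = toCells y L (suc r) so sL (trans (sym (Np.+-suc r (length L))) len)
          (Np.≤-<-trans (subst (_≤ lower x + r) (sym (Np.+-suc (lower y) r)) (Np.+-monoˡ-≤ r (proj₁ x≻y))) a+r)
          (Np.≤-<-trans (subst (_≤ upper x + r) (sym (Np.+-suc (upper y) r)) (Np.+-monoˡ-≤ r (proj₂ (proj₂ x≻y)))) b+r)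
          c+k (proj₁ x≻y) (subst (upper y <_) b≡' (proj₂ (proj₂ x≻y)))

    crossing⇒cells : ∀ {S : Fin n → Fin n → Set} → HasCrossing k S →
      Σ ℕ λ c → c ≤ m × Cells k c (λ a b → Located S a b × Nontrivial a b) (suc k) (k + c) (suc K)
    crossing⇒cells {S} (f , s , cr) with sorted-crossing {S = λ x → S (proj₁ x) (proj₂ x)} (suc k) f s cr
    ... | x ∷ [] , len , _ = ⊥-elim (Np.<-irrefl (Np.suc-injective len) 1≤k)
    ... | x ∷ y ∷ L , len , so@(x≻ ∷ _) , al , _ = c , c≤m ,
        subst (λ d → Cells k c (λ a b → Located S a b × Nontrivial a b) d (k + c) (suc K)) len
          (toCells x (y ∷ L) 0 so al len' (subst (_< last) (sym (Np.+-identityʳ _)) x<last)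
            (subst (_< n) (sym (Np.+-identityʳ _)) (Fp.toℕ<n (proj₂ x)))
            (Np.≤-reflexive (trans (Np.+-comm c k) k+c≡)) (subst (lower x <_) (sym k+c≡) x<last)
            (subst (upper x <_) (trans nEq (sym (Np.+-suc k K))) (Fp.toℕ<n (proj₂ x))))
      where
      last = lastUpper y L
      len' : length (y ∷ L) ≡ k
      len' = Np.suc-injective len
      x<last : lower x < last
      x<last = lower<lastUpper x y L x≻
      k≤last : k ≤ last
      k≤last = Np.≤-trans (Np.≤-trans (Np.≤-reflexive (sym len')) (length-≤-lower x (y ∷ L) so)) (Np.<⇒≤ x<last)
      -- The smallest upper end `k + c` lies above all lower ends, so it is the line separating rows
      -- from columns.
      c = last ∸ k
      k+c≡ : k + c ≡ last
      k+c≡ = Np.m+[n∸m]≡n k≤last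
      c≤m : c ≤ m
      c≤m = Np.+-cancelˡ-≤ (k + k) _ _ (Np.≤-pred (begin
        suc (k + k + c)          ≡⟨ l1 k c ⟩
        suc (k + c + k)          ≡⟨ cong₂ (λ a b → suc (a + b)) k+c≡ (sym len') ⟩
        suc (last + length (y ∷ L)) ≤⟨ s≤s (lastUpper-≤ x (y ∷ L) so) ⟩
        suc (upper x)            ≤⟨ Fp.toℕ<n (proj₂ x) ⟩
        n                        ≡⟨ trans nEq (cong suc (sym (Np.+-assoc k k m))) ⟩
        suc (k + k + m) ∎))
        where
        open Np.≤-Reasoning
        l1 : ∀ k c → 1 + (k + k + c) ≡ 1 + (k + c + k)
        l1 = solve-∀

    -- All lower ends are before `k + c` and all upper ends are not, so two diagonals that increase
    -- in both ends must cross.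
    cells⇒crossing : ∀ {S : Fin n → Fin n → Set} {c B d} → Cells k c (Located S) d (k + c) B →
      Σ (Fin d → Diagonal n) λ f → (∀ i → S (proj₁ (f i)) (proj₂ (f i))) × (∀ i j → i ≢ j → Cross (f i) (f j))
    cells⇒crossing {S} {c} ch = let f , s , cr , _ = go ch Np.≤-refl in f , s , cr
      where
      go : ∀ {d A B} → Cells k c (Located S) d A B → A ≤ k + c →
        Σ (Fin d → Diagonal n) λ f → (∀ i → S (proj₁ (f i)) (proj₂ (f i))) × (∀ i j → i ≢ j → Cross (f i) (f j))
          × (∀ i → lower (f i) < A × k + c ≤ upper (f i) × upper (f i) < k + B)
      go nil _ = (λ ()) , (λ ()) , (λ ()) , λ ()
      go {suc d} {A} {B} (snoc a q ch (i₀ , j₀ , ea , eb , s₀) c≤ a<A aq<B) A≤ with go ch (Np.≤-trans (Np.<⇒≤ a<A) A≤)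
      ... | f , s , cr , bd = f' , s' , cr' , bd'
        where
        l1 : ∀ a k q → a + (k + q) ≡ k + (a + q)
        l1 = solve-∀
        eb' : toℕ j₀ ≡ k + (a + q)
        eb' = trans eb (l1 a k q)
        f' : Fin (suc d) → Diagonal n
        f' zero = i₀ , j₀
        f' (suc i) = f i
        s' : ∀ i → S (proj₁ (f' i)) (proj₂ (f' i))
        s' zero = s₀
        s' (suc i) = s i
        dom : ∀ i → (i₀ , j₀) ≻ f i
        dom i with bd i
        ... | la , lu , ub = subst (lower (f i) <_) (sym ea) la ,
          subst (_< upper (f i)) (sym ea) (Np.<-≤-trans (Np.<-≤-trans a<A A≤) lu) , subst (upper (f i) <_) (sym eb') ub
        cr' : ∀ i j → i ≢ j → Cross (f' i) (f' j)
        cr' zero zero ne = ⊥-elim (ne refl)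
        cr' zero (suc j) _ = inj₂ (dom j)
        cr' (suc i) zero _ = inj₁ (dom i)
        cr' (suc i) (suc j) ne = cr i j (ne ∘ cong suc)
        bd' : ∀ i → lower (f' i) < A × k + c ≤ upper (f' i) × upper (f' i) < k + B
        bd' zero = subst (_< A) (sym ea) a<A , subst (k + c ≤_) (sym eb') (Np.+-monoʳ-≤ k c≤) , subst (_< k + B) (sym eb') (Np.+-monoʳ-< k aq<B)
        bd' (suc i) with bd i
        ... | la , lu , ub = Np.<-trans la a<A , lu , Np.<-trans ub (Np.+-monoʳ-< k aq<B)

    Full : (ℕ → ℕ → Bool) → Set
    Full e = ∀ a b → a < b → b < n → ¬ Nontrivial a b → e a b ≡ true

    big : ∀ c → c ≤ m → k + c ≤ n
    big c c≤m = subst (k + c ≤_) (sym nEq) (Np.m≤n⇒m≤1+n (Np.+-monoʳ-≤ k (Np.≤-trans c≤m (Np.m≤n+m m k))))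

    unsorted⇒crossing : ∀ {e} {S : Fin n → Fin n → Set} → Full e → (∀ {a b} → e a b ≡ true → Located S a b) →
      state e n ≢ target 0 m → HasCrossing k S
    unsorted⇒crossing {e} full loc ne with unsorted⇒cells n big e trivial ne
      where
      trivial : ∀ a q → a + q < suc K → q ≤ suc m → q ≡ 0 ⊎ rowLength a < q → e a (a + (k + q)) ≡ true
      trivial a q lt q≤ why = full a (a + (k + q)) (Np.m<m+n a (Np.≤-trans 1≤k (Np.m≤m+n k q)))
        (subst₂ _<_ (l1 k a q) (trans (Np.+-suc k K) (sym nEq)) (Np.+-monoʳ-< k lt)) (notNontrivial why)
        where
        l1 : ∀ k a q → k + (a + q) ≡ a + (k + q)
        l1 = solve-∀
        notNontrivial : q ≡ 0 ⊎ rowLength a < q → ¬ Nontrivial a (a + (k + q))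
        notNontrivial (inj₁ refl) (p , _) = Np.<-irrefl (cong (a +_) (sym (Np.+-identityʳ k))) p
        notNontrivial (inj₂ short) (_ , p) with Np.⊓-sel m (K ∸ a)
        ... | inj₁ eq = Np.<⇒≱ (subst (_< q) eq short) (Np.+-cancelˡ-≤ (a + (k + k)) _ _ (Np.≤-pred (subst₂ _≤_ (cong suc (l2 a k q)) (trans (cong (a +_) nEq) (l3 a k m)) p)))
          where
          l2 : ∀ a k q → a + (k + q) + k ≡ a + (k + k) + q
          l2 = solve-∀
          l3 : ∀ a k m → a + (1 + (k + (k + m))) ≡ 1 + (a + (k + k) + m)
          l3 = solve-∀
        ... | inj₂ eq = Np.<⇒≱ (subst (_< q) eq short) (Np.m+n≤o⇒m≤o∸n q (subst (_≤ K) (Np.+-comm a q) (Np.≤-pred lt)))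
    ... | c , _ , ch = cells⇒crossing (cells-map loc ch)

    crossing⇒unsorted : ∀ {e} {S : Fin n → Fin n → Set} → (∀ i j → S i j → e (toℕ i) (toℕ j) ≡ true) → HasCrossing k S → state e n ≢ target 0 m
    crossing⇒unsorted {e} f cr with crossing⇒cells cr
    ... | c , c≤m , ch = cells⇒unsorted n big e (λ { ((i , j , refl , refl , s) , _) → f i j s }) c≤m ch

    Valid : (ℕ → ℕ → Bool) → Set
    Valid e = (∀ a → a < n → validRow (letters e a) (rowLength a) (state e a) ≡ true) × state e n ≡ target 0 m

    cell⇒nontrivial : ∀ a j → j < rowLength a → Nontrivial a (a + (k + suc j)) × a + (k + suc j) < n
    cell⇒nontrivial a j lt = (Np.+-monoʳ-< a (Np.m<m+n k (s≤s z≤n)) ,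
        subst₂ _<_ (l1 a k (suc j)) (trans (l2 a k m) (cong (a +_) (sym nEq))) (s≤s (Np.+-monoʳ-≤ (a + (k + k)) (Np.≤-trans lt (Np.m⊓n≤m m _))))) ,
      subst₂ _<_ (l3 a k (suc j)) (sym nEq) (s≤s (Np.+-monoʳ-≤ k (Np.≤-trans (Np.+-monoʳ-≤ a lt') (Np.≤-reflexive (Np.m+[n∸m]≡n a≤K)))))
      where
      lt' : suc j ≤ K ∸ a
      lt' = Np.≤-trans lt (Np.m⊓n≤n m _)
      a≤K : a ≤ K
      a≤K = Np.≮⇒≥ λ K<a → Np.<⇒≱ (s≤s z≤n) (subst (suc j ≤_) (Np.m≤n⇒m∸n≡0 (Np.<⇒≤ K<a)) lt')
      l1 : ∀ a k q → a + (k + k) + q ≡ a + (k + q) + k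
      l1 = solve-∀
      l2 : ∀ a k m → 1 + (a + (k + k) + m) ≡ a + (1 + (k + (k + m)))
      l2 = solve-∀
      l3 : ∀ a k q → k + (a + q) ≡ a + (k + q)
      l3 = solve-∀

    nontrivial⇒cell : ∀ a b → b < n → Nontrivial a b → Σ ℕ λ j → b ≡ a + (k + suc j) × j < rowLength a
    nontrivial⇒cell a b b<n (p , q) with Np.m≤n⇒∃[o]m+o≡n p
    ... | j , refl = j , l0 a k j , Np.⊓-glb
        (Np.+-cancelˡ-≤ (a + (k + k)) _ _ (Np.≤-pred (subst₂ _≤_ (cong suc (l1 a k j)) (trans (cong (a +_) nEq) (l2 a k m)) q)))
        (Np.m+n≤o⇒m≤o∸n (suc j) (Np.+-cancelˡ-≤ k _ _ (Np.≤-pred (subst₂ _≤_ (cong suc (l3 a k j)) nEq b<n))))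
      where
      l0 : ∀ a k j → 1 + (a + k) + j ≡ a + (k + (1 + j))
      l0 = solve-∀
      l1 : ∀ a k j → 1 + (a + k) + j + k ≡ a + (k + k) + (1 + j)
      l1 = solve-∀
      l2 : ∀ a k m → a + (1 + (k + (k + m))) ≡ 1 + (a + (k + k) + m)
      l2 = solve-∀
      l3 : ∀ a k j → 1 + (a + k) + j ≡ k + ((1 + j) + a)
      l3 = solve-∀

    add : (ℕ → ℕ → Bool) → ℕ → ℕ → ℕ → ℕ → Bool
    add e a b x y = choose (x ≟ a) (choose (y ≟ b) true (e x y)) (e x y)

    add-true : ∀ e a b {x y} → add e a b x y ≡ true → e x y ≡ true ⊎ (x ≡ a × y ≡ b)
    add-true e a b {x} {y} p with x ≟ a | y ≟ b
    ... | yes refl | yes refl = inj₂ (refl , refl)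
    ... | yes _ | no _ = inj₁ p
    ... | no _ | _ = inj₁ p

    add-old : ∀ e a b {x y} → e x y ≡ true → add e a b x y ≡ true
    add-old e a b {x} {y} p with x ≟ a | y ≟ b
    ... | yes _ | yes _ = refl
    ... | yes _ | no _ = p
    ... | no _ | _ = p

    add-new : ∀ e a b → add e a b a b ≡ true
    add-new e a b = trans (choose-yes (a ≟ a) refl) (choose-yes (b ≟ b) refl)

    add-row : ∀ e a b {x} y → x ≢ a → add e a b x y ≡ e x y
    add-row e a b {x} y ne = choose-no (x ≟ a) ne

    add-column : ∀ e a b x {y} → y ≢ b → add e a b x y ≡ e x y
    add-column e a b x {y} ne with x ≟ a
    ... | yes _ = choose-no (y ≟ b) ne
    ... | no _ = refl

    column-≢ : ∀ a {i j} → i ≢ j → a + (k + suc i) ≢ a + (k + suc j)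
    column-≢ a ne e = ne (Np.suc-injective (Np.+-cancelˡ-≡ k _ _ (Np.+-cancelˡ-≡ a _ _ e)))

    module _ (e : ℕ → ℕ → Bool) (a₀ j₀ : ℕ) (j₀< : j₀ < rowLength a₀) (absent₀ : letters e a₀ j₀ ≡ false) where
      private
        e' : ℕ → ℕ → Bool
        e' = add e a₀ (a₀ + (k + suc j₀))

      state-idle : strict j₀ (runRow (letters e a₀) j₀ (state e a₀)) ≡ false → ∀ a → state e a ≡ state e' a
      state-idle idle zero = refl
      state-idle idle (suc a) = trans (same (a ≟ a₀)) (cong (runRow (letters e' a) (rowLength a)) (state-idle idle a))
        where
        same : Dec (a ≡ a₀) → runRow (letters e a) (rowLength a) (state e a) ≡ runRow (letters e' a) (rowLength a) (state e a)
        same (yes refl) = runRow-idle (rowLength a) (state e a) j₀ j₀< absent₀ idle (add-new e a _)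
          (λ i ne → sym (add-column e a _ a (column-≢ a ne)))
        same (no ne) = runRow-cong (rowLength a) (state e a) (λ j _ → sym (add-row e a₀ _ _ ne))

      absentCells-add : ∀ N → a₀ < N → ∑ (List.downFrom N) (λ a → absent (letters e a) (rowLength a)) ≡
        suc (∑ (List.downFrom N) (λ a → absent (letters e' a) (rowLength a)))
      absentCells-add N lt = toggle N a₀ _ _ lt
        (toggle (rowLength a₀) j₀ _ _ j₀< (trans (cong (ind ∘ not) absent₀) (cong (suc ∘ ind ∘ not) (sym (add-new e a₀ _))))
          (λ j ne → cong (ind ∘ not) (sym (add-column e a₀ _ a₀ (column-≢ a₀ ne)))))
        (λ a ne → ∑-cong (List.downFrom (rowLength a)) (λ j → cong (ind ∘ not) (sym (add-row e a₀ _ _ ne))))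
        where
        toggle : ∀ N i (f g : ℕ → ℕ) → i < N → f i ≡ suc (g i) → (∀ j → j ≢ i → f j ≡ g j) →
          ∑ (List.downFrom N) f ≡ suc (∑ (List.downFrom N) g)
        toggle (suc N) i f g lt e₁ e₂ with i ≟ N
        ... | yes refl = cong₂ _+_ e₁ (∑-cong∈ (List.downFrom i) λ j j∈ → e₂ j (Np.<⇒≢ (∈-downFrom⁻ j∈)))
          where open import Data.List.Membership.Propositional.Properties using (∈-downFrom⁻)
        ... | no ne = trans (cong₂ _+_ (e₂ N (ne ∘ sym)) (toggle N i f g (Np.≤∧≢⇒< (Np.≤-pred lt) ne) e₁ e₂)) (Np.+-suc _ _)

    -- An absent letter removes at most one ascent, and exactly one in the valid case
    -- `ascents-valid`. Hence no sorting set has fewer absent diagonals than a valid one.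
    ascents-bound : ∀ e N → ascents (start 0 m) ≤ ascents (state e N) + ∑ (List.downFrom N) (λ a → absent (letters e a) (rowLength a))
    ascents-bound e zero = Np.≤-reflexive (sym (Np.+-identityʳ _))
    ascents-bound e (suc N) = Np.≤-trans (ascents-bound e N) (subst (ascents (state e N) + ∑ (List.downFrom N) (λ a → absent (letters e a) (rowLength a)) ≤_)
      (Np.+-assoc (ascents (state e (suc N))) (absent (letters e N) (rowLength N)) (∑ (List.downFrom N) (λ a → absent (letters e a) (rowLength a))))
      (Np.+-monoˡ-≤ (∑ (List.downFrom N) (λ a → absent (letters e a) (rowLength a))) (ascents-runRow (letters e N) (rowLength N) (state e N))))

    ascents-valid : ∀ e N → (∀ a → a < N → validRow (letters e a) (rowLength a) (state e a) ≡ true) →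
      ascents (state e N) + ∑ (List.downFrom N) (λ a → absent (letters e a) (rowLength a)) ≡ ascents (start 0 m)
    ascents-valid e zero _ = Np.+-identityʳ _
    ascents-valid e (suc N) v = trans (sym (Np.+-assoc (ascents (state e (suc N))) _ _))
      (trans (cong (_+ ∑ (List.downFrom N) _) (ascents-validRow (letters e N) (rowLength N) (state e N) (v N Np.≤-refl)))
        (ascents-valid e N (λ a lt → v a (Np.m<n⇒m<1+n lt))))

    validRow-intro : ∀ p l w → (∀ j → j < l → p j ≡ false → strict j (runRow p j w) ≡ true) → validRow p l w ≡ true
    validRow-intro p zero w _ = refl
    validRow-intro p (suc l) w h with p l in pl
    ... | true = cong (_∧ true) (validRow-intro p l w (λ j lt → h j (Np.m<n⇒m<1+n lt)))
    ... | false = cong₂ _∧_ (validRow-intro p l w (λ j lt → h j (Np.m<n⇒m<1+n lt))) (h l Np.≤-refl pl)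

    module _ (D : DiagSet n) where
      private
        e : ℕ → ℕ → Bool
        e = entry D

      add-located : ∀ i j {a b} → add e (toℕ i) (toℕ j) a b ≡ true → Located (Add (In D) i j) a b
      add-located i j {a} {b} p with add-true e (toℕ i) (toℕ j) {a} {b} p
      ... | inj₂ (refl , refl) = i , j , refl , refl , inj₂ (refl , refl)
      ... | inj₁ q with entry⇒located D {a} {b} q
      ...   | x , y , ex , ey , s = x , y , ex , ey , inj₁ s

      located-add : ∀ i j x y → Add (In D) i j x y → add e (toℕ i) (toℕ j) (toℕ x) (toℕ y) ≡ true
      located-add i j x y (inj₁ s) = add-old e _ _ (trans (entry-toℕ D x y) s)
      located-add i j .i .j (inj₂ (refl , refl)) = add-new e (toℕ i) (toℕ j)

      -- Maximality is a count: if `D` with one more nontrivial diagonal still sorted the word, it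
      -- would do so with one absent letter fewer than there are ascents. So it does not sort, and a
      -- crossing arises.
      valid⇒triangulation : Canonical D → Full e → Valid e → IsKTriangulation n k D
      valid⇒triangulation can full (valid , sorted) = can ,
        (λ cr → crossing⇒unsorted (λ i j s → trans (entry-toℕ D i j) s) cr sorted) , maximal
        where
        maximal : ∀ i j → toℕ i < toℕ j → ¬ In D i j → HasCrossing k (Add (In D) i j)
        maximal i j i<j ∉D with nontrivial? (toℕ i) (toℕ j)
        ... | no triv = ⊥-elim (∉D (trans (sym (entry-toℕ D i j)) (full _ _ i<j (Fp.toℕ<n j) triv)))
        ... | yes nt with nontrivial⇒cell (toℕ i) (toℕ j) (Fp.toℕ<n j) nt
        ...   | j₀ , j≡ , j₀< = unsorted⇒crossing (λ a b p q t → add-old e _ _ (full a b p q t)) (add-located i j) unsorted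
          where
          absent₀ : letters e (toℕ i) j₀ ≡ false
          absent₀ with entry D (toℕ i) (toℕ i + (k + suc j₀)) in eq
          ... | false = refl
          ... | true = ⊥-elim (∉D (trans (sym (entry-toℕ D i j)) (trans (cong (entry D (toℕ i)) j≡) eq)))
          unsorted : state (add e (toℕ i) (toℕ j)) n ≢ target 0 m
          unsorted s' = Np.<-irrefl refl (begin-strict
            ascents (start 0 m)                   ≤⟨ ascents-bound e' n ⟩
            ascents (state e' n) + Abs e'         ≡⟨ cong (λ w → ascents w + Abs e') (trans (subst (λ b → state (add e (toℕ i) b) n ≡ target 0 m) j≡ s') (sym sorted)) ⟩
            ascents (state e n) + Abs e'          <⟨ Np.+-monoʳ-< (ascents (state e n)) (Np.≤-reflexive (sym (absentCells-add e (toℕ i) j₀ j₀< absent₀ n (Fp.toℕ<n i)))) ⟩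
            ascents (state e n) + Abs e           ≡⟨ ascents-valid e n valid ⟩
            ascents (start 0 m) ∎)
            where
            open Np.≤-Reasoning hiding (start)
            e' = add e (toℕ i) (toℕ i + (k + suc j₀))
            Abs : (ℕ → ℕ → Bool) → ℕ
            Abs e = ∑ (List.downFrom n) (λ a → absent (letters e a) (rowLength a))

      module _ (tri : IsKTriangulation n k D) where
        private
          can : Canonical D
          can = proj₁ tri
          free : ¬ HasCrossing k (In D)
          free = proj₁ (proj₂ tri)
          maximal : ∀ i j → toℕ i < toℕ j → ¬ In D i j → HasCrossing k (Add (In D) i j)
          maximal = proj₂ (proj₂ tri)

        -- A missing trivial diagonal would create a crossing when added. But a crossing consists of
        -- nontrivial diagonals, so it would already lie in `D`.
        triangulation⇒full : Full e
        triangulation⇒full a b a<b b<n triv with entry D a b in eq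
        ... | true = refl
        ... | false = ⊥-elim (free (cells⇒crossing (cells-map old (proj₂ (proj₂ (crossing⇒cells (maximal i j
                (subst₂ _<_ (sym ea) (sym eb) a<b) ∉D)))))))
          where
          i j : Fin n
          i = fromℕ< (Np.<-trans a<b b<n)
          j = fromℕ< b<n
          ea : toℕ i ≡ a
          ea = Fp.toℕ-fromℕ< _
          eb : toℕ j ≡ b
          eb = Fp.toℕ-fromℕ< _
          ∉D : ¬ In D i j
          ∉D s with () ← trans (sym (trans (entry-toℕ D i j) s)) (trans (cong₂ (entry D) ea eb) eq)
          old : ∀ {x y} → Located (Add (In D) i j) x y × Nontrivial x y → Located (In D) x y
          old ((x , y , ex , ey , inj₁ s) , _) = x , y , ex , ey , s
          old ((x , y , refl , refl , inj₂ (refl , refl)) , nt) = ⊥-elim (triv (subst₂ Nontrivial ea eb nt))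

        triangulation⇒sorted : state e n ≡ target 0 m
        triangulation⇒sorted with Lp.≡-dec _≟_ (state e n) (target 0 m)
        ... | yes eq = eq
        ... | no ne = ⊥-elim (free (unsorted⇒crossing triangulation⇒full (entry⇒located D) ne))

        -- If an absent letter had no effect, its diagonal could be added without changing any
        -- state; the word would still be sorted, against maximality.
        triangulation⇒strict : ∀ a → a < n → ∀ j → j < rowLength a → letters e a j ≡ false → strict j (runRow (letters e a) j (state e a)) ≡ true
        triangulation⇒strict a a<n j j< abs with strict j (runRow (letters e a) j (state e a)) in st
        ... | true = refl
        ... | false = ⊥-elim (crossing⇒unsorted {add e (toℕ x) (toℕ y)} (located-add x y)
                (maximal x y (subst₂ _<_ (sym ex) (sym ey) (Np.<-≤-trans (Np.m<m+n a 1≤k) (Np.<⇒≤ (proj₁ (proj₁ nt))))) ∉D)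
                (subst₂ (λ p q → state (add e p q) n ≡ target 0 m) (sym ex) (sym ey)
                  (trans (sym (state-idle e a j j< abs st n)) triangulation⇒sorted)))
          where
          nt : Nontrivial a (a + (k + suc j)) × a + (k + suc j) < n
          nt = cell⇒nontrivial a j j<
          x y : Fin n
          x = fromℕ< a<n
          y = fromℕ< (proj₂ nt)
          ex : toℕ x ≡ a
          ex = Fp.toℕ-fromℕ< _
          ey : toℕ y ≡ a + (k + suc j)
          ey = Fp.toℕ-fromℕ< _
          ∉D : ¬ In D x y
          ∉D s with () ← trans (sym (trans (entry-toℕ D x y) s)) (trans (cong₂ (entry D) ex ey) abs)

        triangulation⇒valid : Valid e
        triangulation⇒valid = (λ a a<n → validRow-intro (letters e a) (rowLength a) (state e a) (triangulation⇒strict a a<n)) , triangulation⇒sorted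

-- Enumerating k-triangulations row by row.

module Triangulations where
  open import Defs hiding (take; N; E)
  open Sums
  open PathTransfer using (when)
  open NilCoxeter
  open Comparison using (Word; start; target; indicator; foldr-row-cong; module PipeOperators)
  open Coefficients using (monomial)
  open PathChains using (ind; choose; choose-yes; choose-no; unique-map)
  open PathTuples using (<⇒<ᵇ≡true; ∑-upTo; ∑-filter; module Exponents)
  open Sorting
  open KCrossings
  open import Data.Fin using (Fin; zero; suc; toℕ; fromℕ<)
  open import Data.List.Membership.Propositional using (_∈_)
  open import Data.List.Membership.Propositional.Properties using (∈-downFrom⁻; ∈-filter⁺; ∈-filter⁻; ∈-map⁺; ∈-map⁻; ∈-cartesianProductWith⁺; ∈-cartesianProductWith⁻)
  open import Data.List.Relation.Unary.Any using (here; there)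
  open import Data.List.Relation.Unary.All as All using (All; []; _∷_)
  open import Data.List.Relation.Unary.AllPairs using ([]; _∷_)
  open import Data.List.Relation.Unary.Unique.Propositional using (Unique)

  bitVecs : ∀ l → List (Vec Bool l)
  bitVecs zero = [] ∷ []
  bitVecs (suc l) = cartesianProductWith _∷_ (true ∷ false ∷ []) (bitVecs l)

  bitVecs-unique : ∀ l → Unique (bitVecs l)
  bitVecs-unique zero = [] ∷ []
  bitVecs-unique (suc l) = Uq.cartesianProductWith⁺ _∷_ Vp.∷-injective (((λ ()) ∷ []) ∷ [] ∷ []) (bitVecs-unique l)

  ∈-bitVecs : ∀ {l} (bs : Vec Bool l) → bs ∈ bitVecs l
  ∈-bitVecs [] = here refl
  ∈-bitVecs (true ∷ bs) = ∈-cartesianProductWith⁺ _∷_ {true ∷ false ∷ []} (here refl) (∈-bitVecs bs)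
  ∈-bitVecs (false ∷ bs) = ∈-cartesianProductWith⁺ _∷_ {true ∷ false ∷ []} (there (here refl)) (∈-bitVecs bs)

  -- The head of a vector of bits belongs to the last letter.
  letter : ∀ {l} → Vec Bool l → ℕ → Bool
  letter [] j = true
  letter {suc l} (b ∷ bs) j = choose (j ≟ l) b (letter bs j)

  letter-head : ∀ {l} b (bs : Vec Bool l) → letter (b ∷ bs) l ≡ b
  letter-head {l} b bs = choose-yes (l ≟ l) refl

  letter-tail : ∀ {l} b (bs : Vec Bool l) {j} → j < l → letter (b ∷ bs) j ≡ letter bs j
  letter-tail {l} b bs {j} lt = choose-no (j ≟ l) (Np.<⇒≢ lt)

  letter-beyond : ∀ {l} (bs : Vec Bool l) j → l ≤ j → letter bs j ≡ true
  letter-beyond [] j _ = refl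
  letter-beyond {suc l} (b ∷ bs) j lt = trans (choose-no (j ≟ l) (λ e → Np.<⇒≢ lt (sym e))) (letter-beyond bs j (Np.<⇒≤ lt))

  fromLetters : ∀ l → (ℕ → Bool) → Vec Bool l
  fromLetters zero p = []
  fromLetters (suc l) p = p l ∷ fromLetters l p

  letter-fromLetters : ∀ l p j → j < l → letter (fromLetters l p) j ≡ p j
  letter-fromLetters (suc l) p j lt with j ≟ l
  ... | yes refl = refl
  ... | no ne = letter-fromLetters l p j (Np.≤∧≢⇒< (Np.≤-pred lt) ne)

  letter-injective : ∀ {l} (bs cs : Vec Bool l) → (∀ j → j < l → letter bs j ≡ letter cs j) → bs ≡ cs
  letter-injective [] [] _ = refl
  letter-injective {suc l} (b ∷ bs) (c ∷ cs) e = cong₂ _∷_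
    (trans (sym (letter-head b bs)) (trans (e l Np.≤-refl) (letter-head c cs)))
    (letter-injective bs cs (λ j lt → trans (sym (letter-tail b bs lt)) (trans (e j (Np.m<n⇒m<1+n lt)) (letter-tail c cs lt))))

  presentCount : (ℕ → Bool) → ℕ → ℕ
  presentCount p l = ∑ (List.downFrom l) (ind ∘ p)

  presentCount-cong : ∀ {p q} l → (∀ j → j < l → p j ≡ q j) → presentCount p l ≡ presentCount q l
  presentCount-cong l e = ∑-cong∈ (List.downFrom l) λ j j∈ → cong ind (e j (∈-downFrom⁻ j∈))

  validRow-cong : ∀ {p q} l w → (∀ j → j < l → p j ≡ q j) → validRow p l w ≡ validRow q l w
  validRow-cong zero w e = refl
  validRow-cong {p} {q} (suc l) w e = cong₂ _∧_ (validRow-cong l w e')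
    (cong₂ (λ b v → if b then true else strict l v) (e l Np.≤-refl) (runRow-cong l w e'))
    where
    e' : ∀ j → j < l → p j ≡ q j
    e' j lt = e j (Np.m<n⇒m<1+n lt)

  guard : Bool → ℕ → ℕ
  guard b x = if b then x else 0

  u-strict : ∀ j (f : Fun) w → u j f w ≡ guard (strict j w) (f (stick j w))
  u-strict zero f [] = refl
  u-strict zero f (x ∷ []) = refl
  u-strict zero f (x ∷ y ∷ w) with x <ᵇ y
  ... | true = refl
  ... | false = refl
  u-strict (suc j) f [] = refl
  u-strict (suc j) f (x ∷ w) = u-strict j (f ∘ (x ∷_)) w

  rowTerm : ℕ → Fun → Word → ∀ l → (ℕ → Bool) → ℕ
  rowTerm α f w l p = α ^ presentCount p l * guard (validRow p l w) (f (runRow p l w))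

  -- Multiplying out: the scalar of a factor stands for a present diagonal, the generator for an
  -- absent one, and non-reduced choices contribute zero through `validRow`.
  row-sum : ∀ l α (f : Fun) w → row l α f w ≡ ∑ (bitVecs l) (λ bs → rowTerm α f w l (letter bs))
  row-sum zero α f w = sym (trans (Np.+-identityʳ _) (Np.+-identityʳ _))
  row-sum (suc l) α f w = begin
    row l α (h l α f) w
      ≡⟨ row-sum l α (h l α f) w ⟩
    ∑ (bitVecs l) (λ bs → rowTerm α (h l α f) w l (letter bs))
      ≡⟨ ∑-cong (bitVecs l) (λ bs → split bs) ⟩
    ∑ (bitVecs l) (λ bs → part true bs + part false bs)
      ≡⟨ ∑-add (bitVecs l) (part true) (part false) ⟩
    ∑ (bitVecs l) (part true) + ∑ (bitVecs l) (part false)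
      ≡⟨ cong (∑ (bitVecs l) (part true) +_) (sym (Np.+-identityʳ _)) ⟩
    ∑ (true ∷ false ∷ []) (λ b → ∑ (bitVecs l) (part b))
      ≡⟨ sym (∑-product _∷_ (true ∷ false ∷ []) (bitVecs l) _) ⟩
    ∑ (bitVecs (suc l)) (λ bs → rowTerm α f w (suc l) (letter bs)) ∎
    where
    open ≡-Reasoning
    part : Bool → Vec Bool l → ℕ
    part b bs = rowTerm α f w (suc l) (letter (b ∷ bs))
    module _ (bs : Vec Bool l) where
      p : ℕ → Bool
      p = letter bs
      w' : Word
      w' = runRow p l w
      count-eq : ∀ b → presentCount (letter (b ∷ bs)) (suc l) ≡ ind b + presentCount p l
      count-eq b = cong₂ _+_ (cong ind (letter-head b bs)) (presentCount-cong l (λ j lt → letter-tail b bs lt))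
      run-eq : ∀ b → runRow (letter (b ∷ bs)) l w ≡ w'
      run-eq b = runRow-cong l w (λ j lt → letter-tail b bs lt)
      valid-eq : ∀ b → validRow (letter (b ∷ bs)) l w ≡ validRow p l w
      valid-eq b = validRow-cong l w (λ j lt → letter-tail b bs lt)
      part-eq : ∀ b → part b bs ≡ α ^ (ind b + presentCount p l) *
        guard (validRow p l w ∧ (if b then true else strict l w')) (f (if b then w' else stick l w'))
      part-eq b rewrite count-eq b | run-eq b | valid-eq b | letter-head b bs = refl
      split : rowTerm α (h l α f) w l p ≡ part true bs + part false bs
      split = trans (cong (λ z → α ^ presentCount p l * guard (validRow p l w) (α * f w' + z)) (u-strict l f w'))
        (trans (lem (α ^ presentCount p l) α (f w') (f (stick l w')) (validRow p l w) (strict l w'))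
          (sym (cong₂ _+_ (part-eq true) (part-eq false))))
        where
        lem : ∀ x α y z b c → x * guard b (α * y + guard c z) ≡ α * x * guard (b ∧ true) y + x * guard (b ∧ c) z
        lem x α y z false c = l0 x α
          where
          l0 : ∀ x α → x * 0 ≡ α * x * 0 + x * 0
          l0 = solve-∀
        lem x α y z true true = l1 x α y z
          where
          l1 : ∀ x α y z → x * (α * y + z) ≡ α * x * y + x * z
          l1 = solve-∀
        lem x α y z true false = l1 x α y
          where
          l1 : ∀ x α y → x * (α * y + 0) ≡ α * x * y + x * 0
          l1 = solve-∀

  ∑-downFrom-+ : ∀ a b (f : ℕ → ℕ) → ∑ (List.downFrom (a + b)) f ≡ ∑ (List.downFrom a) f + ∑ (List.downFrom b) (λ j → f (a + j))
  ∑-downFrom-+ a zero f = trans (cong (λ n → ∑ (List.downFrom n) f) (Np.+-identityʳ a)) (sym (Np.+-identityʳ _))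
  ∑-downFrom-+ a (suc b) f = trans (cong (λ n → ∑ (List.downFrom n) f) (Np.+-suc a b))
    (trans (cong (f (a + b) +_) (∑-downFrom-+ a b f)) (+-exchange (f (a + b)) (∑ (List.downFrom a) f) (∑ (List.downFrom b) (λ j → f (a + j)))))

  ∑-all-zero : (xs : List A) {f : A → ℕ} → (∀ x → x ∈ xs → f x ≡ 0) → ∑ xs f ≡ 0
  ∑-all-zero xs e = trans (∑-cong∈ xs e) (∑-zero xs)

  length-filterᵇ-allFin : ∀ n (p : Fin n → Bool) (q : ℕ → Bool) → (∀ i → p i ≡ q (toℕ i)) →
    List.length (List.filterᵇ p (List.allFin n)) ≡ ∑ (List.downFrom n) (ind ∘ q)
  length-filterᵇ-allFin n p q e = trans (go n id q e) (∑-upTo n (ind ∘ q))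
    where
    shift : ∀ N (f : ℕ → ℕ) (h : ℕ → ℕ) → ∑ (List.applyUpTo f N) h ≡ ∑ (List.applyUpTo id N) (h ∘ f)
    shift zero f h = refl
    shift (suc N) f h = cong (h (f 0) +_) (trans (shift N (f ∘ suc) h) (sym (shift N suc (h ∘ f))))
    go : ∀ N (g : Fin N → Fin n) (q : ℕ → Bool) → (∀ i → p (g i) ≡ q (toℕ i)) →
      List.length (List.filterᵇ p (List.tabulate g)) ≡ ∑ (List.upTo N) (ind ∘ q)
    go zero g q e = refl
    go (suc N) g q e with p (g zero) | e zero
    ... | true | e₀ = cong₂ _+_ (cong ind e₀) (trans (go N (g ∘ suc) (q ∘ suc) (e ∘ suc)) (sym (shift N suc (ind ∘ q))))
    ... | false | e₀ = cong₂ _+_ (cong ind e₀) (trans (go N (g ∘ suc) (q ∘ suc) (e ∘ suc)) (sym (shift N suc (ind ∘ q))))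

  lookupℕ-tabulate : ∀ {n} (d : A) (f : ℕ → A) i → i < n → lookupℕ d (Vec.tabulate {n = n} (f ∘ toℕ)) i ≡ f i
  lookupℕ-tabulate {n = suc n} d f zero _ = refl
  lookupℕ-tabulate {n = suc n} d f (suc i) (s≤s lt) = lookupℕ-tabulate d (f ∘ suc) i lt

  module TriangulationEnumeration (k n : ℕ) (nEq : n ≡ suc (k + (k + msz n k))) (1≤k : 1 ≤ k) where
    private
      M : ℕ
      M = msz n k
    open Run k M
    open Crossings k M n nEq 1≤k

    emptyRow : Vec Bool n
    emptyRow = Vec.replicate n false

    -- Canonical form makes the entries up to `a` absent. Trivial diagonals are present: those close
    -- to `a` by the second test, those at the far end because `letter` is true beyond its bits.
    cellValue : ∀ {l} → ℕ → Vec Bool l → ℕ → Bool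
    cellValue a bs b = choose (b ≤? a) false (choose (b ≤? a + k) true (letter bs (b ∸ (a + suc k))))

    makeRow : ℕ → ∀ {l} → Vec Bool l → Vec Bool n
    makeRow a bs = Vec.tabulate (cellValue a bs ∘ toℕ)

    rows : ℕ → List (Vec Bool n)
    rows a = List.map (makeRow a) (bitVecs (rowLength a))

    rowLetters : ℕ → Vec Bool n → ℕ → Bool
    rowLetters a r j = lookupℕ false r (a + (k + suc j))

    cellValue-letter : ∀ {l} a (bs : Vec Bool l) j → cellValue a bs (a + (k + suc j)) ≡ letter bs j
    cellValue-letter a bs j = trans (choose-no (a + (k + suc j) ≤? a) (Np.<⇒≱ (Np.m<m+n a (subst (0 <_) (sym (Np.+-suc k j)) (s≤s z≤n)))))
      (trans (choose-no (a + (k + suc j) ≤? a + k) (Np.<⇒≱ (Np.+-monoʳ-< a (Np.m<m+n k (s≤s z≤n)))))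
        (cong (letter bs) (trans (cong (_∸ (a + suc k)) (l1 a k j)) (Np.m+n∸m≡n (a + suc k) j))))
      where
      l1 : ∀ a k j → a + (k + (1 + j)) ≡ a + (1 + k) + j
      l1 = solve-∀

    rowLetters-makeRow : ∀ a {l} (bs : Vec Bool l) j → j < rowLength a → rowLetters a (makeRow a bs) j ≡ letter bs j
    rowLetters-makeRow a bs j lt = trans (lookupℕ-tabulate false (cellValue a bs) _ (proj₂ (cell⇒nontrivial a j lt))) (cellValue-letter a bs j)

    rows-unique : ∀ a → Unique (rows a)
    rows-unique a = unique-map (bitVecs (rowLength a)) (λ {bs} {cs} _ _ e → letter-injective bs cs (λ j lt →
      trans (sym (rowLetters-makeRow a bs j lt)) (trans (cong (λ r → rowLetters a r j) e) (rowLetters-makeRow a cs j lt))))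
      (bitVecs-unique (rowLength a))

    fillings : ℕ → ∀ N → List (Vec (Vec Bool n) N)
    fillings a zero = [] ∷ []
    fillings a (suc N) = cartesianProductWith _∷_ (rows a) (fillings (suc a) N)

    fillings-unique : ∀ a N → Unique (fillings a N)
    fillings-unique a zero = [] ∷ []
    fillings-unique a (suc N) = Uq.cartesianProductWith⁺ _∷_ Vp.∷-injective (rows-unique a) (fillings-unique (suc a) N)

    ∈-fillings⁺ : ∀ a N (D : Vec (Vec Bool n) N) → (∀ i → i < N → lookupℕ emptyRow D i ∈ rows (a + i)) → D ∈ fillings a N
    ∈-fillings⁺ a zero [] _ = here refl
    ∈-fillings⁺ a (suc N) (r ∷ D) e = ∈-cartesianProductWith⁺ _∷_
      (subst (λ z → r ∈ rows z) (Np.+-identityʳ a) (e 0 (s≤s z≤n)))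
      (∈-fillings⁺ (suc a) N D (λ i lt → subst (λ z → lookupℕ emptyRow D i ∈ rows z) (Np.+-suc a i) (e (suc i) (s≤s lt))))

    ∈-fillings⁻ : ∀ a N {D : Vec (Vec Bool n) N} → D ∈ fillings a N → ∀ i → i < N → lookupℕ emptyRow D i ∈ rows (a + i)
    ∈-fillings⁻ a (suc N) D∈ i lt with ∈-cartesianProductWith⁻ _∷_ (rows a) (fillings (suc a) N) D∈
    ∈-fillings⁻ a (suc N) D∈ zero _ | r , D , p , q , refl = subst (λ z → r ∈ rows z) (sym (Np.+-identityʳ a)) p
    ∈-fillings⁻ a (suc N) D∈ (suc i) (s≤s lt) | r , D , p , q , refl =
      subst (λ z → lookupℕ emptyRow D i ∈ rows z) (sym (Np.+-suc a i)) (∈-fillings⁻ (suc a) N q i lt)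

    -- `Valid` as a recursion over the rows of a filling, which lets the sum over fillings factor
    -- row by row.
    validFrom : ∀ {N} → ℕ → Vec (Vec Bool n) N → Word → Bool
    validFrom a [] w = choose (Lp.≡-dec _≟_ w (target 0 M)) true false
    validFrom a (r ∷ D) w = validRow (rowLetters a r) (rowLength a) w ∧ validFrom (suc a) D (runRow (rowLetters a r) (rowLength a) w)

    Agree : ∀ {N} → (ℕ → ℕ → Bool) → ℕ → Vec (Vec Bool n) N → Set
    Agree e a D = ∀ i j → lookupℕ false (lookupℕ emptyRow D i) j ≡ e (a + i) j

    module _ {N} e a r (D : Vec (Vec Bool n) N) (H : Agree e a (r ∷ D)) where
      agree-tail : Agree e (suc a) D
      agree-tail i j = trans (H (suc i) j) (cong (λ z → e z j) (Np.+-suc a i))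

      agree-head : ∀ j → rowLetters a r j ≡ letters e a j
      agree-head j = trans (H 0 _) (cong (λ z → e z (a + (k + suc j))) (Np.+-identityʳ a))

      agree-runRow : runRow (rowLetters a r) (rowLength a) (state e a) ≡ state e (suc a)
      agree-runRow = runRow-cong (rowLength a) (state e a) (λ j _ → agree-head j)

      agree-validRow : validRow (rowLetters a r) (rowLength a) (state e a) ≡ validRow (letters e a) (rowLength a) (state e a)
      agree-validRow = validRow-cong (rowLength a) (state e a) (λ j _ → agree-head j)

    ValidRowAt : (ℕ → ℕ → Bool) → ℕ → Set
    ValidRowAt e a = validRow (letters e a) (rowLength a) (state e a) ≡ true

    validFrom⇒ : ∀ {N} e a (D : Vec (Vec Bool n) N) → Agree e a D → validFrom a D (state e a) ≡ true →
      (∀ i → i < N → ValidRowAt e (a + i)) × state e (a + N) ≡ target 0 M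
    validFrom⇒ e a [] _ v with Lp.≡-dec _≟_ (state e a) (target 0 M)
    ... | yes eq = (λ i ()) , trans (cong (state e) (Np.+-identityʳ a)) eq
    validFrom⇒ {suc N} e a (r ∷ D) H v with ∧-split {validRow (rowLetters a r) (rowLength a) (state e a)} v
    ... | v₀ , v₁ with validFrom⇒ e (suc a) D (agree-tail e a r D H) (trans (cong (validFrom (suc a) D) (sym (agree-runRow e a r D H))) v₁)
    ...   | vs , fin = valid , trans (cong (state e) (Np.+-suc a N)) fin
      where
      valid : ∀ i → i < suc N → ValidRowAt e (a + i)
      valid zero _ = subst (ValidRowAt e) (sym (Np.+-identityʳ a)) (trans (sym (agree-validRow e a r D H)) v₀)
      valid (suc i) (s≤s lt) = subst (ValidRowAt e) (sym (Np.+-suc a i)) (vs i lt)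

    validFrom⇐ : ∀ {N} e a (D : Vec (Vec Bool n) N) → Agree e a D →
      (∀ i → i < N → ValidRowAt e (a + i)) → state e (a + N) ≡ target 0 M → validFrom a D (state e a) ≡ true
    validFrom⇐ e a [] _ _ fin = choose-yes (Lp.≡-dec _≟_ (state e a) (target 0 M)) (trans (cong (state e) (sym (Np.+-identityʳ a))) fin)
    validFrom⇐ {suc N} e a (r ∷ D) H vs fin = cong₂ _∧_
      (trans (agree-validRow e a r D H) (subst (ValidRowAt e) (Np.+-identityʳ a) (vs 0 (s≤s z≤n))))
      (trans (cong (validFrom (suc a) D) (agree-runRow e a r D H))
        (validFrom⇐ e (suc a) D (agree-tail e a r D H)
          (λ i lt → subst (ValidRowAt e) (Np.+-suc a i) (vs (suc i) (s≤s lt)))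
          (trans (cong (state e) (sym (Np.+-suc a N))) fin)))

    valid? : (D : DiagSet n) → Dec (validFrom 0 D (start 0 M) ≡ true)
    valid? D = validFrom 0 D (start 0 M) Bp.≟ true

    triangulations : List (DiagSet n)
    triangulations = List.filter valid? (fillings 0 n)

    triangulations-unique : Unique triangulations
    triangulations-unique = Uq.filter⁺ valid? (fillings-unique 0 n)

    filling-canonical : ∀ {D} → D ∈ fillings 0 n → Canonical D
    filling-canonical {D} D∈ i j s with ∈-map⁻ (makeRow (toℕ i)) (∈-fillings⁻ 0 n D∈ (toℕ i) (Fp.toℕ<n i))
    ... | bs , _ , eq = Np.≰⇒> λ le → absurd (trans (sym s) (trans (sym (entry-toℕ D i j))
          (trans (cong (λ r → lookupℕ false r (toℕ j)) eq) (trans (lookupℕ-tabulate false (cellValue (toℕ i) bs) (toℕ j) (Fp.toℕ<n j))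
            (choose-yes (toℕ j ≤? toℕ i) le)))))
      where
      absurd : true ≡ false → ⊥
      absurd ()

    cellValue-trivial : ∀ a {b} (bs : Vec Bool (rowLength a)) → a < b → ¬ Nontrivial a b → cellValue a bs b ≡ true
    cellValue-trivial a {b} bs a<b triv = trans (choose-no (b ≤? a) (Np.<⇒≱ a<b)) (by-cases (b ≤? a + k))
      where
      by-cases : Dec (b ≤ a + k) → choose (b ≤? a + k) true (letter bs (b ∸ (a + suc k))) ≡ true
      by-cases (yes le) = choose-yes (b ≤? a + k) le
      by-cases (no nle) = trans (choose-no (b ≤? a + k) nle) (letter-beyond bs j (Np.≮⇒≥ λ lt →
          triv (subst (Nontrivial a) b≡ (proj₁ (cell⇒nontrivial a j lt)))))
        where
        j = b ∸ (a + suc k)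
        l1 : ∀ a k j → a + (k + (1 + j)) ≡ a + (1 + k) + j
        l1 = solve-∀
        b≡ : a + (k + suc j) ≡ b
        b≡ = trans (l1 a k j) (Np.m+[n∸m]≡n (subst (_≤ b) (sym (Np.+-suc a k)) (Np.≰⇒> nle)))

    filling-full : ∀ {D} → D ∈ fillings 0 n → Full (entry D)
    filling-full {D} D∈ a b a<b b<n triv with ∈-map⁻ (makeRow a) (∈-fillings⁻ 0 n D∈ a (Np.<-trans a<b b<n))
    ... | bs , _ , eq = trans (cong (λ r → lookupℕ false r b) eq) (trans (lookupℕ-tabulate false (cellValue a bs) b b<n)
          (cellValue-trivial a bs a<b triv))

    ∈⇒triangulation : ∀ {D} → D ∈ triangulations → IsKTriangulation n k D
    ∈⇒triangulation {D} D∈ with ∈-filter⁻ valid? {xs = fillings 0 n} D∈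
    ... | D∈' , v = valid⇒triangulation D (filling-canonical D∈') (filling-full D∈')
          (validFrom⇒ (entry D) 0 D (λ i j → refl) v)

    canonical-row : ∀ D → Canonical D → Full (entry D) → ∀ a → a < n → lookupℕ emptyRow D a ∈ rows a
    canonical-row D can full a a<n = subst (_∈ rows a) (sym row≡) (∈-map⁺ (makeRow a) (∈-bitVecs bs))
      where
      i : Fin n
      i = fromℕ< a<n
      ia : toℕ i ≡ a
      ia = Fp.toℕ-fromℕ< a<n
      bs : Vec Bool (rowLength a)
      bs = fromLetters (rowLength a) (letters (entry D) a)
      value : ∀ b → b < n → entry D a b ≡ cellValue a bs b
      value b b<n with b ≤? a
      ... | yes b≤a with entry D a b in eq
      ...   | false = refl
      ...   | true = ⊥-elim (Np.<⇒≱ (subst₂ _<_ ia (Fp.toℕ-fromℕ< b<n)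
                (can i (fromℕ< b<n) (trans (sym (entry-toℕ D i (fromℕ< b<n))) (trans (cong₂ (entry D) ia (Fp.toℕ-fromℕ< b<n)) eq)))) b≤a)
      value b b<n | no b≰a with nontrivial? a b
      ... | no triv = trans (full a b (Np.≰⇒> b≰a) b<n triv)
              (trans (sym (cellValue-trivial a bs (Np.≰⇒> b≰a) triv)) (choose-no (b ≤? a) b≰a))
      ... | yes nt with nontrivial⇒cell a b b<n nt
      ...   | j , refl , j< = trans (sym (letter-fromLetters (rowLength a) (letters (entry D) a) j j<))
                (trans (sym (cellValue-letter a bs j)) (choose-no (b ≤? a) b≰a))
      row≡ : lookupℕ emptyRow D a ≡ makeRow a bs
      row≡ = trans (sym (Vp.tabulate∘lookup (lookupℕ emptyRow D a))) (Vp.tabulate-cong λ j →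
        trans (sym (lookupℕ-toℕ false (lookupℕ emptyRow D a) j)) (value (toℕ j) (Fp.toℕ<n j)))

    triangulation⇒∈ : ∀ {D} → IsKTriangulation n k D → D ∈ triangulations
    triangulation⇒∈ {D} tri = ∈-filter⁺ valid?
      (∈-fillings⁺ 0 n D (canonical-row D (proj₁ tri) (triangulation⇒full D tri)))
      (let v , s = triangulation⇒valid D tri in validFrom⇐ (entry D) 0 D (λ i j → refl) v s)

    module _ (x : ℕ → ℕ) where
      weight : ∀ {N} → ℕ → Vec (Vec Bool n) N → ℕ
      weight a [] = 1
      weight a (r ∷ D) = x a ^ presentCount (rowLetters a r) (rowLength a) * weight (suc a) D

      rowProduct : ℕ → ℕ → Fun
      rowProduct a zero = indicator (target 0 M)
      rowProduct a (suc N) = row (rowLength a) (x a) (rowProduct (suc a) N)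

      fillings-sum : ∀ N a w → ∑ (fillings a N) (λ D → guard (validFrom a D w) (weight a D)) ≡ rowProduct a N w
      fillings-sum zero a w with Lp.≡-dec _≟_ w (target 0 M)
      ... | yes _ = refl
      ... | no _ = refl
      fillings-sum (suc N) a w = begin
        ∑ (fillings a (suc N)) (λ D → guard (validFrom a D w) (weight a D))
          ≡⟨ ∑-product _∷_ (rows a) (fillings (suc a) N) _ ⟩
        ∑ (rows a) (λ r → ∑ (fillings (suc a) N) (λ D → guard (validFrom a (r ∷ D) w) (weight a (r ∷ D))))
          ≡⟨ ∑-map (makeRow a) (bitVecs (rowLength a)) _ ⟩
        ∑ (bitVecs (rowLength a)) (λ bs → ∑ (fillings (suc a) N) (λ D → guard (validFrom a (makeRow a bs ∷ D) w) (weight a (makeRow a bs ∷ D))))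
          ≡⟨ ∑-cong (bitVecs (rowLength a)) term ⟩
        ∑ (bitVecs (rowLength a)) (λ bs → rowTerm (x a) (rowProduct (suc a) N) w (rowLength a) (letter bs))
          ≡⟨ sym (row-sum (rowLength a) (x a) (rowProduct (suc a) N) w) ⟩
        rowProduct a (suc N) w ∎
        where
        open ≡-Reasoning
        l = rowLength a
        guard-∧ : ∀ b c p q → guard (b ∧ c) (p * q) ≡ p * guard b 1 * guard c q
        guard-∧ true true p q = cong (_* q) (sym (Np.*-identityʳ p))
        guard-∧ true false p q = sym (Np.*-zeroʳ (p * 1))
        guard-∧ false c p q = sym (cong (_* guard c q) (Np.*-zeroʳ p))
        guard-* : ∀ b p q → p * guard b 1 * q ≡ p * guard b q
        guard-* true p q = cong (_* q) (Np.*-identityʳ p)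
        guard-* false p q = trans (cong (_* q) (Np.*-zeroʳ p)) (sym (Np.*-zeroʳ p))
        term : ∀ bs → ∑ (fillings (suc a) N) (λ D → guard (validFrom a (makeRow a bs ∷ D) w) (weight a (makeRow a bs ∷ D))) ≡
          rowTerm (x a) (rowProduct (suc a) N) w l (letter bs)
        term bs = begin
          ∑ (fillings (suc a) N) (λ D → guard (validRow p l w ∧ validFrom (suc a) D (runRow p l w)) (x a ^ presentCount p l * weight (suc a) D))
            ≡⟨ ∑-cong (fillings (suc a) N) (λ D → guard-∧ (validRow p l w) (validFrom (suc a) D (runRow p l w)) (x a ^ presentCount p l) (weight (suc a) D)) ⟩
          ∑ (fillings (suc a) N) (λ D → x a ^ presentCount p l * guard (validRow p l w) 1 * guard (validFrom (suc a) D (runRow p l w)) (weight (suc a) D))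
            ≡⟨ ∑-scale (x a ^ presentCount p l * guard (validRow p l w) 1) (fillings (suc a) N) _ ⟩
          x a ^ presentCount p l * guard (validRow p l w) 1 * ∑ (fillings (suc a) N) (λ D → guard (validFrom (suc a) D (runRow p l w)) (weight (suc a) D))
            ≡⟨ guard-* (validRow p l w) (x a ^ presentCount p l) _ ⟩
          x a ^ presentCount p l * guard (validRow p l w) (∑ (fillings (suc a) N) (λ D → guard (validFrom (suc a) D (runRow p l w)) (weight (suc a) D)))
            ≡⟨ cong (λ z → x a ^ presentCount p l * guard (validRow p l w) z) (fillings-sum N (suc a) (runRow p l w)) ⟩
          rowTerm (x a) (rowProduct (suc a) N) w l p
            ≡⟨ same ⟩
          rowTerm (x a) (rowProduct (suc a) N) w l (letter bs) ∎
          where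
          p : ℕ → Bool
          p = rowLetters a (makeRow a bs)
          same : rowTerm (x a) (rowProduct (suc a) N) w l p ≡ rowTerm (x a) (rowProduct (suc a) N) w l (letter bs)
          same rewrite presentCount-cong {p} {letter bs} l (λ j lt → rowLetters-makeRow a bs j lt)
                     | validRow-cong {p} {letter bs} l w (λ j lt → rowLetters-makeRow a bs j lt)
                     | runRow-cong {p} {letter bs} l w (λ j lt → rowLetters-makeRow a bs j lt) = refl

      open PipeOperators (λ l → x (K ∸ l))

      rowProduct-trivial : ∀ N a → K ≤ a → ∀ w → rowProduct a N w ≡ indicator (target 0 M) w
      rowProduct-trivial zero a _ w = refl
      rowProduct-trivial (suc N) a K≤a w rewrite Np.m≤n⇒m∸n≡0 K≤a | Np.⊓-zeroʳ M = rowProduct-trivial N (suc a) (Np.m≤n⇒m≤1+n K≤a) w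

      -- Row `a = K - l` has `l` letters and weight `x (K - l)`, the value of `s l` in this
      -- instance. Rows from `K` on are empty.
      rowProduct-tail : ∀ l N a → a + l ≡ K → l ≤ M → l ≤ N → ∀ w → rowProduct a N w ≡ tailRows (suc l) (indicator (target 0 M)) w
      rowProduct-tail zero N a e _ _ w = rowProduct-trivial N a (Np.≤-reflexive (trans (sym e) (Np.+-identityʳ a))) w
      rowProduct-tail (suc l) (suc N) a e l≤m (s≤s l≤N) w = trans
        (cong₂ (λ r b → row r (x b) (rowProduct (suc a) N) w) rl (trans (sym (Np.m∸[m∸n]≡n a≤K)) (cong (K ∸_) rl')))
        (row-cong (suc l) (x (K ∸ suc l)) (rowProduct-tail l N (suc a) (trans (sym (Np.+-suc a l)) e) (Np.<⇒≤ l≤m) l≤N) w)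
        where
        a≤K : a ≤ K
        a≤K = subst (a ≤_) e (Np.m≤m+n a (suc l))
        rl' : K ∸ a ≡ suc l
        rl' = trans (cong (_∸ a) (sym e)) (Np.m+n∸m≡n a (suc l))
        rl : rowLength a ≡ suc l
        rl = trans (cong (M ⊓_) rl') (Np.m≥n⇒m⊓n≡n l≤m)

      -- For `i ≤ k` one has `K - i ≥ M`, so the first `k + 1` rows all have the full `M` letters.
      rowProduct-front : ∀ r i N (f : ℕ → ℕ) → (∀ j → f j ≡ x (i + j)) → i + r ≤ suc k → ∀ w →
        rowProduct i (r + N) w ≡ foldr (row M) (rowProduct (i + r) N) (List.applyUpTo f r) w
      rowProduct-front zero i N f e _ w = cong (λ a → rowProduct a N w) (sym (Np.+-identityʳ i))
      rowProduct-front (suc r) i N f e le w = trans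
        (cong₂ (λ l α → row l α (rowProduct (suc i) (r + N)) w) rl (sym (trans (e 0) (cong x (Np.+-identityʳ i)))))
        (trans (row-cong M (f 0) (rowProduct-front r (suc i) N (f ∘ suc) (λ j → trans (e (suc j)) (cong x (Np.+-suc i j))) le') w)
          (cong (λ a → row M (f 0) (foldr (row M) (rowProduct a N) (List.applyUpTo (f ∘ suc) r)) w) (sym (Np.+-suc i r))))
        where
        le' : suc i + r ≤ suc k
        le' = subst (_≤ suc k) (Np.+-suc i r) le
        rl : rowLength i ≡ M
        rl = Np.m≤n⇒m⊓n≡m (Np.m+n≤o⇒m≤o∸n M (subst (M + i ≤_) (Np.+-comm M k) (Np.+-monoʳ-≤ M (Np.≤-pred (Np.≤-trans (s≤s (Np.m≤m+n i r)) le')))))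

      rowProduct-back : ∀ l → l ≡ M → ∀ w → rowProduct (suc k) K w ≡ tailRows l (indicator (target 0 M)) w
      rowProduct-back zero e w = rowProduct-trivial K (suc k) (subst (_≤ suc k) (trans (sym (Np.+-identityʳ k)) (cong (k +_) e)) (Np.n≤1+n k)) w
      rowProduct-back (suc l) e w = rowProduct-tail l K (suc k) (trans (sym (Np.+-suc k l)) (cong (k +_) e))
        (Np.<⇒≤ (Np.≤-reflexive e)) (Np.≤-trans (Np.<⇒≤ (Np.≤-reflexive e)) (Np.m≤n+m M k)) w

      rowProduct-pipeSum : rowProduct 0 n (start 0 M) ≡ pipeSum M 0 (List.applyUpTo x (suc k))
      rowProduct-pipeSum = trans (cong (λ N → rowProduct 0 N (start 0 M)) nEq)
        (trans (rowProduct-front (suc k) 0 K x (λ _ → refl) Np.≤-refl (start 0 M))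
          (foldr-row-cong M (List.applyUpTo x (suc k)) (rowProduct-back M refl) (start 0 M)))

    nontrivial-tests : ∀ a b y → a < n → b < n → Nontrivial a b → ((a <ᵇ b) ∧ y ∧ (k <ᵇ ((b ∸ a) ⊓ (n ∸ (b ∸ a))))) ≡ y
    nontrivial-tests a b y a<n b<n (p , q) = trans
      (cong₂ (λ c d → c ∧ y ∧ d) (<⇒<ᵇ≡true {a} {b} (Np.≤-<-trans (Np.m≤m+n a k) p))
        (<⇒<ᵇ≡true {k} {(b ∸ a) ⊓ (n ∸ (b ∸ a))} (Np.⊓-glb k<₁ k<₂)))
      (Bp.∧-identityʳ y)
      where
      a≤b : a ≤ b
      a≤b = Np.≤-trans (Np.m≤m+n a k) (Np.<⇒≤ p)
      k<₁ : k < b ∸ a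
      k<₁ = Np.m+n≤o⇒m≤o∸n (suc k) (subst (_≤ b) (cong suc (Np.+-comm a k)) p)
      k<₂ : k < n ∸ (b ∸ a)
      k<₂ = Np.m+n≤o⇒m≤o∸n (suc k) (Np.+-cancelˡ-≤ a _ _ (subst (_≤ a + n) (trans (cong (λ z → suc (z + k)) (sym (Np.m+[n∸m]≡n a≤b))) (l1 a (b ∸ a) k)) q))
        where
        l1 : ∀ a d k → 1 + (a + d + k) ≡ a + (1 + k + d)
        l1 = solve-∀

    trivial-tests : ∀ a b y → b < n → ¬ Nontrivial a b → ((a <ᵇ b) ∧ y ∧ (k <ᵇ ((b ∸ a) ⊓ (n ∸ (b ∸ a))))) ≡ false
    trivial-tests a b y b<n triv with (a <ᵇ b) in e₁ | y | (k <ᵇ ((b ∸ a) ⊓ (n ∸ (b ∸ a)))) in e₂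
    ... | false | _ | _ = refl
    ... | true | false | _ = refl
    ... | true | true | false = refl
    ... | true | true | true = ⊥-elim (triv (p , q))
      where
      a<b : a < b
      a<b = Np.<ᵇ⇒< a b (subst T (sym e₁) tt)
      k< : k < (b ∸ a) ⊓ (n ∸ (b ∸ a))
      k< = Np.<ᵇ⇒< k _ (subst T (sym e₂) tt)
      p : a + k < b
      p = subst₂ _≤_ (Np.+-suc a k) (Np.m+[n∸m]≡n (Np.<⇒≤ a<b)) (Np.+-monoʳ-≤ a (Np.≤-trans k< (Np.m⊓n≤m _ _)))
      d≤n : b ∸ a ≤ n
      d≤n = Np.≤-trans (Np.m∸n≤m b a) (Np.<⇒≤ b<n)
      q : b + k < a + n
      q = subst₂ _≤_ (trans (l1 a (b ∸ a) k) (cong (λ z → suc (z + k)) (Np.m+[n∸m]≡n (Np.<⇒≤ a<b)))) (cong (a +_) (Np.m+[n∸m]≡n d≤n))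
        (Np.+-monoʳ-≤ a (Np.+-monoʳ-≤ (b ∸ a) (Np.≤-trans k< (Np.m⊓n≤n _ _))))
        where
        l1 : ∀ a d k → a + (d + (1 + k)) ≡ 1 + (a + d + k)
        l1 = solve-∀

    row-end : ∀ a → a ≤ K → Σ ℕ λ o → (a + suc k) + (rowLength a + o) ≡ n
    row-end a a≤K with Np.m≤n⇒∃[o]m+o≡n {rowLength a} {K ∸ a} (Np.m⊓n≤n M (K ∸ a))
    ... | o , eq = o , trans (cong (a + suc k +_) eq) (trans (l1 a k (K ∸ a)) (trans (cong (λ z → suc (k + z)) (Np.m+[n∸m]≡n a≤K)) (sym nEq)))
      where
      l1 : ∀ a k r → a + (1 + k) + r ≡ 1 + (k + (a + r))
      l1 = solve-∀

    -- The vertices fall into three blocks: those up to `a + k`, the `rowLength a` ends of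
    -- nontrivial diagonals, and the `o` remaining ones, which are at distance at most `k` round the
    -- other side. The outer blocks fail the tests in `deg`.
    deg-presentCount : ∀ D v → toℕ v ≤ K → deg n k D v ≡ presentCount (letters (entry D) (toℕ v)) (rowLength (toℕ v))
    deg-presentCount D v v≤K = begin
      deg n k D v
        ≡⟨ length-filterᵇ-allFin n _ G (λ j → cong (λ y → (a <ᵇ toℕ j) ∧ y ∧ (k <ᵇ ((toℕ j ∸ a) ⊓ (n ∸ (toℕ j ∸ a))))) (sym (entry-toℕ D v j))) ⟩
      ∑ (List.downFrom n) (ind ∘ G)
        ≡⟨ cong (λ N → ∑ (List.downFrom N) (ind ∘ G)) (sym end) ⟩
      ∑ (List.downFrom ((a + suc k) + (l + o))) (ind ∘ G)
        ≡⟨ ∑-downFrom-+ (a + suc k) (l + o) (ind ∘ G) ⟩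
      ∑ (List.downFrom (a + suc k)) (ind ∘ G) + ∑ (List.downFrom (l + o)) (λ j → ind (G (a + suc k + j)))
        ≡⟨ cong₂ _+_ (∑-all-zero (List.downFrom (a + suc k)) (λ b b∈ → early b (∈-downFrom⁻ b∈))) (∑-downFrom-+ l o (λ j → ind (G (a + suc k + j)))) ⟩
      ∑ (List.downFrom l) (λ j → ind (G (a + suc k + j))) + ∑ (List.downFrom o) (λ j → ind (G (a + suc k + (l + j))))
        ≡⟨ cong₂ _+_ (∑-cong∈ (List.downFrom l) (λ j j∈ → middle j (∈-downFrom⁻ j∈))) (∑-all-zero (List.downFrom o) (λ j j∈ → late j (∈-downFrom⁻ j∈))) ⟩
      presentCount (letters (entry D) a) l + 0
        ≡⟨ Np.+-identityʳ _ ⟩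
      presentCount (letters (entry D) a) l ∎
      where
      open ≡-Reasoning
      a = toℕ v
      l = rowLength a
      o = proj₁ (row-end a v≤K)
      end = proj₂ (row-end a v≤K)
      G : ℕ → Bool
      G b = (a <ᵇ b) ∧ entry D a b ∧ (k <ᵇ ((b ∸ a) ⊓ (n ∸ (b ∸ a))))
      l1 : ∀ a k j → a + (1 + k) + j ≡ a + (k + (1 + j))
      l1 = solve-∀
      early : ∀ b → b < a + suc k → ind (G b) ≡ 0
      early b lt = cong ind (trivial-tests a b (entry D a b) (Np.<-≤-trans lt (subst (a + suc k ≤_) end (Np.m≤m+n _ _)))
        (λ nt → Np.<⇒≱ (proj₁ nt) (Np.≤-pred (subst (b <_) (Np.+-suc a k) lt))))
      middle : ∀ j → j < l → ind (G (a + suc k + j)) ≡ ind (letters (entry D) a j)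
      middle j lt = cong ind (trans (cong G (l1 a k j))
        (nontrivial-tests a _ _ (Fp.toℕ<n v) (proj₂ (cell⇒nontrivial a j lt)) (proj₁ (cell⇒nontrivial a j lt))))
      late : ∀ j → j < o → ind (G (a + suc k + (l + j))) ≡ 0
      late j lt = cong ind (trivial-tests a _ _ b<n beyond)
        where
        b<n : a + suc k + (l + j) < n
        b<n = subst (a + suc k + (l + j) <_) end (Np.+-monoʳ-< (a + suc k) (Np.+-monoʳ-< l lt))
        beyond : ¬ Nontrivial a (a + suc k + (l + j))
        beyond nt with nontrivial⇒cell a _ b<n nt
        ... | j' , eq , j'< = Np.<⇒≱ j'< (subst (l ≤_) (Np.suc-injective (Np.+-cancelˡ-≡ k _ _ (Np.+-cancelˡ-≡ a _ _ (trans (sym (l1 a k (l + j))) eq)))) (Np.m≤m+n l j))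

    module _ (x : ℕ → ℕ) where
      -- A filling has `n` rows but the degree sequence only `n - k - 1` entries, hence two lengths;
      -- the surplus rows have no letters and contribute 1.
      weight-monomial : ∀ N {N'} a (D : Vec (Vec Bool n) N') (c f : ℕ → ℕ) → (∀ j → f j ≡ x (a + j)) → N ≤ N' →
        (∀ i → i < N' → presentCount (rowLetters (a + i) (lookupℕ emptyRow D i)) (rowLength (a + i)) ≡ c i) →
        (∀ i → N ≤ i → i < N' → c i ≡ 0) → weight x a D ≡ monomial f (Vec.tabulate {n = N} (c ∘ toℕ))
      weight-monomial zero a [] c f ef _ e z = refl
      weight-monomial zero a (r ∷ D) c f ef _ e z = trans
        (cong₂ (λ p q → x a ^ p * q)
          (trans (subst (λ b → presentCount (rowLetters b r) (rowLength b) ≡ c 0) (Np.+-identityʳ a) (e 0 (s≤s z≤n))) (z 0 z≤n (s≤s z≤n)))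
          (weight-monomial zero (suc a) D (c ∘ suc) (λ j → x (suc a + j)) (λ _ → refl) z≤n
            (λ i lt → subst (λ b → presentCount (rowLetters b (lookupℕ emptyRow D i)) (rowLength b) ≡ c (suc i)) (Np.+-suc a i) (e (suc i) (s≤s lt)))
            (λ i _ lt → z (suc i) z≤n (s≤s lt))))
        refl
      weight-monomial (suc N) a (r ∷ D) c f ef (s≤s le) e z = cong₂ _*_
        (cong₂ _^_ (sym (trans (ef 0) (cong x (Np.+-identityʳ a))))
          (subst (λ b → presentCount (rowLetters b r) (rowLength b) ≡ c 0) (Np.+-identityʳ a) (e 0 (s≤s z≤n))))
        (weight-monomial N (suc a) D (c ∘ suc) (f ∘ suc) (λ j → trans (ef (suc j)) (cong x (Np.+-suc a j))) le
          (λ i lt → subst (λ b → presentCount (rowLetters b (lookupℕ emptyRow D i)) (rowLength b) ≡ c (suc i)) (Np.+-suc a i) (e (suc i) (s≤s lt)))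
          (λ i le' lt → z (suc i) (s≤s le') (s≤s lt)))

      degrees-monomial : ∀ D → monomial x (degSeq n k D) ≡ weight x 0 D
      degrees-monomial D = trans
        (cong (monomial x) (Vp.tabulate-cong λ j → trans
          (deg-presentCount D _ (subst (_≤ K) (sym (Fp.toℕ-inject≤ j _)) (Np.<⇒≤ (subst (toℕ j <_) size (Fp.toℕ<n j)))))
          (cong c (Fp.toℕ-inject≤ j _))))
        (sym (weight-monomial (n ∸ k ∸ 1) 0 D c x (λ _ → refl)
          (Np.≤-trans (Np.m∸n≤m (n ∸ k) 1) (Np.m∸n≤m n k))
          (λ i _ → refl)
          (λ i le _ → cong (presentCount (letters (entry D) i)) (trans (cong (M ⊓_) (Np.m≤n⇒m∸n≡0 (subst (_≤ i) size le))) (Np.⊓-zeroʳ M)))))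
        where
        c : ℕ → ℕ
        c i = presentCount (letters (entry D) i) (rowLength i)
        size : n ∸ k ∸ 1 ≡ K
        size = trans (Np.∸-+-assoc n k 1) (trans (cong₂ _∸_ nEq (Np.+-comm k 1)) (Np.m+n∸m≡n k K))

      triangulations-sum : ∑ triangulations (monomial x ∘ degSeq n k) ≡
        PipeOperators.pipeSum (λ l → x (K ∸ l)) M 0 (List.applyUpTo x (suc k))
      triangulations-sum = begin
        ∑ triangulations (monomial x ∘ degSeq n k)
          ≡⟨ ∑-filter valid? (fillings 0 n) _ ⟩
        ∑ (fillings 0 n) (λ D → when (valid? D) (monomial x (degSeq n k D)))
          ≡⟨ ∑-cong (fillings 0 n) (λ D → trans (when-guard (validFrom 0 D (start 0 M)) _) (cong (guard (validFrom 0 D (start 0 M))) (degrees-monomial D))) ⟩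
        ∑ (fillings 0 n) (λ D → guard (validFrom 0 D (start 0 M)) (weight x 0 D))
          ≡⟨ fillings-sum x n 0 (start 0 M) ⟩
        rowProduct x 0 n (start 0 M)
          ≡⟨ rowProduct-pipeSum x ⟩
        PipeOperators.pipeSum (λ l → x (K ∸ l)) M 0 (List.applyUpTo x (suc k)) ∎
        where
        open ≡-Reasoning
        when-guard : ∀ b c → when (b Bp.≟ true) c ≡ guard b c
        when-guard true c = refl
        when-guard false c = refl

-- Assembling the bijection.

open Sums
open Comparison using (module Equality)
open Coefficients
open PathChains using (unique-map)
open PathTuples using (module PathEnumeration; module Exponents)
open Triangulations
open import Data.List.Membership.Propositional using (_∈_)
open import Data.List.Membership.Propositional.Properties using (∈-downFrom⁻; ∈-map⁻; ∈-applyUpTo⁻)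
open import Data.List.Relation.Unary.Unique.Propositional using (Unique)
open import Function.Bundles using (Inverse)
open import Defs

vertices≡ : ∀ k n → 2 * k + 1 ≤ n → n ≡ suc (k + (k + msz n k))
vertices≡ k n le = trans (sym (Np.m+[n∸m]≡n le))
  (trans (cong (2 * k + 1 +_) (sym (Np.∸-+-assoc n (2 * k) 1))) (lem k (msz n k)))
  where
  lem : ∀ k m → 2 * k + 1 + m ≡ 1 + (k + (k + m))
  lem = solve-∀

-- The full rows use the indices `0, ..., k`; the weights of the shorter rows use `k + m - l` with
-- `l < m`, which exceed `k`.
row-weights-unique : ∀ k m (x : ℕ → ℕ) → (∀ i j → x i ≡ x j → i ≡ j) →
  Unique (List.applyUpTo x (suc k) ++ List.map (λ l → x (k + m ∸ l)) (List.downFrom m))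
row-weights-unique k m x inj = Uq.++⁺
  (Uq.applyUpTo⁺₁ x (suc k) (λ i<j _ e → Np.<⇒≢ i<j (inj _ _ e)))
  (unique-map (List.downFrom m) (λ a∈ b∈ e → Np.∸-cancelˡ-≡ (below a∈) (below b∈) (inj _ _ e)) (Uq.downFrom⁺ m))
  disjoint
  where
  below : ∀ {l} → l ∈ List.downFrom m → l ≤ k + m
  below l∈ = Np.≤-trans (Np.<⇒≤ (∈-downFrom⁻ l∈)) (Np.m≤n+m m k)
  disjoint : ∀ {v} → v ∈ List.applyUpTo x (suc k) × v ∈ List.map (λ l → x (k + m ∸ l)) (List.downFrom m) → ⊥
  disjoint (p , q) with ∈-applyUpTo⁻ x p | ∈-map⁻ _ q
  ... | i , s≤s i≤k , refl | l , l∈ , e = Np.<⇒≱ (Exponents.K∸z>k k m (∈-downFrom⁻ l∈)) (subst (_≤ k) (inj _ _ e) i≤k)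

theorem7p4 : (k n : ℕ) → 1 ≤ k → 2 * k + 1 ≤ n → (d : Vec ℕ (n ∸ k ∸ 1)) →
    Inverse (KTriSetoid n k d) (PathSetoid n k d)
theorem7p4 k n 1≤k 2k<n d = fibres-inverse triangulations pathTuples (degSeq n k) prediction
  triangulations-unique pathTuples-unique d triangulation⇒∈ ∈⇒triangulation InD⇒∈ ∈⇒InD
  (λ {Ps} matches → trans (Vp.tabulate-cong (λ j → sym (matches j))) (Vp.tabulate∘lookup d))
  (λ {Ps} e j → trans (cong (λ v → Vec.lookup v j) (sym e)) (Vp.lookup∘tabulate _ j))
  (λ x inj → trans (triangulations-sum x) (trans
    (sym (Equality.pathSum≡pipeSum (λ l → x (k + msz n k ∸ l)) (msz n k) 0 (List.applyUpTo x (suc k)) (λ ())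
      (row-weights-unique k (msz n k) x inj)))
    (sym (pathTuples-sum x))))
  where
  nEq : n ≡ suc (k + (k + msz n k))
  nEq = vertices≡ k n 2k<n
  open TriangulationEnumeration k n nEq 1≤k using (triangulations; triangulations-unique; triangulation⇒∈; ∈⇒triangulation; triangulations-sum)
  open PathEnumeration k n nEq using (prediction; pathTuples; pathTuples-unique; pathTuples-sum; InD⇒∈; ∈⇒InD)
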